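{- Let $a$ be a non-negative integer, let $b$ be an odd positive integer, let $n:=2^ab$ with $n\geq 3$, and let $k$ be a positive integer with $k\leq n-1$. Then the Praeger-Xu graph $\mathrm{PX}(n,k)$ is a Cayley graph if, and only if, $k$ can be written as $$k=\sum_{d\mid b}\alpha_d\,\omega(d)$$ for some integers $\alpha_d$ (one for each positive divisor $d$ of $b$) with $$0\leq \alpha_d\leq \frac{2^a\varphi(d)}{\omega(d)}.$$
   Context: For integers $n\geq 3$ and $1\leq k\leq n-1$, the Praeger-Xu graph $\mathrm{PX}(n,k)$ is the finite simple undirected graph with vertex set $\mathbb{Z}_n\times \mathbb{Z}_2^k$ (so it has $n2^k$ vertices), in which, for every $i\in\mathbb{Z}_n$ and all $x_0,x_1,\ldots,x_{k}\in\mathbb{Z}_2$, the vertex $(i,(x_0,x_1,\ldots,x_{k-1}))$ is adjacent to the vertex $(i+1,(x_1,\ldots,x_{k-1},x_k))$, and there are no other adjacencies. (For $k=1$ this means that $(i,x)$ is adjacent to $(i+1,y)$ for all $i\in\mathbb{Z}_n$ and $x,y\in\mathbb{Z}_2$.) A graph is a Cayley graph if it is isomorphic to $\mathrm{Cay}(G,S)$ for some group $G$ and some subset $S\subseteq G\setminus\{1\}$ with $S=S^{ -1}$, where $\mathrm{Cay}(G,S)$ has vertex set $G$ and $g$ is adjacent to $h$ exactly when $hg^{ -1}\in S$; equivalently, its automorphism group contains a subgroup acting regularly on the vertices. $\varphi$ denotes the Euler $\varphi$-function. For an odd positive integer $d$, $\omega(d):=\min\{c\in\mathbb{N}\mid c\geq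 1,\ d\text{ divides }2^c-1\}$ is the multiplicative order of $2$ modulo $d$; in particular $\omega(1)=1$. -}

module Defs where

open import Algebra.Bundles using (Group)
import Algebra.Properties.Group as GroupProperties
open import Data.Fin.Base using (Fin; toℕ)
open import Data.Fin.Properties using (nonZeroIndex; toℕ-fromℕ<; toℕ<n; pigeonhole)
open import Data.List.Base using (List; length; map; filter; upTo)
open import Data.Nat.Base
open import Data.Nat.Coprimality using (Coprime; coprime?; coprime-divisor)
open import Data.Nat.Divisibility
open import Data.Nat.DivMod using (_mod_; m<n⇒m%n≡m; n%n≡0; m≡m%n+[m/n]*n)
open import Data.Nat.Primality using (prime?; prime⇒irreducible)
open import Data.Nat.Properties
open import Data.Product.Base using (_×_; _,_; proj₁; Σ; ∃-syntax)
open import Data.Sum.Base using (_⊎_; inj₁; inj₂; swap)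
open import Data.Vec.Base using (Vec; init; tail)
open import Function.Base using (_∘_)
open import Function.Bundles using (Inverse; _⇔_)
open import Level using (0ℓ)
open import Relation.Binary.Bundles using (Setoid)
open import Relation.Binary.Core using (Rel)
open import Relation.Binary.Definitions using (Symmetric; Irreflexive; _Respects_; _Respects₂_)
open import Relation.Binary.PropositionalEquality
  using (_≡_; refl; sym; trans; cong; subst; setoid; module ≡-Reasoning)
open import Relation.Nullary using (¬_; yes; no; contradiction)
open import Relation.Nullary.Decidable using (from-yes)
open import Relation.Unary using (Pred; Decidable; _∈_; _∉_)

------------------------------------------------------------------------
-- Simple graphs and Cayley graphs

-- Vertices form a setoid so that the elements of a `Group` can be vertices.

record SimpleGraph : Set₁ where
  field
    vertices : Setoid 0ℓ 0ℓ

  open Setoid vertices public using (_≈_) renaming (Carrier to Vertex)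

  field
    Adj        : Rel Vertex 0ℓ
    Adj-resp   : Adj Respects₂ _≈_
    Adj-sym    : Symmetric Adj
    Adj-irrefl : Irreflexive _≈_ Adj

infix 4 _≅_

record _≅_ (Γ Δ : SimpleGraph) : Set where
  private
    module Γ = SimpleGraph Γ
    module Δ = SimpleGraph Δ

  field
    bijection : Inverse Γ.vertices Δ.vertices

  open Inverse bijection public using (to; from)

  field
    preserves : ∀ u v → Γ.Adj u v ⇔ Δ.Adj (to u) (to v)

record ConnectionSet (G : Group 0ℓ 0ℓ) : Set₁ where
  open Group G

  field
    S     : Pred Carrier 0ℓ
    resp  : S Respects _≈_
    ε∉S   : ε ∉ S
    S⁻¹⊆S : ∀ {s} → s ∈ S → s ⁻¹ ∈ S

Cay : (G : Group 0ℓ 0ℓ) → ConnectionSet G → SimpleGraph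
Cay G C = record
  { vertices   = G.setoid
  ; Adj        = λ g h → (h G.∙ g G.⁻¹) ∈ S
  ; Adj-resp   = (λ h≈h′ → resp (G.∙-congʳ h≈h′))
               , (λ g≈g′ → resp (G.∙-congˡ (G.⁻¹-cong g≈g′)))
  ; Adj-sym    = λ hg⁻¹∈S → resp [hg⁻¹]⁻¹≈gh⁻¹ (S⁻¹⊆S hg⁻¹∈S)
  ; Adj-irrefl = λ {g} g≈h hg⁻¹∈S →
      ε∉S (resp (G.trans (G.∙-congʳ (G.sym g≈h)) (G.inverseʳ g)) hg⁻¹∈S)
  }
  where
  module G = Group G
  open GroupProperties G using (⁻¹-anti-homo-∙; ⁻¹-involutive)
  open ConnectionSet C

  [hg⁻¹]⁻¹≈gh⁻¹ : ∀ {g h} → (h G.∙ g G.⁻¹) G.⁻¹ G.≈ (g G.∙ h G.⁻¹)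
  [hg⁻¹]⁻¹≈gh⁻¹ {g} {h} =
    G.trans (⁻¹-anti-homo-∙ h (g G.⁻¹)) (G.∙-congʳ (⁻¹-involutive g))

IsCayleyGraph : SimpleGraph → Set₁
IsCayleyGraph Γ = ∃[ G ] Σ (ConnectionSet G) λ S → Γ ≅ Cay G S

------------------------------------------------------------------------
-- Praeger–Xu graphs

-- i ↦ i + 1 on ℤₙ, represented by Fin n.

next : ∀ {n} → Fin n → Fin n
next {n} i = suc (toℕ i) mod n
  where instance _ = nonZeroIndex i

PXVertex : ℕ → ℕ → Set
PXVertex n k = Fin n × Vec (Fin 2) k

-- With x = (x₀, …, xₖ): init x = (x₀, …, xₖ₋₁) and tail x = (x₁, …, xₖ).

data Arc {n k : ℕ} : Rel (PXVertex n k) 0ℓ where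
  arc : (i : Fin n) (x : Vec (Fin 2) (suc k)) → Arc (i , init x) (next i , tail x)

next-no-fixpoint : ∀ {n} → 3 ≤ n → (i : Fin n) → ¬ (next i ≡ i)
next-no-fixpoint {n} n≥3 i next-i≡i with m≤n⇒m<n∨m≡n (toℕ<n i)
... | inj₁ 1+i<n = 1+n≢n (begin
  suc (toℕ i)      ≡⟨ m<n⇒m%n≡m 1+i<n ⟨
  suc (toℕ i) % n  ≡⟨ toℕ-fromℕ< _ ⟨
  toℕ (next i)     ≡⟨ cong toℕ next-i≡i ⟩
  toℕ i            ∎)
  where
  open ≡-Reasoning
  instance _ = nonZeroIndex i
... | inj₂ 1+i≡n = contradiction (subst (3 ≤_) n≡1 n≥3) λ { (s≤s ()) }
  where
  open ≡-Reasoning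
  instance _ = nonZeroIndex i
  n≡1 : n ≡ 1
  n≡1 = begin
    n                      ≡⟨ 1+i≡n ⟨
    suc (toℕ i)            ≡⟨ cong (suc ∘ toℕ) next-i≡i ⟨
    suc (toℕ (next i))     ≡⟨ cong suc (toℕ-fromℕ< _) ⟩
    suc (suc (toℕ i) % n)  ≡⟨ cong (λ m → suc (m % n)) 1+i≡n ⟩
    suc (n % n)            ≡⟨ cong suc (n%n≡0 n) ⟩
    1                      ∎

PX : (n k : ℕ) → 3 ≤ n → SimpleGraph
PX n k n≥3 = record
  { vertices   = setoid (PXVertex n k)
  ; Adj        = λ u v → Arc u v ⊎ Arc v u
  ; Adj-resp   = (λ { refl e → e }) , (λ { refl e → e })
  ; Adj-sym    = swap
  ; Adj-irrefl = λ { refl (inj₁ e) → no-loop refl e ; refl (inj₂ e) → no-loop refl e }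
  }
  where
  no-loop : {u v : PXVertex n k} → u ≡ v → ¬ Arc u v
  no-loop u≡v (arc i x) = next-no-fixpoint n≥3 i (sym (cong proj₁ u≡v))

------------------------------------------------------------------------
-- Arithmetic functions

[1‥_] : ℕ → List ℕ
[1‥ n ] = map suc (upTo n)

divisors : ℕ → List ℕ
divisors n = filter (_∣? n) [1‥ n ]

φ : ℕ → ℕ
φ n = length (filter (λ m → coprime? m n) [1‥ n ])

-- `search P? l f` is the least m in l , l + 1 , … , l + f − 1 satisfying P,
-- and l + f if there is none.

search : {P : Pred ℕ 0ℓ} → Decidable P → ℕ → ℕ → ℕ
search P? l zero    = l
search P? l (suc f) with P? l
... | yes _ = l
... | no  _ = search P? (suc l) f

-- The multiplicative order of 2 modulo d.  For odd d it is at most d, so the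
-- search c = 1 , … , d succeeds; `ω-isLeast` below shows that ω d is then
-- min {c ≥ 1 ∣ d divides 2ᶜ − 1}.  For even d the value is irrelevant.

ω : ℕ → ℕ
ω d = suc (search (λ c → d ∣? 2 ^ suc c ∸ 1) 0 d)

search-sound : ∀ {P : Pred ℕ 0ℓ} (P? : Decidable P) l f {m} →
               l ≤ m → m < l + f → P m → P (search P? l f)
search-sound P? l zero l≤m m<l+f Pm =
  contradiction (≤-trans m<l+f (≤-reflexive (+-identityʳ l))) (≤⇒≯ l≤m)
search-sound P? l (suc f) {m} l≤m m<l+f Pm with P? l
... | yes Pl = Pl
... | no ¬Pl with m≤n⇒m<n∨m≡n l≤m
...   | inj₁ l<m  = search-sound P? (suc l) f l<m (subst (m <_) (+-suc l f) m<l+f) Pm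
...   | inj₂ refl = contradiction Pm ¬Pl

search-least : ∀ {P : Pred ℕ 0ℓ} (P? : Decidable P) l f {m} →
               l ≤ m → P m → search P? l f ≤ m
search-least P? l zero    l≤m Pm = l≤m
search-least P? l (suc f) l≤m Pm with P? l
... | yes _  = l≤m
... | no ¬Pl with m≤n⇒m<n∨m≡n l≤m
...   | inj₁ l<m  = search-least P? (suc l) f l<m Pm
...   | inj₂ refl = contradiction Pm ¬Pl

%≡%⇒∣∸ : ∀ m n d .{{_ : NonZero d}} → m % d ≡ n % d → d ∣ n ∸ m
%≡%⇒∣∸ m n d eq = divides (n / d ∸ m / d) (begin
  n ∸ m                                    ≡⟨ cong (_∸ m) (m≡m%n+[m/n]*n n d) ⟩
  (n % d + n / d * d) ∸ m                  ≡⟨ cong ((n % d + n / d * d) ∸_) (m≡m%n+[m/n]*n m d) ⟩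
  (n % d + n / d * d) ∸ (m % d + m / d * d) ≡⟨ cong (λ r → (n % d + n / d * d) ∸ (r + m / d * d)) eq ⟩
  (n % d + n / d * d) ∸ (n % d + m / d * d) ≡⟨ [m+n]∸[m+o]≡n∸o (n % d) _ _ ⟩
  n / d * d ∸ m / d * d                    ≡⟨ *-distribʳ-∸ d (n / d) (m / d) ⟨
  (n / d ∸ m / d) * d                      ∎)
  where open ≡-Reasoning

odd⇒coprime-2^ : ∀ {d} → ¬ 2 ∣ d → ∀ i → Coprime d (2 ^ i)
odd⇒coprime-2^ odd zero    (_ , e∣1) = ∣1⇒≡1 e∣1
odd⇒coprime-2^ {d} odd (suc i) {e} (e∣d , e∣2^1+i) =
  odd⇒coprime-2^ odd i (e∣d , coprime-divisor coprime-e-2 e∣2^1+i)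
  where
  coprime-e-2 : Coprime e 2
  coprime-e-2 (f∣e , f∣2) with prime⇒irreducible (from-yes (prime? 2)) f∣2
  ... | inj₁ f≡1  = f≡1
  ... | inj₂ refl = contradiction (∣-trans f∣e e∣d) odd

order-exists : ∀ {d} → ¬ 2 ∣ d → ∃[ c ] c < d × d ∣ 2 ^ suc c ∸ 1
order-exists {zero}    odd = contradiction (2 ∣0) odd
order-exists {d@(suc _)} odd
  with i , j , i<j , eq ← pigeonhole {m = d} (n<1+n d) (λ i → 2 ^ toℕ i mod d)
  with c , 1+i+c≡j ← m≤n⇒∃[o]m+o≡n i<j
  = c
  , ≤-trans (s≤s (m≤n+m c (toℕ i))) (≤-trans (≤-reflexive 1+i+c≡j) (s≤s⁻¹ (toℕ<n j)))
  , coprime-divisor (odd⇒coprime-2^ odd (toℕ i)) (subst (d ∣_) factor d∣diff)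
  where
  open ≡-Reasoning
  d∣diff : d ∣ 2 ^ toℕ j ∸ 2 ^ toℕ i
  d∣diff = %≡%⇒∣∸ (2 ^ toℕ i) (2 ^ toℕ j) d
    (trans (sym (toℕ-fromℕ< _)) (trans (cong toℕ eq) (toℕ-fromℕ< _)))
  factor : 2 ^ toℕ j ∸ 2 ^ toℕ i ≡ 2 ^ toℕ i * (2 ^ suc c ∸ 1)
  factor = begin
    2 ^ toℕ j ∸ 2 ^ toℕ i
      ≡⟨ cong (λ e → 2 ^ e ∸ 2 ^ toℕ i) (trans (sym 1+i+c≡j) (sym (+-suc (toℕ i) c))) ⟩
    2 ^ (toℕ i + suc c) ∸ 2 ^ toℕ i
      ≡⟨ cong (_∸ 2 ^ toℕ i) (^-distribˡ-+-* 2 (toℕ i) (suc c)) ⟩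
    2 ^ toℕ i * 2 ^ suc c ∸ 2 ^ toℕ i
      ≡⟨ cong (2 ^ toℕ i * 2 ^ suc c ∸_) (*-identityʳ (2 ^ toℕ i)) ⟨
    2 ^ toℕ i * 2 ^ suc c ∸ 2 ^ toℕ i * 1
      ≡⟨ *-distribˡ-∸ (2 ^ toℕ i) (2 ^ suc c) 1 ⟨
    2 ^ toℕ i * (2 ^ suc c ∸ 1) ∎

ω-isLeast : ∀ {d} → ¬ 2 ∣ d →
            (1 ≤ ω d × d ∣ 2 ^ ω d ∸ 1) ×
            (∀ c → 1 ≤ c → d ∣ 2 ^ c ∸ 1 → ω d ≤ c)
ω-isLeast {d} odd with c , c<d , d∣ ← order-exists odd
  = (s≤s z≤n , search-sound P? 0 d z≤n c<d d∣)
  , λ { (suc c) _ d∣ → s≤s (search-least P? 0 d z≤n d∣) }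
  where
  P? : Decidable (λ c → d ∣ 2 ^ suc c ∸ 1)
  P? c = d ∣? 2 ^ suc c ∸ 1

-- Necessity.  The right translations of a regular group are automorphisms of
-- PX(n,k).  When n ≥ 5 and k ≥ 2, looking at common neighbours shows that every
-- automorphism preserves all arcs or reverses all arcs; hence the group acts on
-- the 0-1 labellings of ℤₙ, the arc-preserving elements acting as affine maps
-- whose linear part is a shift.  Its translations form a linear code C.  If no
-- element reverses arcs and fixes a fibre, then C has 2ᵏ elements; otherwise such
-- an element w halves C, and adding v + v·w to C repairs this, where v is
-- a labelling fixed modulo C by an element inducing the shift by 2ᵃ (averaging
-- over an orbit, whose length b modulo C is odd, produces v).  The resulting
-- code is invariant under the shift by 2ᵃ, so k is a sum of 2ᵃ dimensions of
-- cyclic codes of length b, that is, of degrees of divisors of tᵇ + 1 over 𝔽₂.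
-- Finally an irreducible factor of tᵇ + 1 modulo which t has order d has degree
-- ω(d), and there are φ(d)/ω(d) such factors.
--
-- Sufficiency.  A divisor of degree k of tⁿ + 1 = (tᵇ + 1)^(2ᵃ) is the feedback
-- polynomial of a shift register A on 𝔽₂ᵏ with Aⁿ = 1, and the semidirect product
-- 𝔽₂ᵏ ⋊ ℤₙ, in which 1 ∈ ℤₙ acts as A, acts regularly on PX(n,k).

module Submission where

open import Data.Bool.Base using (Bool; true; false; not; _∧_; _xor_; if_then_else_)
open import Data.Nat.Base using (ℕ; zero; suc; pred; _+_; _*_; _∸_; _^_; _%_; _≤_; _<_; z≤n; s≤s; s≤s⁻¹; NonZero; ≢-nonZero; >-nonZero; >-nonZero⁻¹)
open import Data.Product.Base using (_,_; Σ-syntax; ∃; ∃₂; ∃-syntax; _×_; proj₁; proj₂)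
open import Data.Sum.Base using (_⊎_; inj₁; inj₂)
open import Data.Vec.Base using (Vec; []; _∷_)
open import Function.Base using (_∘_)
open import Level using (0ℓ)
open import Relation.Binary.PropositionalEquality using (_≡_; _≢_; _≗_; refl; sym; trans; cong; cong₂; subst; subst₂; setoid; isEquivalence; module ≡-Reasoning)
open import Relation.Nullary using (¬_; Dec; yes; no; does; contradiction)

-- Arc-reversing elements are the obstacle to necessity. All elements that carry the fibre of the
-- identity to a neighbouring one may reverse arcs, so only an arc-preserving element of shift 2 is
-- guaranteed; since b is odd, some power of it has shift 2ᵃ. That shift is the useful one because
-- its orbits on ℤₙ have odd length b, and averaging in characteristic 2 needs an odd number of
-- terms. The price is a code that is only quasi-cyclic; projecting to one orbit of the shift after
-- another splits it into 2ᵃ cyclic codes. Both directions then rest on the number of irreducible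
-- factors of tᵇ + 1 of each order. No extension field is built for this: degrees come from counting
-- roots modulo a factor in two ways (powers of t as roots of the factor, all residues as roots of
-- x^(2^ω(d)) + x), and the number φ(d)/ω(d) comes from Möbius inversion, because for every e
-- dividing b the factors whose order divides e have total degree e.

-- The ring 𝔽₂[t].

module PolynomialRing where

  open import Algebra.Bundles using (CommutativeRing)
  import Algebra.Properties.CommutativeSemigroup as CommutativeSemigroupProperties
  open import Algebra.Structures using (IsCommutativeRing)
  open import Data.Bool.Properties using (xor-assoc; xor-comm; xor-same; xor-identityʳ; ∧-distribˡ-xor; ∧-distribʳ-xor; ∧-zeroʳ; xor-∧-commutativeRing)
  open import Data.List.Base using (List; []; _∷_)

  open CommutativeSemigroupProperties (CommutativeRing.+-commutativeSemigroup xor-∧-commutativeRing) public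
    using () renaming (interchange to xor-interchange)

  xor-cancelˡ : ∀ a b → a xor (a xor b) ≡ b
  xor-cancelˡ a b = trans (sym (xor-assoc a a b)) (cong (_xor b) (xor-same a))

  xor≡false⇒≡ : ∀ a b → a xor b ≡ false → a ≡ b
  xor≡false⇒≡ false false _ = refl
  xor≡false⇒≡ true  true  _ = refl

  -- Polynomials over 𝔽₂, lowest coefficient first.  A polynomial p(t) acts on
  -- sequences, t being the left shift; polynomials are identified when they act
  -- in the same way, which makes the ring laws statements about linear operators.

  Poly : Set
  Poly = List Bool

  act : Poly → (ℕ → Bool) → ℕ → Bool
  act []      s i = false
  act (a ∷ p) s i = (a ∧ s i) xor act p s (suc i)

  infix 4 _≈_
  record _≈_ (p q : Poly) : Set where
    constructor mk
    field at : ∀ s i → act p s i ≡ act q s i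
  open _≈_ public

  infixl 6 _⊕_
  infixl 7 _⊗_ _·_

  _⊕_ : Poly → Poly → Poly
  []      ⊕ q       = q
  (a ∷ p) ⊕ []      = a ∷ p
  (a ∷ p) ⊕ (b ∷ q) = (a xor b) ∷ (p ⊕ q)

  _·_ : Bool → Poly → Poly
  a · q = if a then q else []

  _⊗_ : Poly → Poly → Poly
  []      ⊗ q = []
  (a ∷ p) ⊗ q = a · q ⊕ (false ∷ p ⊗ q)

  act-cong : ∀ p {s s′} → (∀ i → s i ≡ s′ i) → ∀ i → act p s i ≡ act p s′ i
  act-cong []      eq i = refl
  act-cong (a ∷ p) eq i = cong₂ (λ x y → (a ∧ x) xor y) (eq i) (act-cong p eq (suc i))

  act-⊕ : ∀ p q s i → act (p ⊕ q) s i ≡ act p s i xor act q s i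
  act-⊕ []      q       s i = refl
  act-⊕ (a ∷ p) []      s i = sym (xor-identityʳ _)
  act-⊕ (a ∷ p) (b ∷ q) s i =
    trans (cong₂ _xor_ (∧-distribʳ-xor (s i) a b) (act-⊕ p q s (suc i)))
          (xor-interchange (a ∧ s i) (b ∧ s i) _ _)

  act-· : ∀ a q s i → act (a · q) s i ≡ a ∧ act q s i
  act-· false q s i = refl
  act-· true  q s i = refl

  act-⊗ : ∀ p q s i → act (p ⊗ q) s i ≡ act p (act q s) i
  act-⊗ []      q s i = refl
  act-⊗ (a ∷ p) q s i =
    trans (act-⊕ (a · q) (false ∷ p ⊗ q) s i) (cong₂ _xor_ (act-· a q s i) (act-⊗ p q s (suc i)))

  act-shift : ∀ p s i → act p (λ j → s (suc j)) i ≡ act p s (suc i)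
  act-shift []      s i = refl
  act-shift (a ∷ p) s i = cong ((a ∧ s (suc i)) xor_) (act-shift p s (suc i))

  act-xor : ∀ p s s′ i → act p (λ j → s j xor s′ j) i ≡ act p s i xor act p s′ i
  act-xor []      s s′ i = refl
  act-xor (a ∷ p) s s′ i =
    trans (cong₂ _xor_ (∧-distribˡ-xor a (s i) (s′ i)) (act-xor p s s′ (suc i)))
          (xor-interchange (a ∧ s i) (a ∧ s′ i) _ _)

  act-∧ : ∀ p a s i → act p (λ j → a ∧ s j) i ≡ a ∧ act p s i
  act-∧ p       true  s i = refl
  act-∧ []      false s i = refl
  act-∧ (a ∷ p) false s i = cong₂ _xor_ (∧-zeroʳ a) (act-∧ p false s (suc i))

  -- Every such operator commutes with scalars and with the shift, and these generate all of them.
  act-comm : ∀ p q s i → act p (act q s) i ≡ act q (act p s) i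
  act-comm []      q s i = sym (act-∧ q false s i)
  act-comm (a ∷ p) q s i = begin
    (a ∧ act q s i) xor act p (act q s) (suc i)
      ≡⟨ cong₂ _xor_ (sym (act-∧ q a s i)) (trans (act-comm p q s (suc i)) (sym (act-shift q (act p s) i))) ⟩
    act q (λ j → a ∧ s j) i xor act q (λ j → act p s (suc j)) i
      ≡⟨ act-xor q _ _ i ⟨
    act q (act (a ∷ p) s) i ∎
    where open ≡-Reasoning

  ⊗-comm : ∀ p q → p ⊗ q ≈ q ⊗ p
  ⊗-comm p q = mk λ s i → trans (act-⊗ p q s i) (trans (act-comm p q s i) (sym (act-⊗ q p s i)))

  ⊗-distribˡ : ∀ p q r → p ⊗ (q ⊕ r) ≈ (p ⊗ q) ⊕ (p ⊗ r)
  ⊗-distribˡ p q r = mk λ s i → begin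
    act (p ⊗ (q ⊕ r)) s i                      ≡⟨ act-⊗ p (q ⊕ r) s i ⟩
    act p (act (q ⊕ r) s) i                    ≡⟨ act-cong p (act-⊕ q r s) i ⟩
    act p (λ j → act q s j xor act r s j) i    ≡⟨ act-xor p _ _ i ⟩
    act p (act q s) i xor act p (act r s) i    ≡⟨ cong₂ _xor_ (act-⊗ p q s i) (act-⊗ p r s i) ⟨
    act (p ⊗ q) s i xor act (p ⊗ r) s i        ≡⟨ act-⊕ (p ⊗ q) (p ⊗ r) s i ⟨
    act ((p ⊗ q) ⊕ (p ⊗ r)) s i                ∎
    where open ≡-Reasoning

  ⊗-distribʳ : ∀ p q r → (q ⊕ r) ⊗ p ≈ (q ⊗ p) ⊕ (r ⊗ p)
  ⊗-distribʳ p q r = mk λ s i → begin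
    act ((q ⊕ r) ⊗ p) s i                      ≡⟨ act-⊗ (q ⊕ r) p s i ⟩
    act (q ⊕ r) (act p s) i                    ≡⟨ act-⊕ q r (act p s) i ⟩
    act q (act p s) i xor act r (act p s) i    ≡⟨ cong₂ _xor_ (act-⊗ q p s i) (act-⊗ r p s i) ⟨
    act (q ⊗ p) s i xor act (r ⊗ p) s i        ≡⟨ act-⊕ (q ⊗ p) (r ⊗ p) s i ⟨
    act ((q ⊗ p) ⊕ (r ⊗ p)) s i                ∎
    where open ≡-Reasoning

  abstract
    polyRing-isCommutativeRing : IsCommutativeRing _≈_ _⊕_ _⊗_ (λ p → p) [] (true ∷ [])
    polyRing-isCommutativeRing = record
        { isRing = record
          { +-isAbelianGroup = record
            { isGroup = record
              { isMonoid = record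
                { isSemigroup = record
                  { isMagma = record
                    { isEquivalence = record
                      { refl  = mk λ s i → refl
                      ; sym   = λ e → mk λ s i → sym (at e s i)
                      ; trans = λ e e′ → mk λ s i → trans (at e s i) (at e′ s i) }
                    ; ∙-cong = λ {p} {p′} {q} {q′} e e′ → mk λ s i →
                        trans (act-⊕ p q s i) (trans (cong₂ _xor_ (at e s i) (at e′ s i)) (sym (act-⊕ p′ q′ s i))) }
                  ; assoc = λ p q r → mk λ s i →
                      trans (trans (act-⊕ (p ⊕ q) r s i) (cong (_xor act r s i) (act-⊕ p q s i)))
                      (trans (xor-assoc (act p s i) (act q s i) (act r s i))
                      (sym (trans (act-⊕ p (q ⊕ r) s i) (cong (act p s i xor_) (act-⊕ q r s i))))) }
                ; identity = (λ p → mk λ s i → refl)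
                           , (λ p → mk λ s i → trans (act-⊕ p [] s i) (xor-identityʳ _)) }
              ; inverse = (λ p → mk λ s i → trans (act-⊕ p p s i) (xor-same (act p s i)))
                        , (λ p → mk λ s i → trans (act-⊕ p p s i) (xor-same (act p s i)))
              ; ⁻¹-cong = λ e → e }
            ; comm = λ p q → mk λ s i →
                trans (act-⊕ p q s i) (trans (xor-comm (act p s i) (act q s i)) (sym (act-⊕ q p s i))) }
          ; *-cong = λ {p} {p′} {q} {q′} e e′ → mk λ s i →
              trans (act-⊗ p q s i) (trans (at e (act q s) i)
              (trans (act-cong p′ (at e′ s) i) (sym (act-⊗ p′ q′ s i))))
          ; *-assoc = λ p q r → mk λ s i →
              trans (act-⊗ (p ⊗ q) r s i) (trans (act-⊗ p q (act r s) i)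
              (sym (trans (act-⊗ p (q ⊗ r) s i) (act-cong p (act-⊗ q r s) i))))
          ; *-identity = (λ p → mk λ s i → trans (act-⊗ (true ∷ []) p s i) (xor-identityʳ _))
                       , (λ p → mk λ s i → trans (act-⊗ p (true ∷ []) s i) (act-cong p (λ j → xor-identityʳ _) i))
          ; distrib = ⊗-distribˡ , ⊗-distribʳ }
        ; *-comm = ⊗-comm }

  polyRing : CommutativeRing 0ℓ 0ℓ
  polyRing = record { isCommutativeRing = polyRing-isCommutativeRing }

  module F₂[t] = CommutativeRing polyRing
  open F₂[t] public using () renaming (refl to ≈-refl; sym to ≈-sym; trans to ≈-trans)

  ⊕-congˡ : ∀ p {q r} → q ≈ r → p ⊕ q ≈ p ⊕ r
  ⊕-congˡ p e = F₂[t].+-congˡ {p} e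

  ⊕-congʳ : ∀ p {q r} → q ≈ r → q ⊕ p ≈ r ⊕ p
  ⊕-congʳ p e = F₂[t].+-congʳ {p} e

  ⊗-congˡ : ∀ p {q r} → q ≈ r → p ⊗ q ≈ p ⊗ r
  ⊗-congˡ p e = F₂[t].*-congˡ {p} e

  ⊗-congʳ : ∀ p {q r} → q ≈ r → q ⊗ p ≈ r ⊗ p
  ⊗-congʳ p e = F₂[t].*-congʳ {p} e

  open import Data.Maybe.Base using (Maybe; just; nothing)
  open import Tactic.RingSolver using (solve-∀)
  open import Tactic.RingSolver.Core.AlmostCommutativeRing using (AlmostCommutativeRing; fromCommutativeRing)

  -- Recognising 1 + 1 as zero lets the solver prove identities of characteristic 2.
  isZero? : ∀ p → Maybe ([] ≈ p)
  isZero? []          = just F₂[t].refl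
  isZero? (true  ∷ p) = nothing
  isZero? (false ∷ p) with isZero? p
  ... | just e  = just (mk λ s i → at e s (suc i))
  ... | nothing = nothing

  solverRing : AlmostCommutativeRing 0ℓ 0ℓ
  solverRing = fromCommutativeRing polyRing isZero?

  abstract
    frobenius-⊕ : ∀ x y → (x ⊕ y) ⊗ (x ⊕ y) ≈ x ⊗ x ⊕ y ⊗ y
    frobenius-⊕ = solve-∀ solverRing

-- Division, irreducibility and factorisation over 𝔽₂.

module Factorisation where

  open import Data.List.Base using (List; []; _∷_; _++_; length; foldr; map)
  open import Data.List.Relation.Unary.All using (All; []; _∷_)
  import Data.List.Relation.Unary.All.Properties as All
  open import Data.Nat.Induction using (<-wellFounded)
  open import Induction.WellFounded using (Acc; acc)
  import Data.Nat.Properties as ℕ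
  open import Data.Nat.ListAction using (sum)
  open import Data.Vec.Base as Vec using (toList; replicate; zipWith)
  open import Relation.Nullary.Decidable using (map′)
  open import Relation.Unary using (Decidable; Pred)
  open import Tactic.RingSolver using (solve-∀)
  open PolynomialRing
  import Relation.Binary.Reasoning.Setoid as SetoidReasoning
  module ≈-Reasoning = SetoidReasoning F₂[t].setoid

  private
    variable
      m l : ℕ

  -- The polynomial tᵐ + xₘ₋₁tᵐ⁻¹ + … + x₀.
  monic : Vec Bool m → Poly
  monic []      = true ∷ []
  monic (a ∷ x) = a ∷ monic x

  ∷-cong : ∀ {a p q} → p ≈ q → a ∷ p ≈ a ∷ q
  ∷-cong {a} e = mk λ s i → cong ((a ∧ s i) xor_) (at e s (suc i))

  ⊕≈0⇒≈ : ∀ {p q} → p ⊕ q ≈ [] → p ≈ q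
  ⊕≈0⇒≈ {p} {q} e = begin
    p              ≈⟨ lemma p q ⟩
    p ⊕ q ⊕ q      ≈⟨ ⊕-congʳ q e ⟩
    q              ∎
    where
    open ≈-Reasoning
    lemma : ∀ p q → p ≈ p ⊕ q ⊕ q
    lemma = solve-∀ solverRing

  ≈⇒⊕≈0 : ∀ {p q} → p ≈ q → p ⊕ q ≈ []
  ≈⇒⊕≈0 {p} {q} e = ≈-trans (⊕-congʳ q e) (F₂[t].-‿inverseˡ q)

  -- The sequence 1, 0, 0, ... reads off the constant coefficient, and sequences with a 0 prepended
  -- recover the action of the rest. Hence equality of operators is equality of coefficients up to
  -- trailing zeros.
  ∷≈0⇒ : ∀ {a p} → a ∷ p ≈ [] → a ≡ false × p ≈ []
  ∷≈0⇒ {a} {p} e = a≡false a p (at e δ 0) , mk λ s i →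
    trans (act-shift p (0∷ s) i) (lemma a (a≡false a p (at e δ 0)) s i)
    where
    δ : ℕ → Bool
    δ zero    = true
    δ (suc _) = false
    0∷ : (ℕ → Bool) → ℕ → Bool
    0∷ s zero    = false
    0∷ s (suc i) = s i
    act-0 : ∀ p → act p δ 1 ≡ false
    act-0 p = trans (sym (act-shift p δ 0)) (act-∧ p false δ 0)
    a≡false : ∀ a p → act (a ∷ p) δ 0 ≡ false → a ≡ false
    a≡false false p e = refl
    a≡false true  p e rewrite act-0 p = e
    lemma : ∀ a → a ≡ false → ∀ s i → act p (0∷ s) (suc i) ≡ false
    lemma .false refl s zero    = trans (cong (_xor act p (0∷ s) 1) (sym (a∧0 a))) (at e (0∷ s) 0)
      where
      a∧0 : ∀ a → a ∧ false ≡ false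
      a∧0 true  = refl
      a∧0 false = refl
    lemma .false refl s (suc i) = trans (cong (_xor act p (0∷ s) (suc (suc i))) (cong (_∧ s i) (sym (a≡false a p (at e δ 0))))) (at e (0∷ s) (suc i))

  ∷-injective : ∀ {a b p q} → a ∷ p ≈ b ∷ q → a ≡ b × p ≈ q
  ∷-injective {a} {b} {p} {q} e with a+b , p+q ← ∷≈0⇒ (≈⇒⊕≈0 {a ∷ p} {b ∷ q} e) = xor≡false⇒≡ a b a+b , ⊕≈0⇒≈ {p} {q} p+q

  monic≉0 : (x : Vec Bool m) → ¬ monic x ≈ []
  monic≉0 []      e = contradiction (proj₁ (∷≈0⇒ e)) λ ()
  monic≉0 (a ∷ x) e = monic≉0 x (proj₂ (∷≈0⇒ e))

  monic-injective : (x : Vec Bool m) (y : Vec Bool l) → monic x ≈ monic y → _≡_ {A = ∃ (Vec Bool)} (m , x) (l , y)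
  monic-injective []      []      e = refl
  monic-injective []      (b ∷ y) e = contradiction (≈-sym (proj₂ (∷-injective e))) (monic≉0 y)
  monic-injective (a ∷ x) []      e = contradiction (proj₂ (∷-injective e)) (monic≉0 x)
  monic-injective (a ∷ x) (b ∷ y) e with refl , e′ ← ∷-injective e with refl ← monic-injective x y e′ = refl

  toList-injective : (x y : Vec Bool m) → toList x ≈ toList y → x ≡ y
  toList-injective []      []      e = refl
  toList-injective (a ∷ x) (b ∷ y) e with refl , e′ ← ∷-injective e = cong (a ∷_) (toList-injective x y e′)

  degree<length : ∀ p (x : Vec Bool m) → p ≈ monic x → m < length p
  degree<length []      x       e = contradiction (≈-sym e) (monic≉0 x)
  degree<length (a ∷ p) []      e = s≤s z≤n
  degree<length (a ∷ p) (b ∷ x) e = s≤s (degree<length p x (proj₂ (∷-injective e)))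

  length-toList : (x : Vec Bool m) → length (toList x) ≡ m
  length-toList []      = refl
  length-toList (a ∷ x) = cong suc (length-toList x)

  length-monic : (x : Vec Bool m) → length (monic x) ≡ suc m
  length-monic []      = refl
  length-monic (a ∷ x) = cong suc (length-monic x)

  -- A list may end in zeros, so its length does not give the degree. Over 𝔽₂ a nonzero polynomial
  -- is monic, hence two cases suffice.
  data Degree (p : Poly) : Set where
    isZero  : p ≈ [] → Degree p
    isMonic : (x : Vec Bool m) → p ≈ monic x → Degree p

  degree : ∀ p → Degree p
  degree [] = isZero ≈-refl
  degree (a ∷ p) with degree p
  ... | isMonic x e = isMonic (a ∷ x) (∷-cong e)
  degree (false ∷ p) | isZero e = isZero (mk λ s i → at e s (suc i))
  degree (true  ∷ p) | isZero e = isMonic [] (∷-cong e)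

  ⊕-monic : ∀ p (x : Vec Bool m) → length p ≤ m → ∃[ z ] p ⊕ monic x ≈ monic {m} z
  ⊕-monic []      x       _       = x , ≈-refl
  ⊕-monic (a ∷ p) (b ∷ x) (s≤s h) with z , e ← ⊕-monic p x h = (a xor b) ∷ z , ∷-cong e

  length-· : ∀ a p → length (a · p) ≤ length p
  length-· false p = z≤n
  length-· true  p = ℕ.≤-refl

  monic-⊗ : (x : Vec Bool m) (y : Vec Bool l) → ∃[ z ] monic x ⊗ monic y ≈ monic {m + l} z
  monic-⊗ []      y = y , F₂[t].*-identityˡ (monic y)
  monic-⊗ {suc m} {l} (a ∷ x) y
    with z , e ← monic-⊗ x y
    with w , e′ ← ⊕-monic (a · monic y) (false ∷ z) (ℕ.≤-trans (length-· a (monic y)) (ℕ.≤-trans (ℕ.≤-reflexive (length-monic y)) (s≤s (ℕ.m≤n+m l m))))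
    = w , ≈-trans (⊕-congˡ (a · monic y) (∷-cong e)) e′

  infix 4 _∣ₚ_
  _∣ₚ_ : Poly → Poly → Set
  f ∣ₚ p = ∃[ q ] p ≈ q ⊗ f

  ∣ₚ-resp : ∀ {f p q} → p ≈ q → f ∣ₚ p → f ∣ₚ q
  ∣ₚ-resp e (c , e′) = c , ≈-trans (≈-sym e) e′

  ∣ₚ-respˡ : ∀ {f g p} → f ≈ g → f ∣ₚ p → g ∣ₚ p
  ∣ₚ-respˡ e (c , e′) = c , ≈-trans e′ (⊗-congˡ c e)

  ∣ₚ-refl : ∀ {f} → f ∣ₚ f
  ∣ₚ-refl {f} = true ∷ [] , ≈-sym (F₂[t].*-identityˡ f)

  ∣ₚ0 : ∀ {f} → f ∣ₚ []
  ∣ₚ0 = [] , ≈-refl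

  ∣ₚ-trans : ∀ {f g p} → f ∣ₚ g → g ∣ₚ p → f ∣ₚ p
  ∣ₚ-trans {f} (c , e) (d , e′) =
    d ⊗ c , ≈-trans e′ (≈-trans (⊗-congˡ d e) (≈-sym (F₂[t].*-assoc d c f)))

  ∣ₚ-⊕ : ∀ {f p q} → f ∣ₚ p → f ∣ₚ q → f ∣ₚ p ⊕ q
  ∣ₚ-⊕ {f} (c , e) (d , e′) = c ⊕ d , ≈-trans (F₂[t].+-cong e e′) (≈-sym (F₂[t].distribʳ f c d))

  ∣ₚ-⊗ˡ : ∀ {f p} q → f ∣ₚ p → f ∣ₚ q ⊗ p
  ∣ₚ-⊗ˡ {f} q (c , e) = q ⊗ c , ≈-trans (⊗-congˡ q e) (≈-sym (F₂[t].*-assoc q c f))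

  ∣ₚ-⊗ʳ : ∀ {f p} q → f ∣ₚ p → f ∣ₚ p ⊗ q
  ∣ₚ-⊗ʳ {f} {p} q d = ∣ₚ-resp (⊗-comm q p) (∣ₚ-⊗ˡ q d)

  quotient-degree : (x : Vec Bool m) (y : Vec Bool l) → ∀ q → monic x ≈ q ⊗ monic y →
                    Σ[ c ∈ ℕ ] Σ[ z ∈ Vec Bool c ] q ≈ monic z × c + l ≡ m
  quotient-degree x y q e with degree q
  ... | isZero q≈0 = contradiction (≈-trans e (⊗-congʳ (monic y) q≈0)) (monic≉0 x)
  ... | isMonic z q≈z with w , e′ ← monic-⊗ z y =
    _ , z , q≈z , sym (cong proj₁ (monic-injective x w (≈-trans e (≈-trans (⊗-congʳ (monic y) q≈z) e′))))

  ∣ₚ⇒≤ : (x : Vec Bool m) (y : Vec Bool l) → monic y ∣ₚ monic x → l ≤ m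
  ∣ₚ⇒≤ x y (q , e) with c , _ , _ , refl ← quotient-degree x y q e = ℕ.m≤n+m _ c

  zeros≈0 : ∀ m → toList (replicate m false) ≈ []
  zeros≈0 zero    = ≈-refl
  zeros≈0 (suc m) = mk λ s i → at (zeros≈0 m) s (suc i)

  toList-zipWith : (x y : Vec Bool m) → toList (zipWith _xor_ x y) ≈ toList x ⊕ toList y
  toList-zipWith []      []      = ≈-refl
  toList-zipWith (a ∷ x) (b ∷ y) = ∷-cong (toList-zipWith x y)

  monic-zipWith : (x y : Vec Bool m) → toList (zipWith _xor_ x y) ≈ monic x ⊕ monic y
  monic-zipWith []      []      = mk λ s i → refl
  monic-zipWith (a ∷ x) (b ∷ y) = ∷-cong (monic-zipWith x y)

  splitLeading : (v : Vec Bool (suc m)) → ∃[ w ] (toList v ≈ toList {n = m} w ⊎ toList v ≈ monic w)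
  splitLeading (false ∷ []) = [] , inj₁ (zeros≈0 1)
  splitLeading (true  ∷ []) = [] , inj₂ ≈-refl
  splitLeading (a ∷ v@(_ ∷ _)) with splitLeading v
  ... | w , inj₁ e = a ∷ w , inj₁ (∷-cong e)
  ... | w , inj₂ e = a ∷ w , inj₂ (∷-cong e)

  -- Horner's scheme: t times the old remainder plus the new coefficient has at most one coefficient
  -- too many, and when that one is 1, adding `monic x` removes it.
  divMod : (x : Vec Bool m) → ∀ p → ∃[ q ] Σ[ r ∈ Vec Bool m ] p ≈ q ⊗ monic x ⊕ toList r
  divMod {m} x [] = [] , replicate m false , ≈-sym (zeros≈0 m)
  divMod x (a ∷ p) with q , r , e ← divMod x p with splitLeading (a ∷ r)
  ... | w , inj₁ e′ = false ∷ q , w ,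
    ≈-trans (∷-cong e) (⊕-congˡ (false ∷ q ⊗ monic x) e′)
  ... | w , inj₂ e′ = true ∷ q , zipWith _xor_ x w , (begin
    a ∷ p                                                          ≈⟨ ∷-cong e ⟩
    (false ∷ q ⊗ monic x) ⊕ (a ∷ toList r)                         ≈⟨ ⊕-congˡ (false ∷ q ⊗ monic x) e′ ⟩
    (false ∷ q ⊗ monic x) ⊕ monic w                                ≈⟨ lemma (false ∷ q ⊗ monic x) (monic w) (monic x) ⟩
    (monic x ⊕ (false ∷ q ⊗ monic x)) ⊕ (monic x ⊕ monic w)        ≈⟨ ⊕-congˡ (monic x ⊕ (false ∷ q ⊗ monic x)) (monic-zipWith x w) ⟨
    (true ∷ q) ⊗ monic x ⊕ toList (zipWith _xor_ x w)              ∎)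
    where
    open ≈-Reasoning
    lemma : ∀ u v w → u ⊕ v ≈ (w ⊕ u) ⊕ (w ⊕ v)
    lemma = solve-∀ solverRing

  ∣ₚ-short⇒≈0 : (x : Vec Bool m) → ∀ p → length p ≤ m → monic x ∣ₚ p → p ≈ []
  ∣ₚ-short⇒≈0 {m} x p p≤m (q , e) with degree q
  ... | isZero q≈0 = ≈-trans e (⊗-congʳ (monic x) q≈0)
  ... | isMonic {l} z q≈z with w , e′ ← monic-⊗ z x =
    contradiction (degree<length p w (≈-trans e (≈-trans (⊗-congʳ (monic x) q≈z) e′)))
                  (ℕ.≤⇒≯ (ℕ.≤-trans p≤m (ℕ.m≤n+m m l)))

  short-residue-unique : (x r r′ : Vec Bool m) → monic x ∣ₚ toList r ⊕ toList r′ → r ≡ r′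
  short-residue-unique x r r′ d = toList-injective r r′ (⊕≈0⇒≈ (≈-trans (≈-sym (toList-zipWith r r′))
    (∣ₚ-short⇒≈0 x _ (ℕ.≤-reflexive (length-toList (zipWith _xor_ r r′)))
      (∣ₚ-resp (≈-sym (toList-zipWith r r′)) d))))

  ≈0? : ∀ p → Dec (p ≈ [])
  ≈0? p with degree p
  ... | isZero e    = yes e
  ... | isMonic x e = no λ p≈0 → monic≉0 x (≈-trans (≈-sym e) p≈0)

  _∣ₚ?_ : (x : Vec Bool m) → ∀ p → Dec (monic x ∣ₚ p)
  x ∣ₚ? p with q , r , e ← divMod x p with ≈0? (toList r)
  ... | yes r≈0 = yes (q , ≈-trans e (≈-trans (⊕-congˡ (q ⊗ monic x) r≈0) (F₂[t].+-identityʳ _)))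
  ... | no  r≉0 = no λ d → r≉0 (∣ₚ-short⇒≈0 x (toList r) (ℕ.≤-reflexive (length-toList r))
    (∣ₚ-resp (≈-trans (⊕-congˡ (q ⊗ monic x) e) (lemma (q ⊗ monic x) (toList r))) (∣ₚ-⊕ (q , ≈-refl) d)))
    where
    lemma : ∀ u v → u ⊕ (u ⊕ v) ≈ v
    lemma = solve-∀ solverRing

  -- Euclid's algorithm; the divisor stays monic because over 𝔽₂ every nonzero remainder is.
  bezout : (y : Vec Bool l) → ∀ p → Acc _<_ l →
           Σ[ c ∈ ℕ ] Σ[ z ∈ Vec Bool c ]
           monic z ∣ₚ monic y × monic z ∣ₚ p × ∃[ u ] ∃[ v ] monic z ≈ u ⊗ monic y ⊕ v ⊗ p
  bezout {l} y p (acc rs) with q , r , e ← divMod y p with degree (toList r)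
  ... | isZero r≈0 = l , y , ∣ₚ-refl
    , (q , ≈-trans e (≈-trans (⊕-congˡ (q ⊗ monic y) r≈0) (F₂[t].+-identityʳ _)))
    , true ∷ [] , [] , lemma (monic y)
    where
    lemma : ∀ f → f ≈ (true ∷ []) ⊗ f ⊕ []
    lemma = solve-∀ solverRing
  ... | isMonic w r≈w
    with c , z , z∣w , z∣y , u , v , e′ ←
           bezout w (monic y) (rs (ℕ.≤-trans (degree<length (toList r) w r≈w) (ℕ.≤-reflexive (length-toList r))))
    = c , z , z∣y
    , ∣ₚ-resp (≈-sym (≈-trans e (⊕-congˡ (q ⊗ monic y) r≈w))) (∣ₚ-⊕ (∣ₚ-⊗ˡ q z∣y) z∣w)
    , u ⊗ q ⊕ v , u , (begin
      monic z                                           ≈⟨ e′ ⟩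
      u ⊗ monic w ⊕ v ⊗ monic y                         ≈⟨ ⊕-congʳ (v ⊗ monic y) (⊗-congˡ u r≈w) ⟨
      u ⊗ toList r ⊕ v ⊗ monic y                        ≈⟨ lemma u q v (monic y) (toList r) ⟩
      (u ⊗ q ⊕ v) ⊗ monic y ⊕ u ⊗ (q ⊗ monic y ⊕ toList r)  ≈⟨ ⊕-congˡ ((u ⊗ q ⊕ v) ⊗ monic y) (⊗-congˡ u e) ⟨
      (u ⊗ q ⊕ v) ⊗ monic y ⊕ u ⊗ p                     ∎)
    where
    open ≈-Reasoning
    lemma : ∀ u q v f r → u ⊗ r ⊕ v ⊗ f ≈ (u ⊗ q ⊕ v) ⊗ f ⊕ u ⊗ (q ⊗ f ⊕ r)
    lemma = solve-∀ solverRing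

  Irreducible : Vec Bool m → Set
  Irreducible {m} x = 1 ≤ m × (∀ {l} (y : Vec Bool l) → monic y ∣ₚ monic x → l ≡ 0 ⊎ l ≡ m)

  irreducible⇒∤1 : (x : Vec Bool m) → Irreducible x → ¬ monic x ∣ₚ true ∷ []
  irreducible⇒∤1 x (1≤m , _) d = ℕ.≤⇒≯ (∣ₚ⇒≤ [] x d) 1≤m

  irreducible⇒prime : (x : Vec Bool m) → Irreducible x → ∀ p q → monic x ∣ₚ p ⊗ q → monic x ∣ₚ p ⊎ monic x ∣ₚ q
  irreducible⇒prime x (_ , irr) p q d
    with c , z , z∣x , z∣p , u , v , e′ ← bezout x p (<-wellFounded _) with irr z z∣x
  ... | inj₁ refl with [] ← z = inj₂ (∣ₚ-resp (begin
      u ⊗ q ⊗ monic x ⊕ v ⊗ (p ⊗ q)      ≈⟨ lemma u v (monic x) p q ⟩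
      (u ⊗ monic x ⊕ v ⊗ p) ⊗ q          ≈⟨ ⊗-congʳ q e′ ⟨
      (true ∷ []) ⊗ q                    ≈⟨ F₂[t].*-identityˡ q ⟩
      q                                  ∎)
      (∣ₚ-⊕ (u ⊗ q , ≈-refl) (∣ₚ-⊗ˡ v d)))
    where
    open ≈-Reasoning
    lemma : ∀ u v f p q → u ⊗ q ⊗ f ⊕ v ⊗ (p ⊗ q) ≈ (u ⊗ f ⊕ v ⊗ p) ⊗ q
    lemma = solve-∀ solverRing
  ... | inj₂ refl = inj₁ (∣ₚ-trans (same-degree z∣x) z∣p)
    where
    same-degree : monic z ∣ₚ monic x → monic x ∣ₚ monic z
    same-degree (w , e) with quotient-degree x z w e
    ... | suc c′ , _ , _ , c+m≡m = contradiction (ℕ.m≤n+m _ c′) (ℕ.<⇒≱ (ℕ.≤-reflexive c+m≡m))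
    ... | zero , [] , w≈1 , _ = true ∷ [] , ≈-trans (≈-sym (F₂[t].*-identityˡ (monic z)))
      (≈-trans (⊗-congʳ (monic z) (≈-sym w≈1)) (≈-trans (≈-sym e) (≈-sym (F₂[t].*-identityˡ (monic x)))))

  any-vec? : ∀ {P : Pred (Vec Bool m) 0ℓ} → Decidable P → Dec (∃ P)
  any-vec? {zero}  P? = map′ ([] ,_) (λ { ([] , p) → p }) (P? [])
  any-vec? {suc m} P? with any-vec? (λ x → P? (false ∷ x)) | any-vec? (λ x → P? (true ∷ x))
  ... | yes (x , p) | _           = yes (false ∷ x , p)
  ... | no  _       | yes (x , p) = yes (true ∷ x , p)
  ... | no  ¬f      | no  ¬t      = no λ { (false ∷ x , p) → ¬f (x , p) ; (true ∷ x , p) → ¬t (x , p) }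

  MonicPoly : Set
  MonicPoly = ∃ (Vec Bool)

  deg : MonicPoly → ℕ
  deg = proj₁

  poly : MonicPoly → Poly
  poly (_ , x) = monic x

  IrreduciblePoly : MonicPoly → Set
  IrreduciblePoly (_ , x) = Irreducible x

  ∏ : List MonicPoly → Poly
  ∏ = foldr (λ f p → poly f ⊗ p) (true ∷ [])

  Σdeg : List MonicPoly → ℕ
  Σdeg fs = sum (map deg fs)

  ∏-monic : ∀ fs → ∃[ z ] ∏ fs ≈ monic {Σdeg fs} z
  ∏-monic []             = [] , ≈-refl
  ∏-monic ((m , x) ∷ fs) with z , e ← ∏-monic fs with w , e′ ← monic-⊗ x z =
    w , ≈-trans (⊗-congˡ (monic x) e) e′

  ∏-++ : ∀ fs gs → ∏ (fs ++ gs) ≈ ∏ fs ⊗ ∏ gs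
  ∏-++ []       gs = ≈-sym (F₂[t].*-identityˡ (∏ gs))
  ∏-++ (f ∷ fs) gs = ≈-trans (⊗-congˡ (poly f) (∏-++ fs gs)) (≈-sym (F₂[t].*-assoc (poly f) (∏ fs) (∏ gs)))

  factorise : (x : Vec Bool m) → Acc _<_ m → ∃[ fs ] All IrreduciblePoly fs × monic x ≈ ∏ fs
  factorise {zero} [] _ = [] , [] , ≈-refl
  factorise {m@(suc m′)} x (acc rs)
    -- The degrees tried are l + 1 with l < m′, that is, 1 up to m - 1.
    with ℕ.anyUpTo? (λ l → any-vec? λ (y : Vec Bool (suc l)) → y ∣ₚ? monic x) m′
  ... | yes (l , l<m′ , y , q , e)
    with c , z , q≈z , c+l≡m ← quotient-degree x y q e
    with fs , irr , e₁ ← factorise z (rs (ℕ.≤-trans (ℕ.m<m+n c (s≤s z≤n)) (ℕ.≤-reflexive c+l≡m)))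
    with gs , irr′ , e₂ ← factorise y (rs (s≤s l<m′))
    = fs ++ gs , All.++⁺ irr irr′ ,
    ≈-trans e (≈-trans (F₂[t].*-cong (≈-trans q≈z e₁) e₂) (≈-sym (∏-++ fs gs)))
  ... | no ¬d = (m , x) ∷ [] , (s≤s z≤n , irr) ∷ [] , ≈-sym (F₂[t].*-identityʳ (monic x))
    where
    irr : ∀ {l} (y : Vec Bool l) → monic y ∣ₚ monic x → l ≡ 0 ⊎ l ≡ m
    irr {zero}  y d = inj₁ refl
    irr {suc l} y d with ℕ.m≤n⇒m<n∨m≡n (∣ₚ⇒≤ x y d)
    ... | inj₁ (s≤s l<m′) = contradiction (l , l<m′ , y , d) ¬d
    ... | inj₂ refl       = inj₂ refl

-- The degree of an irreducible polynomial and the order of t modulo it.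

module MultiplicativeOrder where

  open import Data.Bool.Properties using (xor-comm)
  open import Data.Fin.Base using (Fin; zero; suc; toℕ; funToFin; finToFun)
  open import Data.Fin.Properties using (toℕ<n; toℕ-injective; funToFin-finToFin; finToFun-funToFin; 2↔Bool)
  import Data.Fin.Properties as Fin
  import Data.Fin.Base as Fin′
  open import Data.List.Base using (List; []; _∷_; length; map; replicate)
  open import Data.List.Properties using (length-map; length-replicate)
  open import Data.List.Relation.Unary.All using ([]; _∷_)
  open import Data.Nat.Divisibility using (_∣_; divides)
  open import Data.Nat.Coprimality using (coprime-divisor)
  open import Data.Nat.DivMod using (_/_; m≡m%n+[m/n]*n; m%n<n)
  open import Data.Nat.Induction using (<-wellFounded)
  import Data.Nat.Divisibility as ℕ
  import Data.Nat.Properties as ℕ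
  open import Data.Vec.Base as Vec using (toList; lookup; tabulate)
  open import Data.Vec.Properties using (tabulate∘lookup; tabulate-cong; lookup∘tabulate)
  open import Function.Bundles using (Inverse)
  open import Induction.WellFounded using (Acc; acc)
  open import Relation.Unary using (Decidable; Pred)
  open import Relation.Binary.Definitions using (tri<; tri≈; tri>)
  open import Tactic.RingSolver using (solve-∀)
  open import Defs using (ω; ω-isLeast; odd⇒coprime-2^)
  open PolynomialRing
  open Factorisation

  private
    variable
      m : ℕ

  X^ : ℕ → Poly
  X^ zero    = true ∷ []
  X^ (suc n) = false ∷ X^ n

  1ₚ : Poly
  1ₚ = true ∷ []

  act-X^ : ∀ n s i → act (X^ n) s i ≡ s (n + i)
  act-X^ zero    s i = xor-comm (s i) false
  act-X^ (suc n) s i = trans (act-X^ n s (suc i)) (cong s (ℕ.+-suc n i))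

  X^-+ : ∀ m n → X^ (m + n) ≈ X^ m ⊗ X^ n
  X^-+ m n = mk λ s i → trans (act-X^ (m + n) s i) (trans (cong s (lemma m n i))
    (sym (trans (act-⊗ (X^ m) (X^ n) s i) (trans (act-X^ m _ i) (act-X^ n s (m + i))))))
    where
    lemma : ∀ m n i → m + n + i ≡ n + (m + i)
    lemma m n i = trans (cong (_+ i) (ℕ.+-comm m n)) (ℕ.+-assoc n m i)

  ∷≈⊕t⊗ : ∀ a p → a ∷ p ≈ (a ∷ []) ⊕ X^ 1 ⊗ p
  ∷≈⊕t⊗ a p = mk λ s i → sym (trans (act-⊕ (a ∷ []) (X^ 1 ⊗ p) s i)
    (cong₂ _xor_ (xor-comm (a ∧ s i) false) (trans (act-⊗ (X^ 1) p s i) (act-X^ 1 (act p s) i))))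

  -- Polynomials with coefficients in 𝔽₂[t]; `eval cs` is monic of degree `length cs`.

  eval : List Poly → Poly → Poly
  eval []       x = 1ₚ
  eval (c ∷ cs) x = c ⊕ x ⊗ eval cs x

  -- Synthetic division: the non-leading coefficients of (P(x) + P(a))/(x + a), where P is the monic
  -- polynomial with coefficients `c ∷ cs`.
  deflate : List Poly → Poly → List Poly
  deflate (c ∷ cs@(_ ∷ _)) a = eval cs a ∷ deflate cs a
  deflate _                a = []

  length-deflate : ∀ c cs a → length (deflate (c ∷ cs) a) ≡ length cs
  length-deflate c []       a = refl
  length-deflate c (d ∷ cs) a = cong suc (length-deflate d cs a)

  abstract
    deflate-base : ∀ c x a → (c ⊕ x ⊗ 1ₚ) ⊕ (c ⊕ a ⊗ 1ₚ) ≈ (x ⊕ a) ⊗ 1ₚ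
    deflate-base = solve-∀ solverRing

    deflate-step₁ : ∀ c x a u v → (c ⊕ x ⊗ u) ⊕ (c ⊕ a ⊗ v) ≈ (x ⊕ a) ⊗ v ⊕ x ⊗ (u ⊕ v)
    deflate-step₁ = solve-∀ solverRing

    deflate-step₂ : ∀ x a v q → (x ⊕ a) ⊗ v ⊕ x ⊗ ((x ⊕ a) ⊗ q) ≈ (x ⊕ a) ⊗ (v ⊕ x ⊗ q)
    deflate-step₂ = solve-∀ solverRing

  eval-deflate : ∀ c cs x a → eval (c ∷ cs) x ⊕ eval (c ∷ cs) a ≈ (x ⊕ a) ⊗ eval (deflate (c ∷ cs) a) x
  eval-deflate c []          x a = deflate-base c x a
  eval-deflate c cs@(d ∷ ds) x a = ≈-trans (deflate-step₁ c x a (eval cs x) (eval cs a))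
    (≈-trans (⊕-congˡ ((x ⊕ a) ⊗ eval cs a) (⊗-congˡ x (eval-deflate d ds x a)))
             (deflate-step₂ x a (eval cs a) (eval (deflate cs a) x)))

  -- Modulo an irreducible f there are no zero divisors, so after deflating by one root the others
  -- are still roots. Divisibility by f stands in for equality in the quotient field throughout.
  roots≤degree : (f : Vec Bool m) → Irreducible f → ∀ N cs (r : Fin N → Poly) →
                 (∀ i j → monic f ∣ₚ r i ⊕ r j → i ≡ j) →
                 (∀ i → monic f ∣ₚ eval cs (r i)) → N ≤ length cs
  roots≤degree f irr zero    cs       r inj root = z≤n
  roots≤degree f irr (suc N) []       r inj root = contradiction (root zero) (irreducible⇒∤1 f irr)
  roots≤degree f irr (suc N) (c ∷ cs) r inj root =
    s≤s (ℕ.≤-trans (roots≤degree f irr N (deflate (c ∷ cs) a) (λ i → r (suc i))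
                      (λ i j d → Fin.suc-injective (inj (suc i) (suc j) d)) root′)
                   (ℕ.≤-reflexive (length-deflate c cs a)))
    where
    a = r zero
    root′ : ∀ i → monic f ∣ₚ eval (deflate (c ∷ cs) a) (r (suc i))
    root′ i with irreducible⇒prime f irr (r (suc i) ⊕ a) (eval (deflate (c ∷ cs) a) (r (suc i)))
                   (∣ₚ-resp (eval-deflate c cs (r (suc i)) a) (∣ₚ-⊕ (root (suc i)) (root zero)))
    ... | inj₁ d = contradiction (inj (suc i) zero d) λ ()
    ... | inj₂ d = d

  -- The power with exponent 2ˢ, by repeated squaring; in characteristic 2 it is a ring
  -- endomorphism.
  frob : ℕ → Poly → Poly
  frob zero    p = p
  frob (suc s) p = frob s p ⊗ frob s p

  ⊗-cong : ∀ {p p′ q q′} → p ≈ p′ → q ≈ q′ → p ⊗ q ≈ p′ ⊗ q′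
  ⊗-cong {p} {p′} {q} {q′} e e′ = F₂[t].*-cong e e′

  ⊕-cong : ∀ {p p′ q q′} → p ≈ p′ → q ≈ q′ → p ⊕ q ≈ p′ ⊕ q′
  ⊕-cong {p} {p′} {q} {q′} e e′ = F₂[t].+-cong e e′

  abstract
    ⊗-interchange : ∀ x y → (x ⊗ y) ⊗ (x ⊗ y) ≈ (x ⊗ x) ⊗ (y ⊗ y)
    ⊗-interchange = solve-∀ solverRing

  frob-cong : ∀ s {p q} → p ≈ q → frob s p ≈ frob s q
  frob-cong zero    e = e
  frob-cong (suc s) e = ⊗-cong (frob-cong s e) (frob-cong s e)

  frob-⊕ : ∀ s p q → frob s (p ⊕ q) ≈ frob s p ⊕ frob s q
  frob-⊕ zero    p q = ≈-refl
  frob-⊕ (suc s) p q = ≈-trans (⊗-cong (frob-⊕ s p q) (frob-⊕ s p q)) (frobenius-⊕ (frob s p) (frob s q))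

  frob-⊗ : ∀ s p q → frob s (p ⊗ q) ≈ frob s p ⊗ frob s q
  frob-⊗ zero    p q = ≈-refl
  frob-⊗ (suc s) p q = ≈-trans (⊗-cong (frob-⊗ s p q) (frob-⊗ s p q)) (⊗-interchange (frob s p) (frob s q))

  frob-X^ : ∀ s n → frob s (X^ n) ≈ X^ (2 ^ s * n)
  frob-X^ zero    n = subst (λ m → X^ n ≈ X^ m) (sym (ℕ.+-identityʳ n)) ≈-refl
  frob-X^ (suc s) n = ≈-trans (⊗-cong (frob-X^ s n) (frob-X^ s n))
    (≈-trans (≈-sym (X^-+ (2 ^ s * n) (2 ^ s * n))) (subst (λ m → X^ (2 ^ s * n + 2 ^ s * n) ≈ X^ m) (lemma (2 ^ s) n) ≈-refl))
    where
    lemma : ∀ k n → k * n + k * n ≡ (k + (k + 0)) * n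
    lemma k n = trans (sym (ℕ.*-distribʳ-+ n k k)) (cong (λ z → (k + z) * n) (sym (ℕ.+-identityʳ k)))

  frob-const : ∀ s a → frob s (a ∷ []) ≈ a ∷ []
  frob-const zero    a     = ≈-refl
  frob-const (suc s) a = ≈-trans (⊗-cong (frob-const s a) (frob-const s a)) (lemma a)
    where
    lemma : ∀ a → (a ∷ []) ⊗ (a ∷ []) ≈ a ∷ []
    lemma true  = mk λ s i → refl
    lemma false = mk λ s i → refl

  frob-∣ₚ : ∀ s {f p} → f ∣ₚ p → f ∣ₚ frob s p
  frob-∣ₚ zero    d = d
  frob-∣ₚ (suc s) {p = p} d = ∣ₚ-⊗ˡ (frob s p) (frob-∣ₚ s d)

  consts : Vec Bool m → List Poly
  consts x = map (_∷ []) (toList x)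

  monic≈eval : (x : Vec Bool m) → monic x ≈ eval (consts x) (X^ 1)
  monic≈eval []      = ≈-refl
  monic≈eval (a ∷ x) = ≈-trans (∷≈⊕t⊗ a (monic x)) (⊕-congˡ (a ∷ []) (⊗-congˡ (X^ 1) (monic≈eval x)))

  frob-eval : ∀ s (x : Vec Bool m) y → frob s (eval (consts x) y) ≈ eval (consts x) (frob s y)
  frob-eval s []      y = frob-const s true
  frob-eval s (a ∷ x) y = ≈-trans (frob-⊕ s (a ∷ []) (y ⊗ eval (consts x) y))
    (⊕-cong (frob-const s a) (≈-trans (frob-⊗ s y (eval (consts x) y)) (⊗-congˡ (frob s y) (frob-eval s x y))))

  eval-cong : ∀ cs {x y} → x ≈ y → eval cs x ≈ eval cs y
  eval-cong []       e = ≈-refl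
  eval-cong (c ∷ cs) e = ⊕-congˡ c (⊗-cong e (eval-cong cs e))

  -- Written through `eval` so that x^(2^(ω d)) + x has the shape to which `roots≤degree` applies.
  power : Poly → ℕ → Poly
  power x n = eval (replicate n []) x

  power-+ : ∀ x m n → power x (m + n) ≈ power x m ⊗ power x n
  power-+ x zero    n = ≈-sym (F₂[t].*-identityˡ (power x n))
  power-+ x (suc m) n = ≈-trans (⊗-congˡ x (power-+ x m n)) (≈-sym (F₂[t].*-assoc x (power x m) (power x n)))

  power-2^ : ∀ x s → power x (2 ^ s) ≈ frob s x
  power-2^ x zero    = F₂[t].*-identityʳ x
  power-2^ x (suc s) rewrite ℕ.+-identityʳ (2 ^ s) =
    ≈-trans (power-+ x (2 ^ s) (2 ^ s)) (⊗-cong (power-2^ x s) (power-2^ x s))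

  least : {P : Pred ℕ 0ℓ} → Decidable P → ∀ n → P n → ∃[ m ] P m × (∀ {j} → j < m → ¬ P j)
  least {P} P? n Pn = go n Pn (<-wellFounded n)
    where
    go : ∀ n → P n → Acc _<_ n → ∃[ m ] P m × (∀ {j} → j < m → ¬ P j)
    go n Pn (acc rs) with ℕ.anyUpTo? P? n
    ... | yes (m , m<n , Pm) = go m Pm (rs m<n)
    ... | no  ¬P             = n , Pn , λ j<n Pj → ¬P (_ , j<n , Pj)

  abstract
    X^+1-sum : ∀ u v → u ⊗ v ⊕ 1ₚ ≈ u ⊗ (v ⊕ 1ₚ) ⊕ (u ⊕ 1ₚ)
    X^+1-sum = solve-∀ solverRing

    X^+1-difference : ∀ u v → v ⊗ (u ⊕ 1ₚ) ⊕ (u ⊗ v ⊕ 1ₚ) ≈ v ⊕ 1ₚ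
    X^+1-difference = solve-∀ solverRing

  X^+1-∣-+ : ∀ {f} m n → f ∣ₚ X^ m ⊕ 1ₚ → f ∣ₚ X^ n ⊕ 1ₚ → f ∣ₚ X^ (m + n) ⊕ 1ₚ
  X^+1-∣-+ m n d d′ = ∣ₚ-resp (≈-sym (≈-trans (⊕-congʳ 1ₚ (X^-+ m n)) (X^+1-sum (X^ m) (X^ n)))) (∣ₚ-⊕ (∣ₚ-⊗ˡ (X^ m) d′) d)

  X^+1-∣-∸ : ∀ {f} m n → f ∣ₚ X^ m ⊕ 1ₚ → f ∣ₚ X^ (m + n) ⊕ 1ₚ → f ∣ₚ X^ n ⊕ 1ₚ
  X^+1-∣-∸ m n d d′ = ∣ₚ-resp (X^+1-difference (X^ m) (X^ n))
    (∣ₚ-⊕ (∣ₚ-⊗ˡ (X^ n) d) (∣ₚ-resp (⊕-congʳ 1ₚ (X^-+ m n)) d′))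

  X^+1-∣-* : ∀ {f} d q → f ∣ₚ X^ d ⊕ 1ₚ → f ∣ₚ X^ (q * d) ⊕ 1ₚ
  X^+1-∣-* d zero    h = [] , mk λ s i → refl
  X^+1-∣-* d (suc q) h = X^+1-∣-+ d (q * d) h (X^+1-∣-* d q h)

  -- Characterises d as the multiplicative order of t modulo f.
  record Order (f : Poly) (d : ℕ) : Set where
    field
      ∣⇒∣ₚ : ∀ {e} → d ∣ e → f ∣ₚ X^ e ⊕ 1ₚ
      ∣ₚ⇒∣ : ∀ {e} → f ∣ₚ X^ e ⊕ 1ₚ → d ∣ e

  order : (f : Vec Bool m) → ∀ b → monic f ∣ₚ X^ (suc b) ⊕ 1ₚ → ∃ (Order (monic f))
  order f b f∣ = suc c , record
    { ∣⇒∣ₚ = λ { (divides q refl) → X^+1-∣-* (suc c) q f∣c }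
    ; ∣ₚ⇒∣ = λ {e} f∣e → ℕ.m%n≡0⇒n∣m e (suc c) (remainder≡0 (e % suc c) (m%n<n e (suc c))
        (X^+1-∣-∸ (e / suc c * suc c) (e % suc c) (X^+1-∣-* (suc c) (e / suc c) f∣c)
          (subst (λ n → monic f ∣ₚ X^ n ⊕ 1ₚ)
                 (trans (m≡m%n+[m/n]*n e (suc c)) (ℕ.+-comm (e % suc c) _)) f∣e))) }
    where
    -- Searching over exponents n + 1 keeps the exponent positive; the order is `suc c`.
    minimal = least (λ n → f ∣ₚ? (X^ (suc n) ⊕ 1ₚ)) b f∣
    c    = proj₁ minimal
    f∣c  = proj₁ (proj₂ minimal)
    min′ : ∀ {j} → j < c → ¬ monic f ∣ₚ X^ (suc j) ⊕ 1ₚ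
    min′ = proj₂ (proj₂ minimal)
    remainder≡0 : ∀ r → r < suc c → monic f ∣ₚ X^ r ⊕ 1ₚ → r ≡ 0
    remainder≡0 zero    _         _  = refl
    remainder≡0 (suc r) (s≤s r<c) f∣r = contradiction f∣r (min′ r<c)

  encode : Vec Bool m → Fin (2 ^ m)
  encode x = funToFin (λ i → Inverse.from 2↔Bool (lookup x i))

  decode : Fin (2 ^ m) → Vec Bool m
  decode k = tabulate (λ i → Inverse.to 2↔Bool (finToFun k i))

  encode-injective : (x y : Vec Bool m) → encode x ≡ encode y → x ≡ y
  encode-injective x y eq = trans (sym (tabulate∘lookup x)) (trans (tabulate-cong λ i → from-injective (begin
    Inverse.from 2↔Bool (lookup x i)   ≡⟨ finToFun-funToFin _ i ⟨
    finToFun (encode x) i              ≡⟨ cong (λ k → finToFun k i) eq ⟩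
    finToFun (encode y) i              ≡⟨ finToFun-funToFin _ i ⟩
    Inverse.from 2↔Bool (lookup y i)   ∎)) (tabulate∘lookup y))
    where
    open ≡-Reasoning
    from-injective : ∀ {a b} → Inverse.from 2↔Bool a ≡ Inverse.from 2↔Bool b → a ≡ b
    from-injective {false} {false} _ = refl
    from-injective {true}  {true}  _ = refl

  decode-injective : (k k′ : Fin (2 ^ m)) → decode {m} k ≡ decode k′ → k ≡ k′
  decode-injective {m} k k′ eq = begin
    k                                    ≡⟨ funToFin-finToFin {m} {2} k ⟨
    funToFin (finToFun {2} {m} k)    ≡⟨ funToFin-cong (λ i → to-injective (begin
        Inverse.to 2↔Bool (finToFun k i)    ≡⟨ lookup∘tabulate _ i ⟨
        lookup (decode k) i                 ≡⟨ cong (λ v → lookup v i) eq ⟩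
        lookup (decode k′) i                ≡⟨ lookup∘tabulate _ i ⟩
        Inverse.to 2↔Bool (finToFun k′ i)   ∎)) ⟩
    funToFin (finToFun {2} {m} k′)   ≡⟨ funToFin-finToFin {m} {2} k′ ⟩
    k′                       ∎
    where
    open ≡-Reasoning
    to-injective : ∀ {a b} → Inverse.to 2↔Bool a ≡ Inverse.to 2↔Bool b → a ≡ b
    to-injective {zero}     {zero}     _ = refl
    to-injective {suc zero} {suc zero} _ = refl
    to-injective {zero}     {suc zero} ()
    funToFin-cong : ∀ {n} {f g : Fin n → Fin 2} → (∀ i → f i ≡ g i) → funToFin f ≡ funToFin g
    funToFin-cong {zero}  e = refl
    funToFin-cong {suc n} e = cong₂ Fin′.combine (e zero) (funToFin-cong (λ i → e (suc i)))

  2^-cancel-≤ : ∀ m n → 2 ^ m ≤ 2 ^ n → m ≤ n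
  2^-cancel-≤ m n h = ℕ.≮⇒≥ λ n<m → ℕ.<⇒≱ (ℕ.^-monoʳ-< 2 (s≤s (s≤s z≤n)) n<m) h

  Vec-injective⇒≤ : ∀ {n} (f : Vec Bool m → Vec Bool n) → (∀ x y → f x ≡ f y → x ≡ y) → m ≤ n
  Vec-injective⇒≤ {m} {n} f inj = 2^-cancel-≤ m n (Fin.injective⇒≤ {f = λ k → encode (f (decode k))}
    λ {k} {k′} eq → decode-injective k k′ (inj _ _ (encode-injective _ _ eq)))

  2^∸2^ : ∀ i c → 2 ^ (i + suc c) ≡ 2 ^ i * (2 ^ suc c ∸ 1) + 2 ^ i
  2^∸2^ i c = begin
    2 ^ (i + suc c)                      ≡⟨ ℕ.^-distribˡ-+-* 2 i (suc c) ⟩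
    2 ^ i * 2 ^ suc c                    ≡⟨ cong (2 ^ i *_) (ℕ.m∸n+n≡m (ℕ.m^n>0 2 (suc c))) ⟨
    2 ^ i * (2 ^ suc c ∸ 1 + 1)          ≡⟨ ℕ.*-distribˡ-+ (2 ^ i) _ 1 ⟩
    2 ^ i * (2 ^ suc c ∸ 1) + 2 ^ i * 1  ≡⟨ cong (2 ^ i * (2 ^ suc c ∸ 1) +_) (ℕ.*-identityʳ (2 ^ i)) ⟩
    2 ^ i * (2 ^ suc c ∸ 1) + 2 ^ i      ∎
    where open ≡-Reasoning

  abstract
    X^-factor : ∀ u v → u ⊗ v ⊕ v ≈ v ⊗ (u ⊕ 1ₚ)
    X^-factor = solve-∀ solverRing

    frob-step : ∀ c x y u v → (c ⊕ x ⊗ y) ⊕ (c ⊕ u ⊗ v) ≈ y ⊗ (x ⊕ u) ⊕ u ⊗ (y ⊕ v)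
    frob-step = solve-∀ solverRing

    eval-X²ˢ+X : ∀ x p → [] ⊕ x ⊗ (1ₚ ⊕ x ⊗ p) ≈ x ⊗ (x ⊗ p) ⊕ x
    eval-X²ˢ+X = solve-∀ solverRing

  module _ (f : Vec Bool m) (irr : Irreducible f) {d : ℕ} (ord : Order (monic f) d) (odd : ¬ 2 ∣ d) where
    open Order ord

    private
      1≤ω  = proj₁ (proj₁ (ω-isLeast odd))
      d∣   = proj₂ (proj₁ (ω-isLeast odd))
      ω-least = proj₂ (ω-isLeast odd)

    f∣Xᵈ+1 : monic f ∣ₚ X^ d ⊕ 1ₚ
    f∣Xᵈ+1 = ∣⇒∣ₚ (divides 1 (sym (ℕ.*-identityˡ d)))

    -- t is a unit modulo f, since tᵈ = 1 there and d, being odd, is positive.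
    f∤t : ¬ monic f ∣ₚ X^ 1
    f∤t h = irreducible⇒∤1 f irr (∣ₚ-resp (lemma (X^ d) 1ₚ) (∣ₚ-⊕ (f∣X^ d odd) f∣Xᵈ+1))
      where
      lemma : ∀ u v → u ⊕ (u ⊕ v) ≈ v
      lemma = solve-∀ solverRing
      f∣X^ : ∀ n → ¬ 2 ∣ n → monic f ∣ₚ X^ n
      f∣X^ zero    2∤0 = contradiction (2 ℕ.∣0) 2∤0
      f∣X^ (suc n) _   = ∣ₚ-resp (≈-sym (X^-+ 1 n)) (∣ₚ-⊗ʳ (X^ n) h)

    f∤X^ : ∀ n → ¬ monic f ∣ₚ X^ n
    f∤X^ zero    h = irreducible⇒∤1 f irr h
    f∤X^ (suc n) h with irreducible⇒prime f irr (X^ 1) (X^ n) (∣ₚ-resp (X^-+ 1 n) h)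
    ... | inj₁ h′ = f∤t h′
    ... | inj₂ h′ = f∤X^ n h′

    -- As t is a unit modulo f, equality of the two powers would give d ∣ 2ⁱ(2^(c+1) - 1). The
    -- factor 2ⁱ is coprime to the odd d, so ω(d) ≤ c + 1, a contradiction.
    X^-distinct : ∀ i c → suc c < ω d → ¬ monic f ∣ₚ X^ (2 ^ (i + suc c)) ⊕ X^ (2 ^ i)
    X^-distinct i c c<ω h
      with irreducible⇒prime f irr (X^ (2 ^ i)) (X^ (2 ^ i * (2 ^ suc c ∸ 1)) ⊕ 1ₚ) (∣ₚ-resp (≈-trans
             (⊕-congʳ (X^ (2 ^ i)) (subst (λ n → X^ n ≈ X^ (2 ^ i * (2 ^ suc c ∸ 1)) ⊗ X^ (2 ^ i)) (sym (2^∸2^ i c))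
               (X^-+ (2 ^ i * (2 ^ suc c ∸ 1)) (2 ^ i))))
             (X^-factor (X^ (2 ^ i * (2 ^ suc c ∸ 1))) (X^ (2 ^ i)))) h)
    ... | inj₁ h′ = f∤X^ (2 ^ i) h′
    ... | inj₂ h′ = ℕ.<⇒≱ c<ω (ω-least (suc c) (s≤s z≤n) (coprime-divisor (odd⇒coprime-2^ odd i) (∣ₚ⇒∣ h′)))

    -- The elements t, t², t⁴, … , t^(2^(ω d − 1)) are distinct roots of f modulo f.
    ω≤degree : ω d ≤ m
    ω≤degree = ℕ.≤-trans (roots≤degree f irr (ω d) (consts f) (λ i → X^ (2 ^ toℕ i)) distinct root)
                         (ℕ.≤-reflexive (trans (length-map (_∷ []) (toList f)) (length-toList f)))
      where
      ordered : ∀ (i j : Fin (ω d)) → toℕ i < toℕ j → ¬ monic f ∣ₚ X^ (2 ^ toℕ j) ⊕ X^ (2 ^ toℕ i)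
      ordered i j i<j h with c , i+c≡j ← ℕ.m≤n⇒∃[o]m+o≡n i<j =
        X^-distinct (toℕ i) c
          (ℕ.≤-<-trans (ℕ.≤-trans (s≤s (ℕ.m≤n+m c (toℕ i))) (ℕ.≤-reflexive i+c≡j)) (toℕ<n j))
          (subst (λ n → monic f ∣ₚ X^ (2 ^ n) ⊕ X^ (2 ^ toℕ i)) (trans (sym i+c≡j) (sym (ℕ.+-suc (toℕ i) c))) h)
      distinct : ∀ i j → monic f ∣ₚ X^ (2 ^ toℕ i) ⊕ X^ (2 ^ toℕ j) → i ≡ j
      distinct i j h with ℕ.<-cmp (toℕ i) (toℕ j)
      ... | tri< i<j _ _ = contradiction (∣ₚ-resp (F₂[t].+-comm (X^ (2 ^ toℕ i)) (X^ (2 ^ toℕ j))) h) (ordered i j i<j)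
      ... | tri≈ _ i≡j _ = toℕ-injective i≡j
      ... | tri> _ _ j<i = contradiction h (ordered j i j<i)
      -- Squaring fixes the coefficients of f, so f(t^(2ⁱ)) = f(t)^(2ⁱ), a multiple of f.
      root : ∀ i → monic f ∣ₚ eval (consts f) (X^ (2 ^ toℕ i))
      root i = ∣ₚ-resp (≈-trans (frob-cong (toℕ i) (monic≈eval f)) (≈-trans (frob-eval (toℕ i) f (X^ 1)) (eval-cong (consts f)
        (≈-trans (frob-X^ (toℕ i) 1) (subst (λ n → X^ (2 ^ toℕ i * 1) ≈ X^ n) (ℕ.*-identityʳ _) ≈-refl)))))
        (frob-∣ₚ (toℕ i) ∣ₚ-refl)

    frob-t : monic f ∣ₚ frob (ω d) (X^ 1) ⊕ X^ 1
    frob-t = ∣ₚ-resp (≈-sym (≈-trans (⊕-congʳ (X^ 1) (≈-trans (frob-X^ (ω d) 1)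
        (subst (λ n → X^ n ≈ X^ (2 ^ ω d ∸ 1) ⊗ X^ 1) (trans (ℕ.m∸n+n≡m (ℕ.m^n>0 2 (ω d))) (sym (ℕ.*-identityʳ (2 ^ ω d))))
          (X^-+ (2 ^ ω d ∸ 1) 1))))
        (X^-factor (X^ (2 ^ ω d ∸ 1)) (X^ 1))))
      (∣ₚ-⊗ˡ (X^ 1) (∣⇒∣ₚ d∣))

    -- An endomorphism that fixes 𝔽₂ and, modulo f, also t fixes everything modulo f; t is fixed
    -- because d ∣ 2^(ω d) - 1.
    frob-fixes : ∀ g → monic f ∣ₚ frob (ω d) g ⊕ g
    frob-fixes [] = [] , ≈-trans (⊕-congʳ [] (frob-cong (ω d) {[]} {false ∷ []} (mk λ s i → refl)))
      (≈-trans (⊕-congʳ [] (frob-const (ω d) false)) (mk λ s i → refl))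
    frob-fixes (a ∷ g) = ∣ₚ-resp (≈-sym (≈-trans
        (⊕-cong (≈-trans (frob-cong (ω d) (∷≈⊕t⊗ a g)) (≈-trans (frob-⊕ (ω d) (a ∷ []) (X^ 1 ⊗ g))
          (⊕-cong (frob-const (ω d) a) (frob-⊗ (ω d) (X^ 1) g)))) (∷≈⊕t⊗ a g))
        (frob-step (a ∷ []) (frob (ω d) (X^ 1)) (frob (ω d) g) (X^ 1) g)))
      (∣ₚ-⊕ (∣ₚ-⊗ˡ (frob (ω d) g) frob-t) (∣ₚ-⊗ˡ (X^ 1) (frob-fixes g)))

    -- All 2ᵐ residues modulo f are roots of x^(2^(ω d)) + x.
    degree≤ω : m ≤ ω d
    degree≤ω with N , 2+N ← ℕ.m≤n⇒∃[o]m+o≡n (ℕ.^-monoʳ-≤ 2 1≤ω) = 2^-cancel-≤ m (ω d) (ℕ.≤-trans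
      (roots≤degree f irr (2 ^ m) ([] ∷ 1ₚ ∷ replicate N []) (λ k → toList (decode {m} k))
        (λ k k′ h → decode-injective k k′ (short-residue-unique f _ _ h)) (λ k → root N 2+N (toList (decode {m} k))))
      (ℕ.≤-reflexive (trans (cong (λ n → suc (suc n)) (length-replicate N)) 2+N)))
      where
      root : ∀ N → 2 + N ≡ 2 ^ ω d → ∀ g → monic f ∣ₚ eval ([] ∷ 1ₚ ∷ replicate N []) g
      root N 2+N g = ∣ₚ-resp (≈-sym (≈-trans (eval-X²ˢ+X g (power g N)) (⊕-congʳ g
        (subst (λ n → power g n ≈ frob (ω d) g) (sym 2+N) (power-2^ g (ω d)))))) (frob-fixes g)

    degree≡ω : m ≡ ω d
    degree≡ω = ℕ.≤-antisym degree≤ω ω≤degree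

-- The irreducible factors of tᵇ + 1.

module CyclicFactors where

  open import Data.List.Base using (List; []; _∷_; map; replicate)
  open import Data.List.Relation.Unary.All as All using (All; []; _∷_)
  open import Data.List.Relation.Ternary.Interleaving.Propositional using (Interleaving; []; consˡ; consʳ)
  open import Data.Nat.Divisibility using (_∣_; divides; _∣?_)
  open import Data.Nat.ListAction using (sum)
  open import Data.Nat.Induction using (<-wellFounded)
  import Data.Nat.Divisibility as ℕ
  import Data.Nat.Properties as ℕ
  import Data.Vec.Base as Vec
  open import Tactic.RingSolver using (solve-∀)
  open import Defs using (ω)
  open PolynomialRing
  open Factorisation
  open MultiplicativeOrder

  private
    variable
      b m l : ℕ

  X^b+1-monic : ∀ b → X^ (suc b) ⊕ 1ₚ ≈ monic (true ∷ Vec.replicate b false)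
  X^b+1-monic b = ∷-cong (≈-trans (F₂[t].+-identityʳ (X^ b)) (X^-monic b))
    where
    X^-monic : ∀ b → X^ b ≈ monic (Vec.replicate b false)
    X^-monic zero    = ≈-refl
    X^-monic (suc b) = ∷-cong (X^-monic b)

  monic⊗≈0 : (x : Vec Bool m) → ∀ p → monic x ⊗ p ≈ [] → p ≈ []
  monic⊗≈0 x p e with degree p
  ... | isZero p≈0 = p≈0
  ... | isMonic y p≈y with z , e′ ← monic-⊗ x y =
    contradiction (≈-trans (≈-sym e′) (≈-trans (⊗-congˡ (monic x) (≈-sym p≈y)) e)) (monic≉0 z)

  monic⊗-cancel : (x : Vec Bool m) → ∀ p q → monic x ⊗ p ≈ monic x ⊗ q → p ≈ q
  monic⊗-cancel x p q e = ⊕≈0⇒≈ (monic⊗≈0 x (p ⊕ q) (≈-trans (F₂[t].distribˡ (monic x) p q) (≈⇒⊕≈0 e)))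

  -- `ord` together with `label∣b` makes it a divisor of tᵇ + 1. The label is kept because it
  -- determines the degree.
  record Factor (b : ℕ) : Set where
    field
      {deg′}    : ℕ
      factor    : Vec Bool deg′
      irr       : Irreducible factor
      {label}   : ℕ
      ord       : Order (monic factor) label
      label∣b   : label ∣ b

  open Factor

  monicPoly : Factor b → MonicPoly
  monicPoly f = _ , factor f

  fpoly : Factor b → Poly
  fpoly f = monic (factor f)

  ∏ᶠ : List (Factor b) → Poly
  ∏ᶠ fs = ∏ (map monicPoly fs)

  deg≡ω-label : ¬ 2 ∣ b → (f : Factor b) → deg′ f ≡ ω (label f)
  deg≡ω-label odd f = degree≡ω (factor f) (irr f) (ord f) λ 2∣d → odd (ℕ.∣-trans 2∣d (label∣b f))

  Σω : List (Factor b) → ℕ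
  Σω fs = sum (map (ω ∘ label) fs)

  Σdeg≡Σω : ¬ 2 ∣ b → (fs : List (Factor b)) → Σdeg (map monicPoly fs) ≡ Σω fs
  Σdeg≡Σω odd []       = refl
  Σdeg≡Σω odd (f ∷ fs) = cong₂ _+_ (deg≡ω-label odd f) (Σdeg≡Σω odd fs)

  monic≈∏⇒degree : ¬ 2 ∣ b → (g : Vec Bool l) (fs : List (Factor b)) → monic g ≈ ∏ᶠ fs → l ≡ Σω fs
  monic≈∏⇒degree odd g fs e with z , e′ ← ∏-monic (map monicPoly fs) =
    trans (cong proj₁ (monic-injective g z (≈-trans e e′))) (Σdeg≡Σω odd fs)

  abstract
    swapˡ : ∀ u v w → u ⊗ v ⊗ w ≈ v ⊗ (u ⊗ w)
    swapˡ = solve-∀ solverRing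

    rotate : ∀ u v w → u ⊗ (v ⊗ w) ≈ w ⊗ (u ⊗ v)
    rotate = solve-∀ solverRing

  -- Unique factorisation: each prime of the list divides one of the two cofactors and is cancelled
  -- there; the interleaving records which one.
  ∏-split : (fs : List (Factor b)) (g : Vec Bool l) (c : Vec Bool m) → ∏ᶠ fs ≈ monic g ⊗ monic c →
            ∃₂ λ gs cs → Interleaving gs cs fs × monic g ≈ ∏ᶠ gs × monic c ≈ ∏ᶠ cs
  ∏-split []       g c e with quotient-degree [] c (monic g) e
  ... | zero , [] , g≈z , refl with [] ← c = [] , [] , [] , g≈z , ≈-refl
  ∏-split (f ∷ fs) g c e
    with irreducible⇒prime (factor f) (irr f) (monic g) (monic c) (∣ₚ-resp e (∣ₚ-⊗ʳ (∏ᶠ fs) ∣ₚ-refl))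
  ... | inj₁ (q , e′)
    with k , z , q≈z , _ ← quotient-degree g (factor f) q e′
    with gs , cs , i , e₁ , e₂ ← ∏-split fs z c (monic⊗-cancel (factor f) (∏ᶠ fs) (monic z ⊗ monic c)
           (≈-trans e (≈-trans (⊗-congʳ (monic c) (≈-trans e′ (⊗-congʳ (fpoly f) q≈z))) (swapˡ (monic z) (fpoly f) (monic c)))))
    = f ∷ gs , cs , consˡ i
    , ≈-trans e′ (≈-trans (⊗-comm q (fpoly f)) (⊗-congˡ (fpoly f) (≈-trans q≈z e₁))) , e₂
  ... | inj₂ (q , e′)
    with k , z , q≈z , _ ← quotient-degree c (factor f) q e′
    with gs , cs , i , e₁ , e₂ ← ∏-split fs g z (monic⊗-cancel (factor f) (∏ᶠ fs) (monic g ⊗ monic z)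
           (≈-trans e (≈-trans (⊗-congˡ (monic g) (≈-trans e′ (⊗-congʳ (fpoly f) q≈z))) (rotate (monic g) (monic z) (fpoly f)))))
    = gs , f ∷ cs , consʳ i , e₁
    , ≈-trans e′ (≈-trans (⊗-comm q (fpoly f)) (⊗-congˡ (fpoly f) (≈-trans q≈z e₂)))

  ∣∏ : ∀ fs → All (λ f → poly f ∣ₚ ∏ fs) fs
  ∣∏ []       = []
  ∣∏ (f ∷ fs) = ∣ₚ-⊗ʳ (∏ fs) ∣ₚ-refl ∷ All.map (∣ₚ-⊗ˡ (poly f)) (∣∏ fs)

  toFactors : ∀ b fs → All IrreduciblePoly fs → All (λ f → poly f ∣ₚ X^ (suc b) ⊕ 1ₚ) fs →
              ∃[ gs ] ∏ᶠ {suc b} gs ≈ ∏ fs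
  toFactors b []             []         []       = [] , ≈-refl
  toFactors b ((m , f) ∷ fs) (ir ∷ irs) (d ∷ ds) with gs , e ← toFactors b fs irs ds =
    (let _ , o = order f b d in record { factor = f ; irr = ir ; ord = o ; label∣b = Order.∣ₚ⇒∣ o d }) ∷ gs
    , ⊗-congˡ (monic f) e

  factors : ∀ b → ∃[ fs ] ∏ᶠ {suc b} fs ≈ X^ (suc b) ⊕ 1ₚ
  factors b
    with fs , irs , e ← factorise (true ∷ Vec.replicate b false) (<-wellFounded _)
    with gs , e′ ← toFactors b fs irs (All.map
           (∣ₚ-resp (≈-trans (≈-sym e) (≈-sym (X^b+1-monic b)))) (∣∏ fs))
    = gs , ≈-trans e′ (≈-trans (≈-sym e) (≈-sym (X^b+1-monic b)))

  -- The quotient (tᵠᵉ + 1)/(tᵉ + 1) is congruent to q modulo tᵉ + 1, hence coprime to it when q is odd.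

  parity : ℕ → Poly
  parity zero    = []
  parity (suc q) = parity q ⊕ 1ₚ

  parity-odd : ∀ q → ¬ 2 ∣ q → parity q ≈ 1ₚ
  parity-odd zero          odd = contradiction (2 ℕ.∣0) odd
  parity-odd (suc zero)    odd = ≈-refl
  parity-odd (suc (suc q)) odd = ≈-trans (F₂[t].+-assoc (parity q) 1ₚ 1ₚ) (≈-trans
    (⊕-congˡ (parity q) (mk λ s i → refl)) (≈-trans (F₂[t].+-identityʳ (parity q))
    (parity-odd q λ 2∣q → odd (ℕ.∣m∣n⇒∣m+n (divides 1 refl) 2∣q))))

  abstract
    geometric-sum : ∀ u c → u ⊗ (c ⊗ (u ⊕ 1ₚ)) ⊕ (u ⊕ 1ₚ) ≈ (u ⊗ c ⊕ 1ₚ) ⊗ (u ⊕ 1ₚ)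
    geometric-sum = solve-∀ solverRing

    geometric-mod : ∀ u c p → c ⊗ (u ⊕ 1ₚ) ⊕ (c ⊕ p) ≈ (u ⊗ c ⊕ 1ₚ) ⊕ (p ⊕ 1ₚ)
    geometric-mod = solve-∀ solverRing

  geometric : ∀ e q → ∃[ c ] X^ (q * e) ⊕ 1ₚ ≈ c ⊗ (X^ e ⊕ 1ₚ) × X^ e ⊕ 1ₚ ∣ₚ c ⊕ parity q
  geometric e zero = [] , (mk λ s i → refl) , [] , ≈-refl
  geometric e (suc q) with c , e₁ , d ← geometric e q =
    X^ e ⊗ c ⊕ 1ₚ
    , ≈-trans (≈-trans (⊕-congʳ 1ₚ (X^-+ e (q * e))) (X^+1-sum (X^ e) (X^ (q * e))))
        (≈-trans (⊕-congʳ (X^ e ⊕ 1ₚ) (⊗-congˡ (X^ e) e₁)) (geometric-sum (X^ e) c))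
    , ∣ₚ-resp (geometric-mod (X^ e) c (parity q)) (∣ₚ-⊕ (c , ≈-refl) d)

  coprime-cofactor : ∀ e q → ¬ 2 ∣ q → ∃[ c ] X^ (q * e) ⊕ 1ₚ ≈ c ⊗ (X^ e ⊕ 1ₚ) ×
                     (∀ {f} → f ∣ₚ c → f ∣ₚ X^ e ⊕ 1ₚ → f ∣ₚ 1ₚ)
  coprime-cofactor e q odd with c , e₁ , d ← geometric e q = c , e₁ , λ f∣c f∣Xᵉ+1 →
    ∣ₚ-resp (lemma c 1ₚ) (∣ₚ-⊕ f∣c (∣ₚ-resp (⊕-congˡ c (parity-odd q odd)) (∣ₚ-trans f∣Xᵉ+1 d)))
    where
    abstract
      lemma : ∀ u v → u ⊕ (u ⊕ v) ≈ v
      lemma = solve-∀ solverRing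

  ω-if-∣ : ℕ → ℕ → ℕ
  ω-if-∣ e d = if does (d ∣? e) then ω d else 0

  interleaving-sum : ∀ {A : Set} (w : A → ℕ) {xs ys zs : List A} → Interleaving xs ys zs →
                     sum (map w zs) ≡ sum (map w xs) + sum (map w ys)
  interleaving-sum w [] = refl
  interleaving-sum w {x ∷ _} (consˡ i) = trans (cong (w x +_) (interleaving-sum w i)) (sym (ℕ.+-assoc (w x) _ _))
  interleaving-sum w {xs} {y ∷ ys} (consʳ i) =
    trans (cong (w y +_) (interleaving-sum w i)) (trans (sym (ℕ.+-assoc (w y) _ _))
      (trans (cong (_+ sum (map w ys)) (ℕ.+-comm (w y) (sum (map w xs)))) (ℕ.+-assoc (sum (map w xs)) (w y) _)))

  -- Since (b + 1)/e is odd, t^(b+1) + 1 is the product of tᵉ + 1 and a polynomial coprime to it.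
  -- Factors of the former have order dividing e and factors of the latter do not, so the sum is the
  -- degree of tᵉ + 1. These equations for all e are what gets inverted to count factors.
  Σω-∣ : ∀ {b e} (fs : List (Factor (suc b))) → ¬ 2 ∣ suc b → ∏ᶠ fs ≈ X^ (suc b) ⊕ 1ₚ → e ∣ suc b →
         sum (map (ω-if-∣ e ∘ label) fs) ≡ e
  Σω-∣ {b} {zero} fs odd e∏ (divides q eq) = contradiction (trans eq (ℕ.*-zeroʳ q)) λ ()
  Σω-∣ {b} {e@(suc e′)} fs odd e∏ (divides q eq)
    with c , e₁ , coprime ← coprime-cofactor e q (λ 2∣q → odd (subst (2 ∣_) (sym eq) (ℕ.∣m⇒∣m*n e 2∣q)))
    with e₂ ← subst (λ n → X^ n ⊕ 1ₚ ≈ c ⊗ (X^ e ⊕ 1ₚ)) (sym eq) e₁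
    with k , z , c≈z , _ ← quotient-degree (true ∷ Vec.replicate b false) (true ∷ Vec.replicate e′ false) c
           (≈-trans (≈-sym (X^b+1-monic b)) (≈-trans e₂ (⊗-congˡ c (X^b+1-monic e′))))
    with gs , cs , i , eg , ec ← ∏-split fs (true ∷ Vec.replicate e′ false) z
           (≈-trans e∏ (≈-trans e₂ (≈-trans (⊗-comm c (X^ e ⊕ 1ₚ)) (⊗-cong (X^b+1-monic e′) c≈z))))
    = begin
      sum (map w fs)                    ≡⟨ interleaving-sum w i ⟩
      sum (map w gs) + sum (map w cs)   ≡⟨ cong₂ _+_ (divisors-part gs (∣∏ (map monicPoly gs)) (≈-trans (X^b+1-monic e′) eg))
                                                     (coprime-part cs (∣∏ (map monicPoly cs)) (≈-trans c≈z ec)) ⟩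
      Σω gs + 0                         ≡⟨ ℕ.+-identityʳ _ ⟩
      Σω gs                             ≡⟨ monic≈∏⇒degree odd (true ∷ Vec.replicate e′ false) gs eg ⟨
      e                                 ∎
    where
    open ≡-Reasoning
    w = ω-if-∣ e ∘ label
    divisors-part : ∀ {p} gs → All (λ f → poly f ∣ₚ p) (map monicPoly gs) → X^ e ⊕ 1ₚ ≈ p → sum (map w gs) ≡ Σω gs
    divisors-part []       []       eg = refl
    divisors-part (f ∷ gs) (d ∷ ds) eg = cong₂ _+_ w≡ω (divisors-part gs ds eg)
      where
      w≡ω : w f ≡ ω (label f)
      w≡ω with label f ∣? e
      ... | yes _ = refl
      ... | no ∤e = contradiction (Order.∣ₚ⇒∣ (ord f) (∣ₚ-resp (≈-sym eg) d)) ∤e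
    coprime-part : ∀ {p} cs → All (λ f → poly f ∣ₚ p) (map monicPoly cs) → c ≈ p → sum (map w cs) ≡ 0
    coprime-part []       []       ec = refl
    coprime-part (f ∷ cs) (d ∷ ds) ec = cong₂ _+_ w≡0 (coprime-part cs ds ec)
      where
      w≡0 : w f ≡ 0
      w≡0 with label f ∣? e
      ... | no _   = refl
      ... | yes ∣e = contradiction (coprime (∣ₚ-resp (≈-sym ec) d) (Order.∣⇒∣ₚ (ord f) ∣e)) (irreducible⇒∤1 (factor f) (irr f))

-- Sums over divisors, Euler's function and Möbius inversion.

module Totient where

  import Algebra.Properties.CommutativeSemigroup as CommutativeSemigroupProperties
  open import Data.List.Base using (List; []; _∷_; length; map; filter; upTo)
  open import Data.List.Membership.Propositional using (_∈_)
  open import Data.List.Membership.Propositional.Properties using (∈-map⁺; ∈-map⁻; ∈-filter⁺; ∈-filter⁻; ∈-upTo⁺; ∈-upTo⁻)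
  open import Data.List.Membership.Propositional.Properties.WithK using (unique∧set⇒bag)
  open import Data.List.Properties using (length-map; length-upTo; filter-accept; filter-reject)
  open import Data.List.Relation.Binary.BagAndSetEquality using (∼bag⇒↭)
  open import Data.List.Relation.Binary.Permutation.Propositional.Properties using (↭-length)
  open import Data.List.Relation.Unary.Any using (here; there)
  open import Data.List.Relation.Unary.All as All using (All; []; _∷_)
  open import Data.List.Relation.Unary.AllPairs using ([]; _∷_)
  open import Data.List.Relation.Unary.Unique.Propositional using (Unique)
  import Data.List.Relation.Unary.Unique.Propositional.Properties as Unique
  open import Data.Nat.Coprimality using (coprime?; coprime⇒gcd≡1; gcd≡1⇒coprime)
  open import Data.Nat.Divisibility
  open import Data.Nat.GCD using (gcd; gcd[m,n]∣m; gcd[m,n]∣n; c*gcd[m,n]≡gcd[cm,cn])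
  open import Data.Nat.Induction using (<-wellFounded)
  open import Data.Nat.ListAction using (sum)
  open import Data.Nat.Properties
  open import Function.Bundles using (mk⇔)
  open import Induction.WellFounded using (Acc; acc)
  open import Relation.Binary.Definitions using (tri<; tri≈; tri>)
  open import Relation.Nullary.Decidable using (dec-true; dec-false)
  open import Defs using ([1‥_]; divisors; φ)

  count : ℕ → List ℕ → ℕ
  count d xs = length (filter (d ≟_) xs)

  unique-length : ∀ {xs ys : List ℕ} → Unique xs → Unique ys →
                  (∀ {x} → x ∈ xs → x ∈ ys) → (∀ {x} → x ∈ ys → x ∈ xs) → length xs ≡ length ys
  unique-length ux uy f g = ↭-length (∼bag⇒↭ (unique∧set⇒bag ux uy (mk⇔ f g)))

  ∈-[1‥]⁺ : ∀ {m n} → 1 ≤ m → m ≤ n → m ∈ [1‥ n ]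
  ∈-[1‥]⁺ {suc m} _ m<n = ∈-map⁺ suc (∈-upTo⁺ m<n)

  ∈-[1‥]⁻ : ∀ {m n} → m ∈ [1‥ n ] → 1 ≤ m × m ≤ n
  ∈-[1‥]⁻ m∈ with _ , i∈ , refl ← ∈-map⁻ suc m∈ = s≤s z≤n , ∈-upTo⁻ i∈

  [1‥]-unique : ∀ n → Unique [1‥ n ]
  [1‥]-unique n = Unique.map⁺ suc-injective (Unique.upTo⁺ n)

  ∈-divisors⁺ : ∀ {d n} → 1 ≤ n → d ∣ n → d ∈ divisors n
  ∈-divisors⁺ {zero} 1≤n d∣n with refl ← 0∣⇒≡0 d∣n = contradiction 1≤n λ ()
  ∈-divisors⁺ {suc d} {n@(suc _)} _ d∣n = ∈-filter⁺ (_∣? n) (∈-[1‥]⁺ (s≤s z≤n) (∣⇒≤ d∣n)) d∣n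

  ∈-divisors⁻ : ∀ {d n} → d ∈ divisors n → d ∣ n
  ∈-divisors⁻ {n = n} d∈ = proj₂ (∈-filter⁻ (_∣? n) {xs = [1‥ n ]} d∈)

  divisors-unique : ∀ n → Unique (divisors n)
  divisors-unique n = Unique.filter⁺ (_∣? n) ([1‥]-unique n)

  open CommutativeSemigroupProperties +-commutativeSemigroup using () renaming (interchange to +-interchange)

  sum-map-+ : ∀ {A : Set} (u v : A → ℕ) xs → sum (map (λ x → u x + v x) xs) ≡ sum (map u xs) + sum (map v xs)
  sum-map-+ u v []       = refl
  sum-map-+ u v (x ∷ xs) = trans (cong (u x + v x +_) (sum-map-+ u v xs)) (+-interchange (u x) (v x) _ _)

  sum-cong : ∀ {A : Set} {u v : A → ℕ} xs → (∀ {x} → x ∈ xs → u x ≡ v x) → sum (map u xs) ≡ sum (map v xs)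
  sum-cong []       eq = refl
  sum-cong (x ∷ xs) eq = cong₂ _+_ (eq (here refl)) (sum-cong xs (eq ∘ there))

  sum-zero : ∀ {A : Set} {u : A → ℕ} xs → (∀ {x} → x ∈ xs → u x ≡ 0) → sum (map u xs) ≡ 0
  sum-zero []       eq = refl
  sum-zero (x ∷ xs) eq = cong₂ _+_ (eq (here refl)) (sum-zero xs (eq ∘ there))

  at-point : ℕ → (ℕ → ℕ) → ℕ → ℕ
  at-point x g d = if does (d ≟ x) then g d else 0

  at-point-≢ : ∀ {x d} g → d ≢ x → at-point x g d ≡ 0
  at-point-≢ {x} {d} g d≢x rewrite dec-false (d ≟ x) d≢x = refl

  at-point-≡ : ∀ x g → at-point x g x ≡ g x
  at-point-≡ x g rewrite dec-true (x ≟ x) refl = refl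

  sum-at-point : ∀ {x g ds} → Unique ds → x ∈ ds → sum (map (at-point x g) ds) ≡ g x
  sum-at-point {x} {g} {d ∷ ds} (d∉ ∷ u) (here refl) =
    trans (cong₂ _+_ (at-point-≡ d g) (sum-zero ds λ {y} y∈ → at-point-≢ g λ { refl → All.lookup d∉ y∈ refl })) (+-identityʳ _)
  sum-at-point {x} {g} {d ∷ ds} (d∉ ∷ u) (there x∈) =
    cong₂ _+_ (at-point-≢ g λ { refl → All.lookup d∉ x∈ refl }) (sum-at-point u x∈)

  count-∷ : ∀ d x xs g → count d (x ∷ xs) * g d ≡ at-point x g d + count d xs * g d
  count-∷ d x xs g with d ≟ x
  ... | yes refl = trans (cong (λ l → length l * g d) (filter-accept (d ≟_) {xs = xs} refl))
    (cong (_+ count d xs * g d) (sym (at-point-≡ d g)))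
  ... | no d≢x = trans (cong (λ l → length l * g d) (filter-reject (d ≟_) {xs = xs} d≢x))
    (cong (_+ count d xs * g d) (sym (at-point-≢ g d≢x)))

  if-∣ : ℕ → (ℕ → ℕ) → ℕ → ℕ
  if-∣ e g x = if does (x ∣? e) then g x else 0

  -- Groups the entries by value; those not dividing e weigh nothing on the left and have no term on
  -- the right.
  sum-by-label : ∀ e g xs → 1 ≤ e → sum (map (if-∣ e g) xs) ≡ sum (map (λ d → count d xs * g d) (divisors e))
  sum-by-label e g []       1≤e = sym (sum-zero (divisors e) λ _ → refl)
  sum-by-label e g (x ∷ xs) 1≤e = begin
    if-∣ e g x + sum (map (if-∣ e g) xs)
      ≡⟨ cong₂ _+_ point (sum-by-label e g xs 1≤e) ⟩
    sum (map (at-point x g) (divisors e)) + sum (map (λ d → count d xs * g d) (divisors e))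
      ≡⟨ sum-map-+ _ _ (divisors e) ⟨
    sum (map (λ d → at-point x g d + count d xs * g d) (divisors e))
      ≡⟨ sum-cong (divisors e) (λ {d} _ → sym (count-∷ d x xs g)) ⟩
    sum (map (λ d → count d (x ∷ xs) * g d) (divisors e)) ∎
    where
    open ≡-Reasoning
    point : if-∣ e g x ≡ sum (map (at-point x g) (divisors e))
    point with x ∣? e
    ... | yes x∣e = sym (sum-at-point (divisors-unique e) (∈-divisors⁺ 1≤e x∣e))
    ... | no  x∤e = sym (sum-zero (divisors e) λ d∈ → at-point-≢ g λ { refl → x∤e (∈-divisors⁻ d∈) })

  sum-mono-≤ : ∀ {u v : ℕ → ℕ} xs → (∀ {x} → x ∈ xs → u x ≤ v x) → sum (map u xs) ≤ sum (map v xs)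
  sum-mono-≤ []       le = z≤n
  sum-mono-≤ (x ∷ xs) le = +-mono-≤ (le (here refl)) (sum-mono-≤ xs (le ∘ there))

  sum-mono-< : ∀ {u v : ℕ → ℕ} {e} xs → (∀ {x} → x ∈ xs → u x ≤ v x) → e ∈ xs → u e < v e →
               sum (map u xs) < sum (map v xs)
  sum-mono-< (x ∷ xs) le (here refl) lt = +-mono-<-≤ lt (sum-mono-≤ xs (le ∘ there))
  sum-mono-< (x ∷ xs) le (there e∈)  lt = +-mono-≤-< (le (here refl)) (sum-mono-< xs (le ∘ there) e∈ lt)

  -- A strict inequality at `e` in either direction would make the sums differ; this takes the place
  -- of cancelling all the other terms.
  agree-at : ∀ {u v : ℕ → ℕ} {e} xs → (∀ {x} → x ∈ xs → x ≢ e → u x ≡ v x) → e ∈ xs →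
             sum (map u xs) ≡ sum (map v xs) → u e ≡ v e
  agree-at {u} {v} {e} xs eq e∈ sums with <-cmp (u e) (v e)
  ... | tri≈ _ u≡v _ = u≡v
  ... | tri< u<v _ _ = contradiction sums (<⇒≢ (sum-mono-< xs le e∈ u<v))
    where
    le : ∀ {x} → x ∈ xs → u x ≤ v x
    le {x} x∈ with x ≟ e
    ... | yes refl = <⇒≤ u<v
    ... | no  x≢e  = ≤-reflexive (eq x∈ x≢e)
  ... | tri> _ _ v<u = contradiction (sym sums) (<⇒≢ (sum-mono-< xs le e∈ v<u))
    where
    le : ∀ {x} → x ∈ xs → v x ≤ u x
    le {x} x∈ with x ≟ e
    ... | yes refl = <⇒≤ v<u
    ... | no  x≢e  = ≤-reflexive (sym (eq x∈ x≢e))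

  -- The additive order of m modulo e.
  addOrder : ℕ → ℕ → ℕ
  addOrder e m = quotient (gcd[m,n]∣n m e)

  addOrder-gcd : ∀ e m → e ≡ addOrder e m * gcd m e
  addOrder-gcd e m = _∣_.equality (gcd[m,n]∣n m e)

  -- With e = cd, the order e/gcd(m, e) equals d exactly when gcd(m, e) = c, that is, when m = cm′
  -- with m′ coprime to d.
  count-addOrder : ∀ {d e} → 1 ≤ e → d ∣ e → count d (map (addOrder e) [1‥ e ]) ≡ φ d
  count-addOrder {d} {e} 1≤e (divides c e≡c*d) = begin
    length (filter (d ≟_) (map (addOrder e) [1‥ e ]))          ≡⟨ length-filter-map [1‥ e ] ⟩
    length (filter (λ m → d ≟ addOrder e m) [1‥ e ])           ≡⟨ unique-length
        (Unique.filter⁺ _ ([1‥]-unique e)) (Unique.map⁺ (*-cancelˡ-≡ _ _ c) (Unique.filter⁺ _ ([1‥]-unique d))) to from ⟩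
    length (map (c *_) (filter (λ m → coprime? m d) [1‥ d ]))  ≡⟨ length-map (c *_) (filter (λ m → coprime? m d) [1‥ d ]) ⟩
    φ d                                                        ∎
    where
    open ≡-Reasoning
    instance
      c≢0 : NonZero c
      c≢0 = ≢-nonZero λ { refl → contradiction (≤-trans 1≤e (≤-reflexive e≡c*d)) λ () }
      d≢0 : NonZero d
      d≢0 = ≢-nonZero λ { refl → contradiction (≤-trans 1≤e (≤-reflexive (trans e≡c*d (*-zeroʳ c)))) λ () }
    length-filter-map : ∀ xs → length (filter (d ≟_) (map (addOrder e) xs)) ≡ length (filter (λ m → d ≟ addOrder e m) xs)
    length-filter-map []       = refl
    length-filter-map (x ∷ xs) with does (d ≟ addOrder e x)
    ... | true  = cong suc (length-filter-map xs)
    ... | false = length-filter-map xs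
    gcd-scaled : ∀ m → gcd (c * m) e ≡ c * gcd m d
    gcd-scaled m = trans (cong (gcd (c * m)) e≡c*d) (sym (c*gcd[m,n]≡gcd[cm,cn] c m d))
    to : ∀ {m} → m ∈ filter (λ m → d ≟ addOrder e m) [1‥ e ] → m ∈ map (c *_) (filter (λ m → coprime? m d) [1‥ d ])
    to {m} m∈ with m∈′ , d≡ ← ∈-filter⁻ (λ m → d ≟ addOrder e m) {xs = [1‥ e ]} m∈
              with 1≤m , m≤e ← ∈-[1‥]⁻ m∈′ = helper (gcd[m,n]∣m m e)
      where
      gcd≡c : gcd m e ≡ c
      gcd≡c = *-cancelˡ-≡ _ _ d (trans (cong (_* gcd m e) d≡) (trans (sym (addOrder-gcd e m)) (trans e≡c*d (*-comm c d))))
      helper : gcd m e ∣ m → m ∈ map (c *_) (filter (λ m → coprime? m d) [1‥ d ])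
      helper (divides q m≡q*g) = subst (_∈ _) (sym m≡c*q) (∈-map⁺ (c *_) (∈-filter⁺ (λ m → coprime? m d)
        (∈-[1‥]⁺ 1≤q (*-cancelˡ-≤ c (≤-trans (≤-reflexive (sym m≡c*q)) (≤-trans m≤e (≤-reflexive e≡c*d)))))
        (gcd≡1⇒coprime (*-cancelˡ-≡ _ _ c (trans (sym (gcd-scaled q))
          (trans (cong (λ x → gcd x e) (sym m≡c*q)) (trans gcd≡c (sym (*-identityʳ c)))))))))
        where
        m≡c*q : m ≡ c * q
        m≡c*q = trans m≡q*g (trans (cong (q *_) gcd≡c) (*-comm q c))
        1≤q : 1 ≤ q
        1≤q = n≢0⇒n>0 λ { refl → contradiction (≤-trans 1≤m (≤-reflexive m≡q*g)) λ () }
    from : ∀ {m} → m ∈ map (c *_) (filter (λ m → coprime? m d) [1‥ d ]) → m ∈ filter (λ m → d ≟ addOrder e m) [1‥ e ]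
    from m∈ with m , m∈′ , refl ← ∈-map⁻ (c *_) m∈
            with m∈″ , cop ← ∈-filter⁻ (λ m → coprime? m d) {xs = [1‥ d ]} m∈′
            with 1≤m , m≤d ← ∈-[1‥]⁻ m∈″
      = ∈-filter⁺ (λ m → d ≟ addOrder e m)
          (∈-[1‥]⁺ (*-mono-≤ (>-nonZero⁻¹ c) 1≤m) (≤-trans (*-monoʳ-≤ c m≤d) (≤-reflexive (sym e≡c*d))))
          (*-cancelʳ-≡ _ _ c (trans (*-comm d c) (trans (sym e≡c*d) (trans (addOrder-gcd e (c * m))
            (cong (addOrder e (c * m) *_) (trans (gcd-scaled m) (trans (cong (c *_) (coprime⇒gcd≡1 cop)) (*-identityʳ c))))))))

  -- Sorts 1, ..., e by additive order modulo e, which always divides e.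
  Σφ≡ : ∀ e → 1 ≤ e → sum (map φ (divisors e)) ≡ e
  Σφ≡ e 1≤e = begin
    sum (map φ (divisors e))
      ≡⟨ sum-cong (divisors e) (λ {d} d∈ → trans (sym (count-addOrder 1≤e (∈-divisors⁻ d∈))) (sym (*-identityʳ _))) ⟩
    sum (map (λ d → count d orders * 1) (divisors e))
      ≡⟨ sum-by-label e (λ _ → 1) orders 1≤e ⟨
    sum (map (if-∣ e (λ _ → 1)) orders)
      ≡⟨ all-divide [1‥ e ] ⟩
    length [1‥ e ]
      ≡⟨ trans (length-map suc (upTo e)) (length-upTo e) ⟩
    e ∎
    where
    open ≡-Reasoning
    orders = map (addOrder e) [1‥ e ]
    all-divide : ∀ ms → sum (map (if-∣ e (λ _ → 1)) (map (addOrder e) ms)) ≡ length ms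
    all-divide [] = refl
    all-divide (m ∷ ms) with addOrder e m ∣? e
    ... | yes _ = cong suc (all-divide ms)
    ... | no  ∤ = contradiction (divides (gcd m e) (trans (addOrder-gcd e m) (*-comm _ (gcd m e)))) ∤

  -- Möbius inversion for the masses count d xs · g d.
  mass≡φ : ∀ {b} (xs : List ℕ) g → 1 ≤ b → (∀ {e} → e ∣ b → sum (map (if-∣ e g) xs) ≡ e) →
           ∀ {d} → d ∣ b → count d xs * g d ≡ φ d
  mass≡φ {b} xs g 1≤b total {d} d∣b = go d d∣b (<-wellFounded d)
    where
    positive : ∀ {d} → d ∣ b → 1 ≤ d
    positive {zero} 0∣b with refl ← 0∣⇒≡0 0∣b = contradiction 1≤b λ ()
    positive {suc d} _  = s≤s z≤n
    go : ∀ d → d ∣ b → Acc _<_ d → count d xs * g d ≡ φ d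
    -- At the proper divisors of d the masses agree with φ by recursion, and both total d over all
    -- divisors of d.
    go d d∣b (acc rs) = agree-at {λ x → count x xs * g x} {φ} (divisors d)
      (λ {x} x∈ x≢d → go x (∣-trans (∈-divisors⁻ x∈) d∣b)
         (rs (≤∧≢⇒< (∣⇒≤ {{>-nonZero (positive d∣b)}} (∈-divisors⁻ x∈)) x≢d)))
      (∈-divisors⁺ (positive d∣b) ∣-refl)
      (trans (sym (sum-by-label d g xs (positive d∣b))) (trans (total d∣b) (sym (Σφ≡ d (positive d∣b)))))

-- Rotations of ℤₙ, and Cayley graphs from translation-invariant adjacency.

module CyclicGroup where

  open import Algebra.Bundles using (Group)
  open import Data.Fin.Base using (Fin; zero; suc; toℕ)
  open import Data.Fin.Properties using (2↔Bool; toℕ<n; toℕ-fromℕ<; toℕ-injective; nonZeroIndex)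
  open import Data.Nat.DivMod
  open import Data.Nat.Properties
  open import Function.Bundles using (mk⇔; Inverse)
  open import Defs using (next; SimpleGraph; ConnectionSet; IsCayleyGraph)

  iter : ∀ {A : Set} → (A → A) → ℕ → A → A
  iter f zero    x = x
  iter f (suc m) x = f (iter f m x)

  iter-+ : ∀ {A : Set} (f : A → A) m k x → iter f (m + k) x ≡ iter f m (iter f k x)
  iter-+ f zero    k x = refl
  iter-+ f (suc m) k x = cong f (iter-+ f m k x)

  iter-swap : ∀ {A : Set} (f : A → A) m x → iter f m (f x) ≡ f (iter f m x)
  iter-swap f zero    x = refl
  iter-swap f (suc m) x = cong f (iter-swap f m x)

  iter-comm : ∀ {A : Set} (f : A → A) m k x → iter f m (iter f k x) ≡ iter f k (iter f m x)
  iter-comm f m k x = trans (sym (iter-+ f m k x)) (trans (cong (λ j → iter f j x) (+-comm m k)) (iter-+ f k m x))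

  iter-periodic : ∀ {A : Set} (f : A → A) n → (∀ x → iter f n x ≡ x) → ∀ q x → iter f (q * n) x ≡ x
  iter-periodic f n per zero    x = refl
  iter-periodic f n per (suc q) x =
    trans (iter-+ f n (q * n) x) (trans (per (iter f (q * n) x)) (iter-periodic f n per q x))

  iter-% : ∀ {A : Set} (f : A → A) n .{{_ : NonZero n}} → (∀ x → iter f n x ≡ x) → ∀ m x → iter f (m % n) x ≡ iter f m x
  iter-% f n per m x = sym (begin
    iter f m x                              ≡⟨ cong (λ j → iter f j x) (m≡m%n+[m/n]*n m n) ⟩
    iter f (m % n + m / n * n) x            ≡⟨ iter-+ f (m % n) _ x ⟩
    iter f (m % n) (iter f (m / n * n) x)   ≡⟨ cong (iter f (m % n)) (iter-periodic f n per (m / n) x) ⟩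
    iter f (m % n) x                        ∎)
    where open ≡-Reasoning

  open module 2↔B = Inverse 2↔Bool using () renaming (to to bool; from to bit) public

  bool-bit : ∀ a → bool (bit a) ≡ a
  bool-bit false = refl
  bool-bit true  = refl

  bit-bool : ∀ a → bit (bool a) ≡ a
  bit-bool zero       = refl
  bit-bool (suc zero) = refl

  -- nx m is i ↦ i + m on ℤₙ.
  nx : ∀ {n} → ℕ → Fin n → Fin n
  nx = iter next

  toℕ-next : ∀ {n} .{{_ : NonZero n}} (p : Fin n) → toℕ (next p) ≡ suc (toℕ p) % n
  toℕ-next p = toℕ-fromℕ< _

  toℕ-nx : ∀ {n} .{{_ : NonZero n}} m (p : Fin n) → toℕ (nx m p) ≡ (m + toℕ p) % n
  toℕ-nx {n} zero    p = sym (m<n⇒m%n≡m (toℕ<n p))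
  toℕ-nx {n} (suc m) p = begin
    toℕ (next (nx m p))          ≡⟨ toℕ-next (nx m p) ⟩
    suc (toℕ (nx m p)) % n       ≡⟨ cong (λ j → suc j % n) (toℕ-nx m p) ⟩
    suc ((m + toℕ p) % n) % n    ≡⟨ [m+n%d]%d≡[m+n]%d 1 (m + toℕ p) n ⟩
    suc (m + toℕ p) % n          ∎
    where
    open ≡-Reasoning
    [m+n%d]%d≡[m+n]%d : ∀ m k d .{{_ : NonZero d}} → (m + k % d) % d ≡ (m + k) % d
    [m+n%d]%d≡[m+n]%d m k d = trans (%-distribˡ-+ m (k % d) d)
      (trans (cong (λ j → (m % d + j) % d) (m%n%n≡m%n k d)) (sym (%-distribˡ-+ m k d)))

  nx-n : ∀ {n} (p : Fin n) → nx n p ≡ p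
  nx-n {n} p = toℕ-injective (trans (toℕ-nx n p) (trans (cong (_% n) (+-comm n (toℕ p)))
    (trans ([m+n]%n≡m%n (toℕ p) n) (m<n⇒m%n≡m (toℕ<n p)))))
    where instance _ = nonZeroIndex p

  next-injective : ∀ {n} {p q : Fin n} → next p ≡ next q → p ≡ q
  next-injective {suc n} {p} {q} e = begin
    p               ≡⟨ nx-n p ⟨
    nx (suc n) p    ≡⟨ iter-swap next n p ⟨
    nx n (next p)   ≡⟨ cong (nx n) e ⟩
    nx n (next q)   ≡⟨ iter-swap next n q ⟩
    nx (suc n) q    ≡⟨ nx-n q ⟩
    q               ∎
    where open ≡-Reasoning

  nx-% : ∀ {n} .{{_ : NonZero n}} m (p : Fin n) → nx (m % n) p ≡ nx m p
  nx-% {n} m p = iter-% next n nx-n m p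

  reach : ∀ {n} (p q : Fin n) → ∃[ m ] nx m p ≡ q
  reach {n} p q = (n ∸ toℕ p) + toℕ q , toℕ-injective (begin
    toℕ (nx ((n ∸ toℕ p) + toℕ q) p)       ≡⟨ toℕ-nx _ p ⟩
    ((n ∸ toℕ p) + toℕ q + toℕ p) % n      ≡⟨ cong (_% n) (+-assoc (n ∸ toℕ p) (toℕ q) (toℕ p)) ⟩
    ((n ∸ toℕ p) + (toℕ q + toℕ p)) % n    ≡⟨ cong (λ j → ((n ∸ toℕ p) + j) % n) (+-comm (toℕ q) (toℕ p)) ⟩
    ((n ∸ toℕ p) + (toℕ p + toℕ q)) % n    ≡⟨ cong (_% n) (+-assoc (n ∸ toℕ p) (toℕ p) (toℕ q)) ⟨
    ((n ∸ toℕ p) + toℕ p + toℕ q) % n      ≡⟨ cong (λ j → (j + toℕ q) % n) (m∸n+n≡m (<⇒≤ (toℕ<n p))) ⟩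
    (n + toℕ q) % n                        ≡⟨ cong (_% n) (+-comm n (toℕ q)) ⟩
    (toℕ q + n) % n                        ≡⟨ [m+n]%n≡m%n (toℕ q) n ⟩
    toℕ q % n                              ≡⟨ m<n⇒m%n≡m (toℕ<n q) ⟩
    toℕ q                                  ∎)
    where
    open ≡-Reasoning
    instance _ = nonZeroIndex p

  nx-no-fixpoint : ∀ {n} m (p : Fin n) → 0 < m → m < n → nx m p ≢ p
  nx-no-fixpoint {n} m p 0<m m<n e = <⇒≢ 0<m (sym (begin
    m                                        ≡⟨ m<n⇒m%n≡m m<n ⟨
    m % n                                    ≡⟨ [m+n]%n≡m%n m n ⟨
    (m + n) % n                              ≡⟨ cong (λ j → (m + j) % n) (m+[n∸m]≡n (<⇒≤ (toℕ<n p))) ⟨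
    (m + (toℕ p + (n ∸ toℕ p))) % n          ≡⟨ cong (_% n) (+-assoc m (toℕ p) _) ⟨
    (m + toℕ p + (n ∸ toℕ p)) % n            ≡⟨ %-distribˡ-+ (m + toℕ p) (n ∸ toℕ p) n ⟩
    ((m + toℕ p) % n + (n ∸ toℕ p) % n) % n  ≡⟨ cong (λ j → (j + (n ∸ toℕ p) % n) % n) (trans (sym (toℕ-nx m p)) (trans (cong toℕ e) (sym (m<n⇒m%n≡m (toℕ<n p))))) ⟩
    (toℕ p % n + (n ∸ toℕ p) % n) % n        ≡⟨ %-distribˡ-+ (toℕ p) (n ∸ toℕ p) n ⟨
    (toℕ p + (n ∸ toℕ p)) % n                ≡⟨ cong (_% n) (m+[n∸m]≡n (<⇒≤ (toℕ<n p))) ⟩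
    n % n                                    ≡⟨ n%n≡0 n ⟩
    0                                        ∎))
    where
    open ≡-Reasoning
    instance _ = nonZeroIndex p

  module _ (Γ : SimpleGraph) (G : Group 0ℓ 0ℓ) where
    private
      module Γ = SimpleGraph Γ
      module G = Group G

    -- The connection set is the neighbourhood of ε. Translating by u⁻¹ moves the edge uv to one
    -- from ε to vu⁻¹, and translating back by u gives the converse, so one implication about
    -- adjacency is enough as a hypothesis.
    translations⇒Cayley : (iso : Inverse Γ.vertices G.setoid) → let open Inverse iso in
                          (∀ g {u v} → Γ.Adj u v → Γ.Adj (from (to u G.∙ g)) (from (to v G.∙ g))) →
                          IsCayleyGraph Γ
    translations⇒Cayley iso translate = G , connections , record
      { bijection = iso
      ; preserves = λ u v → mk⇔
          (λ a → adj (G.inverseʳ (to u)) G.refl (translate (to u G.⁻¹) a))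
          (λ a → proj₂ Γ.Adj-resp (strictlyInverseʳ u) (proj₁ Γ.Adj-resp (strictlyInverseʳ v)
             (adj (G.trans (G.∙-congʳ (strictlyInverseˡ G.ε)) (G.identityˡ (to u)))
                  (G.trans (G.∙-congʳ (strictlyInverseˡ _)) (G.trans (G.assoc _ _ _)
                    (G.trans (G.∙-congˡ (G.inverseˡ (to u))) (G.identityʳ (to v)))))
               (translate (to u) a))))
      }
      where
      open Inverse iso
      adj : ∀ {g g′ h h′} → g G.≈ g′ → h G.≈ h′ → Γ.Adj (from g) (from h) → Γ.Adj (from g′) (from h′)
      adj e e′ a = proj₂ Γ.Adj-resp (from-cong e) (proj₁ Γ.Adj-resp (from-cong e′) a)
      connections : ConnectionSet G
      connections = record
        { S     = λ g → Γ.Adj (from G.ε) (from g)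
        ; resp  = λ e → adj G.refl e
        ; ε∉S   = Γ.Adj-irrefl Γ-refl
        ; S⁻¹⊆S = λ {s} a → Γ.Adj-sym (adj (G.trans (G.∙-congʳ (strictlyInverseˡ G.ε)) (G.identityˡ _))
                    (G.trans (G.∙-congʳ (strictlyInverseˡ s)) (G.inverseʳ s)) (translate (s G.⁻¹) a))
        }
        where
        open import Relation.Binary.Bundles using (Setoid)
        Γ-refl = Setoid.refl Γ.vertices

-- Shift registers and the regular group for sufficiency.

module ShiftRegister where

  open import Algebra.Bundles using (Group)
  open import Data.Bool.Properties using (xor-assoc; xor-comm; xor-same; xor-identityʳ; ∧-distribˡ-xor)
  open import Data.Fin.Base using (Fin; zero; suc; toℕ)
  open import Data.Fin.Properties using (toℕ<n; toℕ-fromℕ<; toℕ-injective)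
  open import Data.Nat.DivMod
  open import Data.Nat.Properties
  open import Data.Vec.Base as Vec using (head; tail; init; _∷ʳ_; zipWith; replicate; map)
  open import Data.Vec.Properties using (zipWith-assoc; zipWith-comm; zipWith-identityˡ; init-∷ʳ; map-∘; map-id; map-cong)
  open import Function.Bundles using (Inverse; mk↔ₛ′)
  open import Defs
  open PolynomialRing hiding (at)
  open Factorisation using (monic; _∣ₚ_)
  open MultiplicativeOrder using (X^; 1ₚ; act-X^)
  open CyclicGroup

  private
    variable
      k : ℕ

  infixl 6 _⊞_
  _⊞_ : Vec Bool k → Vec Bool k → Vec Bool k
  _⊞_ = zipWith _xor_

  0ᵥ : Vec Bool k
  0ᵥ = replicate _ false

  ⊞-assoc : (x y z : Vec Bool k) → (x ⊞ y) ⊞ z ≡ x ⊞ (y ⊞ z)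
  ⊞-assoc = zipWith-assoc xor-assoc

  ⊞-comm : (x y : Vec Bool k) → x ⊞ y ≡ y ⊞ x
  ⊞-comm = zipWith-comm xor-comm

  ⊞-identityˡ : (x : Vec Bool k) → 0ᵥ ⊞ x ≡ x
  ⊞-identityˡ = zipWith-identityˡ λ _ → refl

  ⊞-identityʳ : (x : Vec Bool k) → x ⊞ 0ᵥ ≡ x
  ⊞-identityʳ x = trans (⊞-comm x 0ᵥ) (⊞-identityˡ x)

  ⊞-self : (x : Vec Bool k) → x ⊞ x ≡ 0ᵥ
  ⊞-self []      = refl
  ⊞-self (a ∷ x) = cong₂ _∷_ (xor-same a) (⊞-self x)

  dot : Vec Bool k → Vec Bool k → Bool
  dot []      []      = false
  dot (a ∷ h) (b ∷ x) = (a ∧ b) xor dot h x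

  dot-⊞ : (h x y : Vec Bool k) → dot h (x ⊞ y) ≡ dot h x xor dot h y
  dot-⊞ []      []      []      = refl
  dot-⊞ (a ∷ h) (b ∷ x) (c ∷ y) =
    trans (cong₂ _xor_ (∧-distribˡ-xor a b c) (dot-⊞ h x y)) (xor-interchange (a ∧ b) (a ∧ c) (dot h x) (dot h y))

  -- The shift register with feedback polynomial h(t) = tᵏ + hₖ₋₁tᵏ⁻¹ + … + h₀.
  register : Vec Bool (suc k) → Vec Bool (suc k) → Vec Bool (suc k)
  register h x = tail x ∷ʳ dot h x

  window : ∀ k → (ℕ → Bool) → ℕ → Vec Bool k
  window zero    s i = []
  window (suc k) s i = s i ∷ window k s (suc i)

  window-∷ʳ : ∀ k s i → window (suc k) s i ≡ window k s i ∷ʳ s (i + k)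
  window-∷ʳ zero    s i = cong (λ j → s j ∷ []) (sym (+-identityʳ i))
  window-∷ʳ (suc k) s i =
    cong (s i ∷_) (trans (window-∷ʳ k s (suc i)) (cong (λ j → window k s (suc i) ∷ʳ s j) (sym (+-suc i k))))

  ∷ʳ-last-injective : ∀ {A : Set} {n} (x y : Vec A n) {a b} → x ∷ʳ a ≡ y ∷ʳ b → a ≡ b
  ∷ʳ-last-injective []      []      refl = refl
  ∷ʳ-last-injective (_ ∷ x) (_ ∷ y) e    = ∷ʳ-last-injective x y (cong tail e)

  -- Replaces a trajectory of overlapping states by the scalar sequence of their first entries, on
  -- which polynomials act.
  shifting-windows : (Y : ℕ → Vec Bool (suc k)) → (∀ i → init (Y (suc i)) ≡ tail (Y i)) →
                     ∀ i → Y i ≡ window (suc k) (head ∘ Y) i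
  shifting-windows {zero} Y shift i with Y i
  ... | a ∷ [] = refl
  shifting-windows {suc k} Y shift i = begin
    Y i                                                     ≡⟨ η (Y i) ⟩
    head (Y i) ∷ tail (Y i)                                 ≡⟨ cong (head (Y i) ∷_) (shifting-windows (tail ∘ Y) shift′ i) ⟩
    head (Y i) ∷ window (suc k) (head ∘ tail ∘ Y) i         ≡⟨ cong (head (Y i) ∷_) (window-cong (suc k) i) ⟩
    head (Y i) ∷ window (suc k) (head ∘ Y) (suc i)          ∎
    where
    open ≡-Reasoning
    η : ∀ {n} (x : Vec Bool (suc n)) → x ≡ head x ∷ tail x
    η (_ ∷ _) = refl
    tail-init : ∀ {n} (x : Vec Bool (suc (suc n))) → init (tail x) ≡ tail (init x)
    tail-init (_ ∷ _ ∷ _) = refl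
    head-init : ∀ {n} (x : Vec Bool (suc (suc n))) → head (init x) ≡ head x
    head-init (_ ∷ _ ∷ _) = refl
    shift′ : ∀ i → init (tail (Y (suc i))) ≡ tail (tail (Y i))
    shift′ i = trans (tail-init (Y (suc i))) (cong tail (shift i))
    window-cong : ∀ m i → window m (head ∘ tail ∘ Y) i ≡ window m (head ∘ Y) (suc i)
    window-cong zero    i = refl
    window-cong (suc m) i = cong₂ _∷_ (trans (cong head (sym (shift i))) (head-init (Y (suc i)))) (window-cong m (suc i))

  -- So `monic h` annihilates s exactly when s obeys the feedback recurrence with coefficients h.
  act-monic : (h : Vec Bool k) → ∀ s i → act (monic h) s i ≡ dot h (window k s i) xor s (i + k)
  act-monic []      s i = trans (xor-identityʳ (s i)) (cong s (sym (+-identityʳ i)))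
  act-monic (a ∷ h) s i = begin
    (a ∧ s i) xor act (monic h) s (suc i)                             ≡⟨ cong ((a ∧ s i) xor_) (act-monic h s (suc i)) ⟩
    (a ∧ s i) xor (dot h (window _ s (suc i)) xor s (suc i + _))      ≡⟨ xor-assoc (a ∧ s i) _ _ ⟨
    ((a ∧ s i) xor dot h (window _ s (suc i))) xor s (suc i + _)      ≡⟨ cong (λ j → dot (a ∷ h) (window _ s i) xor s j) (sym (+-suc i _)) ⟩
    dot (a ∷ h) (window _ s i) xor s (i + suc _)                      ∎
    where open ≡-Reasoning

  -- The output sequence is annihilated by h(t), hence by its multiple tⁿ + 1, which says that it
  -- has period n; the states are windows of it.
  register-periodic : (h : Vec Bool (suc k)) → ∀ n → monic h ∣ₚ X^ n ⊕ 1ₚ → ∀ x → iter (register h) n x ≡ x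
  register-periodic {k} h n (q , e) x = begin
    Y n                     ≡⟨ Y-window n ⟩
    window (suc k) s n      ≡⟨ trans (cong (window (suc k) s) (sym (+-identityʳ n))) (window-periodic (suc k) 0) ⟩
    window (suc k) s 0      ≡⟨ Y-window 0 ⟨
    x                       ∎
    where
    open ≡-Reasoning
    Y : ℕ → Vec Bool (suc k)
    Y i = iter (register h) i x
    s : ℕ → Bool
    s = head ∘ Y
    Y-window : ∀ i → Y i ≡ window (suc k) s i
    Y-window = shifting-windows Y λ i → init-∷ʳ (dot h (Y i)) (tail (Y i))
    recurrence : ∀ i → s (i + suc k) ≡ dot h (window (suc k) s i)
    recurrence i = trans (cong s (+-suc i k)) (∷ʳ-last-injective (window k s (suc i)) (window k s (suc i)) (begin
      window k s (suc i) ∷ʳ s (suc i + k)                    ≡⟨ window-∷ʳ k s (suc i) ⟨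
      window (suc k) s (suc i)                               ≡⟨ Y-window (suc i) ⟨
      register h (Y i)                                       ≡⟨ cong (register h) (Y-window i) ⟩
      window k s (suc i) ∷ʳ dot h (window (suc k) s i)       ∎))
    annihilated : ∀ i → act (monic h) s i ≡ false
    annihilated i = trans (act-monic h s i) (trans (cong (dot h (window (suc k) s i) xor_) (recurrence i)) (xor-same (dot h (window (suc k) s i))))
    s-periodic : ∀ i → s (n + i) ≡ s i
    s-periodic i = xor≡false⇒≡ _ _ (begin
      s (n + i) xor s i                    ≡⟨ cong₂ _xor_ (act-X^ n s i) (act-X^ 0 s i) ⟨
      act (X^ n) s i xor act 1ₚ s i        ≡⟨ act-⊕ (X^ n) 1ₚ s i ⟨
      act (X^ n ⊕ 1ₚ) s i                  ≡⟨ _≈_.at e s i ⟩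
      act (q ⊗ monic h) s i                ≡⟨ act-⊗ q (monic h) s i ⟩
      act q (act (monic h) s) i            ≡⟨ act-cong q annihilated i ⟩
      act q (λ _ → false) i                ≡⟨ act-∧ q false s i ⟩
      false                                ∎)
    window-periodic : ∀ m i → window m s (n + i) ≡ window m s i
    window-periodic zero    i = refl
    window-periodic (suc m) i = cong₂ _∷_ (s-periodic i) (trans (cong (window m s) (sym (+-suc n i))) (window-periodic m (suc i)))

  private
    ∷ʳ-⊞ : ∀ {k} (x y : Vec Bool k) a b → (x ⊞ y) ∷ʳ (a xor b) ≡ (x ∷ʳ a) ⊞ (y ∷ʳ b)
    ∷ʳ-⊞ []      []      a b = refl
    ∷ʳ-⊞ (c ∷ x) (d ∷ y) a b = cong ((c xor d) ∷_) (∷ʳ-⊞ x y a b)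

    tail-zipWith : ∀ {k} (x y : Vec Bool (suc k)) → tail (x ⊞ y) ≡ tail x ⊞ tail y
    tail-zipWith (_ ∷ _) (_ ∷ _) = refl

    init-zipWith : ∀ {k} (x y : Vec Bool (suc k)) → init (x ⊞ y) ≡ init x ⊞ init y
    init-zipWith (a ∷ [])        (b ∷ [])        = refl
    init-zipWith (a ∷ x@(_ ∷ _)) (b ∷ y@(_ ∷ _)) = cong ((a xor b) ∷_) (init-zipWith x y)

    tail-map : ∀ {A B : Set} {k} (f : A → B) (x : Vec A (suc k)) → tail (map f x) ≡ map f (tail x)
    tail-map f (_ ∷ _) = refl

    init-map : ∀ {A B : Set} {k} (f : A → B) (x : Vec A (suc k)) → init (map f x) ≡ map f (init x)
    init-map f (a ∷ [])        = refl
    init-map f (a ∷ x@(_ ∷ _)) = cong (f a ∷_) (init-map f x)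

  register-⊞ : (h x y : Vec Bool (suc k)) → register h (x ⊞ y) ≡ register h x ⊞ register h y
  register-⊞ h x y =
    trans (cong₂ _∷ʳ_ (tail-zipWith x y) (dot-⊞ h x y)) (∷ʳ-⊞ (tail x) (tail y) (dot h x) (dot h y))

  iter-⊞ : ∀ {f : Vec Bool k → Vec Bool k} → (∀ x y → f (x ⊞ y) ≡ f x ⊞ f y) →
           ∀ m x y → iter f m (x ⊞ y) ≡ iter f m x ⊞ iter f m y
  iter-⊞         lin zero    x y = refl
  iter-⊞ {f = f} lin (suc m) x y = trans (cong f (iter-⊞ lin m x y)) (lin _ _)

  iter-0 : ∀ {f : Vec Bool k → Vec Bool k} → (∀ x y → f (x ⊞ y) ≡ f x ⊞ f y) → ∀ m → iter f m 0ᵥ ≡ 0ᵥ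
  iter-0 {f = f} lin m = begin
    iter f m 0ᵥ                                       ≡⟨ cong (iter f m) (⊞-self 0ᵥ) ⟨
    iter f m (0ᵥ ⊞ 0ᵥ)                                ≡⟨ iter-⊞ lin m 0ᵥ 0ᵥ ⟩
    iter f m 0ᵥ ⊞ iter f m 0ᵥ                         ≡⟨ ⊞-self _ ⟩
    0ᵥ                                                ∎
    where open ≡-Reasoning

  -- The semidirect product 𝔽₂ᵏ ⋊ ℤₙ given by a linear map A with Aⁿ = 1:
  -- (i , x) acts on 𝔽₂ᵏ by y ↦ Aⁱ y + x.
  module _ {n} .{{_ : NonZero n}} (A : Vec Bool k → Vec Bool k) (lin : ∀ x y → A (x ⊞ y) ≡ A x ⊞ A y)
           (per : ∀ x → iter A n x ≡ x) where

    private
      C = Fin n × Vec Bool k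

      _∙_ : C → C → C
      (i , x) ∙ (j , y) = nx (toℕ i) j , iter A (toℕ i) y ⊞ x

      0ₙ : Fin n
      0ₙ = 0 mod n

      inv : C → C
      inv (i , x) = nx (n ∸ toℕ i) 0ₙ , iter A (n ∸ toℕ i) x

      toℕ-0ₙ : toℕ 0ₙ ≡ 0
      toℕ-0ₙ = trans (toℕ-fromℕ< _) (m<n⇒m%n≡m (>-nonZero⁻¹ n))

      toℕ-nx-0 : ∀ m → toℕ (nx m 0ₙ) ≡ m % n
      toℕ-nx-0 m = trans (toℕ-nx m 0ₙ) (cong (_% n) (trans (cong (m +_) toℕ-0ₙ) (+-identityʳ m)))

      nx-toℕ-0 : ∀ i → nx (toℕ i) 0ₙ ≡ i
      nx-toℕ-0 i = toℕ-injective (trans (toℕ-nx-0 (toℕ i)) (m<n⇒m%n≡m (toℕ<n i)))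

      iter-nx : ∀ i m x → iter A (toℕ (nx m i)) x ≡ iter A m (iter A (toℕ i) x)
      iter-nx i m x = trans (cong (λ l → iter A l x) (toℕ-nx m i)) (trans (iter-% A n per (m + toℕ i) x) (iter-+ A m (toℕ i) x))

      iter-inverse : ∀ (i : Fin n) x → iter A (n ∸ toℕ i) (iter A (toℕ i) x) ≡ x
      iter-inverse i x = trans (sym (iter-+ A (n ∸ toℕ i) (toℕ i) x))
        (trans (cong (λ l → iter A l x) (m∸n+n≡m (<⇒≤ (toℕ<n i)))) (per x))

      assoc : ∀ u v w → (u ∙ v) ∙ w ≡ u ∙ (v ∙ w)
      assoc (i , x) (j , y) (l , z) = cong₂ _,_
        (trans (cong (λ m → nx m l) (toℕ-nx (toℕ i) j)) (trans (nx-% (toℕ i + toℕ j) l) (iter-+ next (toℕ i) (toℕ j) l)))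
        (begin
          iter A (toℕ (nx (toℕ i) j)) z ⊞ (iter A (toℕ i) y ⊞ x)
            ≡⟨ cong (_⊞ (iter A (toℕ i) y ⊞ x)) (iter-nx j (toℕ i) z) ⟩
          iter A (toℕ i) (iter A (toℕ j) z) ⊞ (iter A (toℕ i) y ⊞ x)
            ≡⟨ ⊞-assoc (iter A (toℕ i) (iter A (toℕ j) z)) _ x ⟨
          (iter A (toℕ i) (iter A (toℕ j) z) ⊞ iter A (toℕ i) y) ⊞ x
            ≡⟨ cong (_⊞ x) (iter-⊞ lin (toℕ i) (iter A (toℕ j) z) y) ⟨
          iter A (toℕ i) (iter A (toℕ j) z ⊞ y) ⊞ x ∎)
        where open ≡-Reasoning

      identityˡ : ∀ u → (0ₙ , 0ᵥ) ∙ u ≡ u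
      identityˡ (j , y) rewrite toℕ-0ₙ = cong (j ,_) (⊞-identityʳ y)

      identityʳ : ∀ u → u ∙ (0ₙ , 0ᵥ) ≡ u
      identityʳ (i , x) = cong₂ _,_ (nx-toℕ-0 i) (trans (cong (_⊞ x) (iter-0 lin (toℕ i))) (⊞-identityˡ x))

      inverseˡ : ∀ u → inv u ∙ u ≡ (0ₙ , 0ᵥ)
      inverseˡ (i , x) = cong₂ _,_
        (begin
          nx (toℕ (nx (n ∸ toℕ i) 0ₙ)) i      ≡⟨ cong (λ m → nx m i) (toℕ-nx-0 (n ∸ toℕ i)) ⟩
          nx ((n ∸ toℕ i) % n) i              ≡⟨ nx-% (n ∸ toℕ i) i ⟩
          nx (n ∸ toℕ i) i                    ≡⟨ cong (nx (n ∸ toℕ i)) (nx-toℕ-0 i) ⟨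
          nx (n ∸ toℕ i) (nx (toℕ i) 0ₙ)      ≡⟨ iter-+ next (n ∸ toℕ i) (toℕ i) 0ₙ ⟨
          nx (n ∸ toℕ i + toℕ i) 0ₙ           ≡⟨ cong (λ m → nx m 0ₙ) (m∸n+n≡m (<⇒≤ (toℕ<n i))) ⟩
          nx n 0ₙ                             ≡⟨ nx-n 0ₙ ⟩
          0ₙ                                  ∎)
        (begin
          iter A (toℕ (nx (n ∸ toℕ i) 0ₙ)) x ⊞ iter A (n ∸ toℕ i) x
            ≡⟨ cong (_⊞ iter A (n ∸ toℕ i) x) (trans (iter-nx 0ₙ (n ∸ toℕ i) x) (cong (λ m → iter A (n ∸ toℕ i) (iter A m x)) toℕ-0ₙ)) ⟩
          iter A (n ∸ toℕ i) x ⊞ iter A (n ∸ toℕ i) x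
            ≡⟨ ⊞-self _ ⟩
          0ᵥ ∎)
        where open ≡-Reasoning

      inverseʳ : ∀ u → u ∙ inv u ≡ (0ₙ , 0ᵥ)
      inverseʳ (i , x) = cong₂ _,_
        (begin
          nx (toℕ i) (nx (n ∸ toℕ i) 0ₙ)      ≡⟨ iter-+ next (toℕ i) (n ∸ toℕ i) 0ₙ ⟨
          nx (toℕ i + (n ∸ toℕ i)) 0ₙ         ≡⟨ cong (λ m → nx m 0ₙ) (m+[n∸m]≡n (<⇒≤ (toℕ<n i))) ⟩
          nx n 0ₙ                             ≡⟨ nx-n 0ₙ ⟩
          0ₙ                                  ∎)
        (begin
          iter A (toℕ i) (iter A (n ∸ toℕ i) x) ⊞ x    ≡⟨ cong (_⊞ x) (iter-comm A (toℕ i) (n ∸ toℕ i) x) ⟩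
          iter A (n ∸ toℕ i) (iter A (toℕ i) x) ⊞ x    ≡⟨ cong (_⊞ x) (iter-inverse i x) ⟩
          x ⊞ x                                        ≡⟨ ⊞-self x ⟩
          0ᵥ                                           ∎)
        where open ≡-Reasoning

    semidirect : Group 0ℓ 0ℓ
    semidirect = record
      { Carrier = C ; _≈_ = _≡_ ; _∙_ = _∙_ ; ε = 0ₙ , 0ᵥ ; _⁻¹ = inv
      ; isGroup = record
        { isMonoid = record
          { isSemigroup = record
            { isMagma = record { isEquivalence = isEquivalence ; ∙-cong = cong₂ _∙_ }
            ; assoc = assoc }
          ; identity = identityˡ , identityʳ }
        ; inverse = inverseˡ , inverseʳ
        ; ⁻¹-cong = cong inv } }

  module _ {n k : ℕ} (n≥3 : 3 ≤ n) (h : Vec Bool (suc k)) (h∣ : monic h ∣ₚ X^ n ⊕ 1ₚ) where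
    private
      instance
        n≢0 : NonZero n
        n≢0 = >-nonZero (≤-trans (s≤s z≤n) n≥3)

      A = register h
      per = register-periodic h n h∣
      G = semidirect A (register-⊞ h) per
      open Group G using (_∙_)

      to : PXVertex n (suc k) → Fin n × Vec Bool (suc k)
      to (i , x) = i , map bool x

      from : Fin n × Vec Bool (suc k) → PXVertex n (suc k)
      from (i , x) = i , map bit x

      iso : Inverse (setoid (PXVertex n (suc k))) (setoid (Fin n × Vec Bool (suc k)))
      iso = mk↔ₛ′ to from
        (λ { (i , x) → cong (i ,_) (trans (sym (map-∘ bool bit x)) (trans (map-cong bool-bit x) (map-id x))) })
        (λ { (i , x) → cong (i ,_) (trans (sym (map-∘ bit bool x)) (trans (map-cong bit-bool x) (map-id x))) })

      -- Multiplying by (j, y) on the right takes (i, x) to (i + j, Aⁱy + x). The states z = Aⁱy and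
      -- Az are the initial and final parts of the one longer word `z ∷ʳ dot h z`, so adding this
      -- word to X yields the image arc.
      translate-arc : ∀ g {u v} → Arc u v → Arc (from (to u ∙ g)) (from (to v ∙ g))
      translate-arc (j , y) (arc i X) = subst₂ Arc
        (cong (nx (toℕ i) j ,_) (begin
          init (map bit ((z ∷ʳ dot h z) ⊞ map bool X))           ≡⟨ init-map bit ((z ∷ʳ dot h z) ⊞ map bool X) ⟩
          map bit (init ((z ∷ʳ dot h z) ⊞ map bool X))           ≡⟨ cong (map bit) (init-zipWith (z ∷ʳ dot h z) (map bool X)) ⟩
          map bit (init (z ∷ʳ dot h z) ⊞ init (map bool X))    ≡⟨ cong₂ (λ v w → map bit (v ⊞ w)) (init-∷ʳ _ z) (init-map bool X) ⟩
          map bit (z ⊞ map bool (init X))                      ∎))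
        (cong₂ _,_
          (sym (trans (cong (λ m → nx m j) (toℕ-next i)) (nx-% (suc (toℕ i)) j)))
          (begin
            tail (map bit ((z ∷ʳ dot h z) ⊞ map bool X))          ≡⟨ tail-map bit ((z ∷ʳ dot h z) ⊞ map bool X) ⟩
            map bit (tail ((z ∷ʳ dot h z) ⊞ map bool X))          ≡⟨ cong (map bit) (tail-zipWith (z ∷ʳ dot h z) (map bool X)) ⟩
            map bit (tail (z ∷ʳ dot h z) ⊞ tail (map bool X))   ≡⟨ cong₂ (λ v w → map bit (v ⊞ w)) (trans (tail-∷ʳ z (dot h z)) (sym A-next)) (tail-map bool X) ⟩
            map bit (iter A (toℕ (next i)) y ⊞ map bool (tail X)) ∎))
        (arc (nx (toℕ i) j) (map bit ((z ∷ʳ dot h z) ⊞ map bool X)))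
        where
        open ≡-Reasoning
        z = iter A (toℕ i) y
        tail-∷ʳ : ∀ {m} (x : Vec Bool (suc m)) a → tail (x ∷ʳ a) ≡ tail x ∷ʳ a
        tail-∷ʳ (_ ∷ _) a = refl
        A-next : iter A (toℕ (next i)) y ≡ A z
        A-next = trans (cong (λ m → iter A m y) (toℕ-next i)) (iter-% A n per (suc (toℕ i)) y)

    divisor⇒Cayley : IsCayleyGraph (PX n (suc k) n≥3)
    divisor⇒Cayley = translations⇒Cayley (PX n (suc k) n≥3) G iso λ g →
      λ { (inj₁ a) → inj₁ (translate-arc g a) ; (inj₂ a) → inj₂ (translate-arc g a) }

-- Divisors of tⁿ + 1 of prescribed degree.

module DivisorSelection where

  open import Data.List.Base using (List; []; _∷_; _++_; length; map; filter)
  open import Data.List.Properties using (map-++; length-++; filter-++; filter-accept; filter-reject; map-∘)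
  open import Data.List.Relation.Ternary.Interleaving.Propositional using (Interleaving; []; consˡ; consʳ)
  open import Data.Nat.Divisibility using (_∣_)
  open import Data.Nat.ListAction using (sum)
  open import Data.Nat.Properties
  open import Defs
  open PolynomialRing
  open Factorisation
  open MultiplicativeOrder
  open CyclicFactors
  open Totient

  open Factor

  private
    variable
      b : ℕ

  labels : List (Factor b) → List ℕ
  labels = map label

  count-accept : ∀ d xs → count d (d ∷ xs) ≡ suc (count d xs)
  count-accept d xs = cong length (filter-accept (d ≟_) {xs = xs} refl)

  count-reject : ∀ {d x} xs → d ≢ x → count d (x ∷ xs) ≡ count d xs
  count-reject {d} xs d≢x = cong length (filter-reject (d ≟_) {xs = xs} d≢x)

  count-++ : ∀ d xs ys → count d (xs ++ ys) ≡ count d xs + count d ys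
  count-++ d xs ys = trans (cong length (filter-++ (d ≟_) xs ys)) (length-++ (filter (d ≟_) xs))

  repeat : ∀ {A : Set} → ℕ → List A → List A
  repeat zero    xs = []
  repeat (suc m) xs = xs ++ repeat m xs

  count-repeat : ∀ d m (fs : List (Factor b)) → count d (labels (repeat m fs)) ≡ m * count d (labels fs)
  count-repeat d zero    fs = refl
  count-repeat d (suc m) fs = trans (cong (count d) (map-++ label fs (repeat m fs)))
    (trans (count-++ d (labels fs) _) (cong (count d (labels fs) +_) (count-repeat d m fs)))

  ∏-repeat : ∀ m (fs : List (Factor b)) → ∏ᶠ (repeat m fs) ≈ power (∏ᶠ fs) m
  ∏-repeat zero    fs = ≈-refl
  ∏-repeat (suc m) fs rewrite map-++ monicPoly fs (repeat m fs) =
    ≈-trans (∏-++ (map monicPoly fs) (map monicPoly (repeat m fs))) (⊗-congˡ (∏ᶠ fs) (∏-repeat m fs))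

  decrement : ℕ → (ℕ → ℕ) → ℕ → ℕ
  decrement x α d = α d ∸ at-point x (λ _ → 1) d

  decrement-≡ : ∀ x α → decrement x α x ≡ pred (α x)
  decrement-≡ x α rewrite at-point-≡ x (λ _ → 1) = ∸-suc′ (α x)
    where
    ∸-suc′ : ∀ n → n ∸ 1 ≡ pred n
    ∸-suc′ zero    = refl
    ∸-suc′ (suc n) = refl

  decrement-≢ : ∀ {x d} α → d ≢ x → decrement x α d ≡ α d
  decrement-≢ α d≢x rewrite at-point-≢ (λ _ → 1) d≢x = refl

  bound-skip : ∀ {x} xs (α : ℕ → ℕ) → α x ≡ 0 → (∀ d → d ∣ b → α d ≤ count d (x ∷ xs)) → ∀ d → d ∣ b → α d ≤ count d xs
  bound-skip {x = x} xs α αx bound d d∣b with d ≟ x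
  ... | yes refl = ≤-trans (≤-reflexive αx) z≤n
  ... | no  d≢   = ≤-trans (bound d d∣b) (≤-reflexive (count-reject xs d≢))

  bound-take : ∀ {x} xs (α : ℕ → ℕ) → (∀ d → d ∣ b → α d ≤ count d (x ∷ xs)) → ∀ d → d ∣ b → decrement x α d ≤ count d xs
  bound-take {x = x} xs α bound d d∣b with d ≟ x
  ... | no  d≢   = ≤-trans (≤-reflexive (decrement-≢ α d≢)) (≤-trans (bound d d∣b) (≤-reflexive (count-reject xs d≢)))
  ... | yes refl = ≤-trans (≤-reflexive (decrement-≡ x α)) (pred-mono-≤ (≤-trans (bound d d∣b) (≤-reflexive (count-accept x xs))))

  -- Greedy choice: a factor is taken while the quota α of its label is positive. The bound keeps
  -- every quota within what remains of the list, so at the end all quotas are zero.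
  select : 1 ≤ b → (fs : List (Factor b)) (α : ℕ → ℕ) → (∀ d → d ∣ b → α d ≤ count d (labels fs)) →
           ∃₂ λ gs cs → Interleaving gs cs fs × Σω gs ≡ sum (map (λ d → α d * ω d) (divisors b))
  select {b} 1≤b [] α bound = [] , [] , []
    , sym (sum-zero (divisors b) λ {d} d∈ → cong (_* ω d) (n≤0⇒n≡0 (bound d (∈-divisors⁻ d∈))))
  select {b} 1≤b (f ∷ fs) α bound with α (label f) in αf
  ... | zero with gs , cs , i , Σ≡ ← select 1≤b fs α (bound-skip (labels fs) α αf bound) = gs , f ∷ cs , consʳ i , Σ≡
  ... | suc c with gs , cs , i , Σ≡ ← select 1≤b fs (decrement (label f) α) (bound-take (labels fs) α bound) = f ∷ gs , cs , consˡ i , (begin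
      ω x + Σω gs
        ≡⟨ cong (ω x +_) Σ≡ ⟩
      ω x + sum (map (λ d → decrement x α d * ω d) (divisors b))
        ≡⟨ cong (_+ sum (map (λ d → decrement x α d * ω d) (divisors b))) (sum-at-point (divisors-unique b) (∈-divisors⁺ 1≤b (label∣b f))) ⟨
      sum (map (at-point x ω) (divisors b)) + sum (map (λ d → decrement x α d * ω d) (divisors b))
        ≡⟨ sum-map-+ _ _ (divisors b) ⟨
      sum (map (λ d → at-point x ω d + decrement x α d * ω d) (divisors b))
        ≡⟨ sum-cong (divisors b) (λ {d} _ → restore d) ⟩
      sum (map (λ d → α d * ω d) (divisors b)) ∎)
    where
    open ≡-Reasoning
    x = label f
    restore : ∀ d → at-point x ω d + decrement x α d * ω d ≡ α d * ω d
    restore d with d ≟ x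
    ... | no  d≢   = cong₂ _+_ (at-point-≢ ω d≢) (cong (_* ω d) (decrement-≢ α d≢))
    ... | yes refl = trans (cong₂ _+_ (at-point-≡ x ω) (cong (_* ω x) (decrement-≡ x α)))
                       (trans (cong (λ n → ω x + pred n * ω x) αf) (cong (_* ω x) (sym αf)))

  ∏-interleaving : ∀ {gs cs fs : List (Factor b)} → Interleaving gs cs fs → ∏ᶠ gs ∣ₚ ∏ᶠ fs
  ∏-interleaving [] = ∣ₚ-refl
  ∏-interleaving {gs = f ∷ gs} (consˡ i) with q , e ← ∏-interleaving i =
    q , ≈-trans (⊗-congˡ (fpoly f) e) (≈-sym (rotate′ q (fpoly f) (∏ᶠ gs)))
    where
    rotate′ : ∀ q f g → q ⊗ (f ⊗ g) ≈ f ⊗ (q ⊗ g)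
    rotate′ q f g = ≈-trans (≈-sym (F₂[t].*-assoc q f g)) (swapˡ q f g)
  ∏-interleaving {cs = f ∷ cs} (consʳ i) = ∣ₚ-⊗ˡ (fpoly f) (∏-interleaving i)

  module Multiplicity (b′ : ℕ) (odd : ¬ 2 ∣ suc b′) where
    fs : List (Factor (suc b′))
    fs = proj₁ (factors b′)

    ∏fs : ∏ᶠ fs ≈ X^ (suc b′) ⊕ 1ₚ
    ∏fs = proj₂ (factors b′)

    -- There are φ(d)/ω(d) factors of order d, by inverting `Σω-∣`; the product form makes sense
    -- before ω(d) is known to divide φ(d).
    count*ω≡φ : ∀ {d} → d ∣ suc b′ → count d (labels fs) * ω d ≡ φ d
    count*ω≡φ = mass≡φ (labels fs) ω (s≤s z≤n) λ {e} e∣b →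
      trans (cong sum (sym (map-∘ {g = if-∣ e ω} {f = label} fs))) (Σω-∣ fs odd ∏fs e∣b)

    ∏-2^ : ∀ a → ∏ᶠ (repeat (2 ^ a) fs) ≈ X^ (2 ^ a * suc b′) ⊕ 1ₚ
    -- In characteristic 2, (tᵇ + 1)^(2ᵃ) = t^(2ᵃb) + 1, where b is `suc b′`.
    ∏-2^ a = ≈-trans (∏-repeat (2 ^ a) fs) (≈-trans (power-2^ (∏ᶠ fs) a) (≈-trans (frob-cong a ∏fs)
      (≈-trans (frob-⊕ a (X^ (suc b′)) 1ₚ) (⊕-cong (frob-X^ a (suc b′)) (frob-const a true)))))

    multiplicity-bound : ∀ a (α : ℕ → ℕ) → (∀ d → d ∣ suc b′ → α d * ω d ≤ 2 ^ a * φ d) →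
                         ∀ d → d ∣ suc b′ → α d ≤ count d (labels (repeat (2 ^ a) fs))
    multiplicity-bound a α bound d d∣b = *-cancelʳ-≤ (α d) _ (ω d) (begin
      α d * ω d                                      ≤⟨ bound d d∣b ⟩
      2 ^ a * φ d                                    ≡⟨ cong (2 ^ a *_) (count*ω≡φ d∣b) ⟨
      2 ^ a * (count d (labels fs) * ω d)            ≡⟨ *-assoc (2 ^ a) _ (ω d) ⟨
      2 ^ a * count d (labels fs) * ω d              ≡⟨ cong (_* ω d) (count-repeat d (2 ^ a) fs) ⟨
      count d (labels (repeat (2 ^ a) fs)) * ω d     ∎)
      where open ≤-Reasoning

    divisor-of-degree : ∀ a (α : ℕ → ℕ) → (∀ d → d ∣ suc b′ → α d * ω d ≤ 2 ^ a * φ d) →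
                        ∀ {k} → k ≡ sum (map (λ d → α d * ω d) (divisors (suc b′))) →
                        ∃[ h ] monic {k} h ∣ₚ X^ (2 ^ a * suc b′) ⊕ 1ₚ
    divisor-of-degree a α bound {k} k≡ = build (select (s≤s z≤n) (repeat (2 ^ a) fs) α (multiplicity-bound a α bound))
      where
      build : (∃₂ λ gs cs → Interleaving gs cs (repeat (2 ^ a) fs) × Σω gs ≡ sum (map (λ d → α d * ω d) (divisors (suc b′)))) →
              ∃[ h ] monic {k} h ∣ₚ X^ (2 ^ a * suc b′) ⊕ 1ₚ
      build (gs , cs , i , Σ≡) = subst (λ m → ∃[ h ] monic {m} h ∣ₚ X^ (2 ^ a * suc b′) ⊕ 1ₚ)
        (trans (Σdeg≡Σω odd gs) (trans Σ≡ (sym k≡)))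
        (proj₁ (∏-monic (map monicPoly gs)) , ∣ₚ-resp (∏-2^ a) (∣ₚ-respˡ (proj₂ (∏-monic (map monicPoly gs))) (∏-interleaving i)))

-- Cyclic codes as ideals, and their dimensions.

module CyclicCode-dimension where

  open import Data.Bool.Properties using (xor-assoc)
  open import Data.List.Base using ([]; _∷_)
  open import Data.List.Relation.Ternary.Interleaving.Propositional using ([])
  open import Data.Nat.Properties
  open import Data.Vec.Base as Vec using (toList; _∷ʳ_; init; last; initLast)
  open import Relation.Unary using (Decidable)
  open import Tactic.RingSolver using (solve-∀)
  open PolynomialRing
  open Factorisation
  open MultiplicativeOrder
  open CyclicFactors
  open ShiftRegister using (_⊞_; 0ᵥ)

  private
    variable
      b : ℕ

  -- `Dim V m`: the set V has 2ᵐ elements.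
  record Dim {X : Set} (V : X → Set) (m : ℕ) : Set where
    field
      elem      : Vec Bool m → X
      elem∈     : ∀ u → V (elem u)
      injective : ∀ u u′ → elem u ≡ elem u′ → u ≡ u′
      covers    : ∀ {x} → V x → ∃[ u ] elem u ≡ x

  open Dim

  dim-unique : ∀ {X : Set} {V : X → Set} {m k} → Dim V m → Dim V k → m ≡ k
  dim-unique d d′ = ≤-antisym (dim-≤ d d′) (dim-≤ d′ d)
    where
    dim-≤ : ∀ {X : Set} {V : X → Set} {m k} → Dim V m → Dim V k → m ≤ k
    dim-≤ d d′ = Vec-injective⇒≤ (λ u → proj₁ (covers d′ (elem∈ d u))) λ u u′ e → injective d u u′
      (trans (sym (proj₂ (covers d′ (elem∈ d u)))) (trans (cong (elem d′) e) (proj₂ (covers d′ (elem∈ d u′)))))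

  -- On coefficient vectors, multiplication by t modulo t^(b+1) + 1.
  rot : Vec Bool (suc b) → Vec Bool (suc b)
  rot x = last x ∷ init x

  record CyclicCode (I : Vec Bool (suc b) → Set) : Set where
    field
      decide : Decidable I
      0∈     : I 0ᵥ
      ⊞∈     : ∀ {x y} → I x → I y → I (x ⊞ y)
      rot∈   : ∀ {x} → I x → I (rot x)

  module _ {b : ℕ} {I : Vec Bool (suc b) → Set} (code : CyclicCode I) where
    open CyclicCode code

    private
      modulus : Vec Bool (suc b)
      modulus = true ∷ Vec.replicate b false

      F = monic modulus

      F≈ : F ≈ X^ (suc b) ⊕ 1ₚ
      F≈ = ≈-sym (X^b+1-monic b)

      abstract
        cancel-sum : ∀ u v → (u ⊕ v) ⊕ v ≈ u
        cancel-sum = solve-∀ solverRing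
        ⊕-regroup : ∀ u v w z → (u ⊕ v) ⊕ (w ⊕ z) ≈ (u ⊕ w) ⊕ (v ⊕ z)
        ⊕-regroup = solve-∀ solverRing
        ⊕-chain : ∀ u v w → (u ⊕ v) ⊕ (v ⊕ w) ≈ u ⊕ w
        ⊕-chain = solve-∀ solverRing
        quotient-cancel : ∀ q u z g → (q ⊗ z ⊕ u) ⊗ g ⊕ u ⊗ g ≈ q ⊗ (z ⊗ g)
        quotient-cancel = solve-∀ solverRing
        wrap-around : ∀ t x l y → t ⊗ (x ⊕ l ⊗ y) ⊕ (l ⊕ t ⊗ x) ≈ l ⊗ (t ⊗ y ⊕ 1ₚ)
        wrap-around = solve-∀ solverRing
        division-remainder : ∀ u v → (u ⊕ v) ⊕ u ≈ v
        division-remainder = solve-∀ solverRing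

        rem : Poly → Vec Bool (suc b)
        rem p = proj₁ (proj₂ (divMod modulus p))

        rem-≡ : ∀ p → F ∣ₚ p ⊕ toList (rem p)
        rem-≡ p = proj₁ (divMod modulus p) , ≈-trans (⊕-congʳ (toList (rem p)) (proj₂ (proj₂ (divMod modulus p))))
          (cancel-sum (proj₁ (divMod modulus p) ⊗ F) (toList (rem p)))

      rem-unique : ∀ p x → F ∣ₚ p ⊕ toList x → rem p ≡ x
      rem-unique p x d = short-residue-unique modulus (rem p) x (∣ₚ-resp (⊕-chain (toList (rem p)) p (toList x))
        (∣ₚ-⊕ (∣ₚ-resp (F₂[t].+-comm p (toList (rem p))) (rem-≡ p)) d))

      rem-toList : ∀ x → rem (toList x) ≡ x
      rem-toList x = rem-unique (toList x) x (∣ₚ-resp (≈-sym (F₂[t].-‿inverseˡ (toList x))) ∣ₚ0)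

      rem-cong : ∀ p q → F ∣ₚ p ⊕ q → rem p ≡ rem q
      rem-cong p q d = rem-unique p (rem q) (∣ₚ-resp (⊕-chain p q (toList (rem q))) (∣ₚ-⊕ d (rem-≡ q)))

      rem-⊕ : ∀ p q → rem (p ⊕ q) ≡ rem p ⊞ rem q
      rem-⊕ p q = rem-unique (p ⊕ q) (rem p ⊞ rem q) (∣ₚ-resp
        (≈-trans (⊕-regroup p (toList (rem p)) q (toList (rem q))) (⊕-congˡ (p ⊕ q) (≈-sym (toList-zipWith (rem p) (rem q)))))
        (∣ₚ-⊕ (rem-≡ p) (rem-≡ q)))

      toList-∷ʳ : ∀ {m} (x : Vec Bool m) l → toList (x ∷ʳ l) ≈ toList x ⊕ (l ∷ []) ⊗ X^ m
      toList-∷ʳ []      true  = mk λ s i → refl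
      toList-∷ʳ []      false = mk λ s i → refl
      toList-∷ʳ {suc m} (a ∷ x) l = ≈-trans (∷-cong (toList-∷ʳ x l)) (mk λ s i → begin
        (a ∧ s i) xor act (toList x ⊕ (l ∷ []) ⊗ X^ m) s (suc i)
          ≡⟨ cong ((a ∧ s i) xor_) (act-⊕ (toList x) ((l ∷ []) ⊗ X^ m) s (suc i)) ⟩
        (a ∧ s i) xor (act (toList x) s (suc i) xor act ((l ∷ []) ⊗ X^ m) s (suc i))
          ≡⟨ xor-assoc (a ∧ s i) _ _ ⟨
        act (a ∷ toList x) s i xor act ((l ∷ []) ⊗ X^ m) s (suc i)
          ≡⟨ cong (act (a ∷ toList x) s i xor_) (trans (act-⊗ (l ∷ []) (X^ m) s (suc i)) (sym (act-⊗ (l ∷ []) (X^ (suc m)) s i))) ⟩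
        act (a ∷ toList x) s i xor act ((l ∷ []) ⊗ X^ (suc m)) s i
          ≡⟨ act-⊕ (a ∷ toList x) ((l ∷ []) ⊗ X^ (suc m)) s i ⟨
        act ((a ∷ toList x) ⊕ (l ∷ []) ⊗ X^ (suc m)) s i ∎)
        where open ≡-Reasoning

      rot-≡ : ∀ (r : Vec Bool (suc b)) → F ∣ₚ (false ∷ toList r) ⊕ toList (rot r)
      rot-≡ r with x , l , refl ← initLast r = l ∷ [] , ≈-trans (⊕-congʳ (l ∷ toList x) (∷-cong {false} (toList-∷ʳ x l)))
        (≈-trans (lemma l) (⊗-congˡ (l ∷ []) (≈-sym F≈)))
        where
        t⊗ : ∀ p → false ∷ p ≈ X^ 1 ⊗ p
        t⊗ p = mk λ s i → sym (trans (act-⊗ (X^ 1) p s i) (act-X^ 1 (act p s) i))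
        lemma : ∀ l → (false ∷ (toList x ⊕ (l ∷ []) ⊗ X^ b)) ⊕ (l ∷ toList x) ≈ (l ∷ []) ⊗ (X^ (suc b) ⊕ 1ₚ)
        lemma l = ≈-trans (⊕-cong (t⊗ (toList x ⊕ (l ∷ []) ⊗ X^ b)) (∷≈⊕t⊗ l (toList x)))
          (≈-trans (wrap-around (X^ 1) (toList x) (l ∷ []) (X^ b))
            (⊗-congˡ (l ∷ []) (⊕-congʳ 1ₚ (≈-sym (t⊗ (X^ b))))))

      -- J is the preimage of the code under 𝔽₂[t] → 𝔽₂[t]/(tᵇ + 1), an ideal.
      J : Poly → Set
      J p = I (rem p)

      J-resp : ∀ {p q} → p ≈ q → J p → J q
      J-resp {p} {q} e = subst I (rem-cong p q (∣ₚ-resp (≈-sym (≈⇒⊕≈0 e)) ∣ₚ0))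

      J-⊕ : ∀ p q → J p → J q → J (p ⊕ q)
      J-⊕ p q p∈ q∈ = subst I (sym (rem-⊕ p q)) (⊞∈ p∈ q∈)

      J-0 : J []
      J-0 = subst I (sym (rem-unique [] 0ᵥ (∣ₚ-resp (≈-sym (zeros≈0 (suc b))) ∣ₚ0))) 0∈

      J-t : ∀ p → J p → J (false ∷ p)
      J-t p p∈ = subst I (sym (rem-unique (false ∷ p) (rot (rem p)) (∣ₚ-resp (⊕-chain (false ∷ p) (false ∷ toList (rem p)) (toList (rot (rem p))))
        (∣ₚ-⊕ (shift p (toList (rem p)) (rem-≡ p)) (rot-≡ (rem p)))))) (rot∈ p∈)
        where
        shift : ∀ p q → F ∣ₚ p ⊕ q → F ∣ₚ (false ∷ p) ⊕ (false ∷ q)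
        shift p q (c , e) = false ∷ c , ∷-cong e

      J-⊗ : ∀ q p → J p → J (q ⊗ p)
      J-⊗ []          p p∈ = J-0
      J-⊗ (false ∷ q) p p∈ = J-t (q ⊗ p) (J-⊗ q p p∈)
      J-⊗ (true  ∷ q) p p∈ = J-⊕ p (false ∷ q ⊗ p) p∈ (J-t (q ⊗ p) (J-⊗ q p p∈))

      generators : ℕ → Set
      generators m = Σ[ g ∈ Vec Bool m ] J (monic g)

      F∈J : J F
      F∈J = subst I (rem-cong [] F (∣ₚ-resp (≈-sym (F₂[t].+-identityˡ F)) ∣ₚ-refl)) J-0

      -- The monic element of least degree generates the ideal. The search ends because the modulus
      -- itself lies in J, and each degree can be searched exhaustively because the code is
      -- decidable.
      generator : ∃[ m ] generators m × (∀ {j} → j < m → ¬ generators j)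
      generator = least {generators} (λ m → any-vec? λ g → decide (rem (monic g))) (suc b) (modulus , F∈J)

    module _ {m} (g : Vec Bool m) (g∈ : J (monic g)) (minimal : ∀ {j} → j < m → ¬ generators j) where
      private
        generates : ∀ p → J p → monic g ∣ₚ p
        generates p p∈ with q , r , e ← divMod g p with degree (toList r)
        ... | isZero r≈0   = q , ≈-trans e (≈-trans (⊕-congˡ (q ⊗ monic g) r≈0) (F₂[t].+-identityʳ (q ⊗ monic g)))
        ... | isMonic w r≈w = contradiction (w , J-resp
            (≈-trans (⊕-congʳ (q ⊗ monic g) e) (≈-trans (division-remainder (q ⊗ monic g) (toList r)) r≈w))
            (J-⊕ p (q ⊗ monic g) p∈ (J-⊗ q (monic g) g∈)))
            (minimal (≤-trans (degree<length (toList r) w r≈w) (≤-reflexive (length-toList r))))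

      -- The code is (g)/(F). Writing F = zg, every word is the residue of ug for exactly one u of
      -- degree below that of z. The dimension is therefore the degree of the cofactor z, again a
      -- divisor of F.
      code-dim : ∃₂ λ c (z : Vec Bool c) → monic z ∣ₚ F × Dim I c
      code-dim with q , e ← generates F F∈J with c , z , q≈z , _ ← quotient-degree modulus g q e =
        c , z , z∣F , record
          { elem      = λ u → rem (toList u ⊗ monic g)
          ; elem∈     = λ u → J-⊗ (toList u) (monic g) g∈
          ; injective = λ u u′ eq → short-residue-unique z u u′ (cancel-g (F∣ u u′ eq))
          ; covers    = covers′ }
        where
        F≈z⊗g : F ≈ monic z ⊗ monic g
        F≈z⊗g = ≈-trans e (⊗-congʳ (monic g) q≈z)
        z∣F : monic z ∣ₚ F
        z∣F = monic g , ≈-trans F≈z⊗g (⊗-comm (monic z) (monic g))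
        F∣ : ∀ u u′ → rem (toList u ⊗ monic g) ≡ rem (toList u′ ⊗ monic g) → F ∣ₚ (toList u ⊕ toList u′) ⊗ monic g
        F∣ u u′ eq = ∣ₚ-resp (≈-trans (⊕-regroup ug (toList (rem ug)) u′g (toList (rem ug)))
            (≈-trans (⊕-congˡ (ug ⊕ u′g) (F₂[t].-‿inverseˡ (toList (rem ug))))
            (≈-trans (F₂[t].+-identityʳ (ug ⊕ u′g)) (≈-sym (F₂[t].distribʳ (monic g) (toList u) (toList u′))))))
          (∣ₚ-⊕ (rem-≡ ug) (subst (λ r → F ∣ₚ u′g ⊕ toList r) (sym eq) (rem-≡ u′g)))
          where
          ug  = toList u ⊗ monic g
          u′g = toList u′ ⊗ monic g
        cancel-g : ∀ {p} → F ∣ₚ p ⊗ monic g → monic z ∣ₚ p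
        cancel-g {p} (c , e′) = c , monic⊗-cancel g p (c ⊗ monic z) (≈-trans (⊗-comm (monic g) p) (≈-trans e′
          (≈-trans (⊗-congˡ c F≈z⊗g) (rotate c (monic z) (monic g)))))
        covers′ : ∀ {x} → I x → ∃[ u ] rem (toList u ⊗ monic g) ≡ x
        covers′ {x} x∈ with p , e₁ ← generates (toList x) (subst I (sym (rem-toList x)) x∈)
                       with q , u , e₂ ← divMod z p = u , rem-unique (toList u ⊗ monic g) x (q , (begin
          toList u ⊗ monic g ⊕ toList x                                      ≈⟨ F₂[t].+-comm (toList u ⊗ monic g) (toList x) ⟩
          toList x ⊕ toList u ⊗ monic g                                      ≈⟨ ⊕-congʳ (toList u ⊗ monic g) (≈-trans e₁ (⊗-congʳ (monic g) e₂)) ⟩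
          (q ⊗ monic z ⊕ toList u) ⊗ monic g ⊕ toList u ⊗ monic g            ≈⟨ quotient-cancel q (toList u) (monic z) (monic g) ⟩
          q ⊗ (monic z ⊗ monic g)                                            ≈⟨ ⊗-congˡ q F≈z⊗g ⟨
          q ⊗ F                                                              ∎))
          where open ≈-Reasoning

    cyclic-dim : ∃₂ λ c (z : Vec Bool c) → monic z ∣ₚ X^ (suc b) ⊕ 1ₚ × Dim I c
    cyclic-dim = wrap (code-dim (proj₁ (proj₁ (proj₂ generator))) (proj₂ (proj₁ (proj₂ generator))) (proj₂ (proj₂ generator)))
      where
      wrap : (∃₂ λ c (z : Vec Bool c) → monic z ∣ₚ F × Dim I c) → ∃₂ λ c (z : Vec Bool c) → monic z ∣ₚ X^ (suc b) ⊕ 1ₚ × Dim I c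
      wrap (c , z , d , dim) = c , z , ∣ₚ-resp F≈ d , dim

-- Quasi-cyclic codes, and the arithmetic form of their dimensions.

module QuasiCyclicCode-dimension where

  open import Data.List.Base using (List; []; _∷_; map)
  open import Data.List.Relation.Ternary.Interleaving.Propositional using (Interleaving; []; consˡ; consʳ)
  open import Data.Nat.Divisibility using (_∣_; _∣?_)
  open import Data.Nat.ListAction using (sum)
  open import Data.Nat.Properties
  open import Data.Vec.Base as Vec using (take; drop; zipWith; replicate)
  open import Data.Vec.Properties using (take++drop≡id; ++-injective)
  open import Relation.Nullary.Decidable using (map′)
  open import Relation.Unary using (Pred; Decidable)
  open import Defs
  open PolynomialRing
  open Factorisation
  open MultiplicativeOrder
  open CyclicFactors
  open Totient
  open ShiftRegister using (_⊞_; 0ᵥ; ⊞-assoc; ⊞-identityˡ; ⊞-identityʳ; ⊞-self)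
  open DivisorSelection
  open CyclicCode-dimension

  open Dim
  open Factor

  private
    variable
      b A : ℕ

  Blocks : ℕ → ℕ → Set
  Blocks b A = Vec (Vec Bool b) A

  infixl 6 _⊞⊞_
  _⊞⊞_ : Blocks b A → Blocks b A → Blocks b A
  _⊞⊞_ = zipWith _⊞_

  ⊞⊞-cancel : (v w : Blocks b A) → v ⊞⊞ (v ⊞⊞ w) ≡ w
  ⊞⊞-cancel []      []      = refl
  ⊞⊞-cancel (x ∷ v) (y ∷ w) =
    cong₂ _∷_ (trans (sym (⊞-assoc x x y)) (trans (cong (_⊞ y) (⊞-self x)) (⊞-identityˡ y))) (⊞⊞-cancel v w)

  ⊞⊞-cancelˡ : (v w w′ : Blocks b A) → v ⊞⊞ w ≡ v ⊞⊞ w′ → w ≡ w′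
  ⊞⊞-cancelˡ v w w′ e = trans (sym (⊞⊞-cancel v w)) (trans (cong (v ⊞⊞_) e) (⊞⊞-cancel v w′))

  any-blocks? : ∀ {P : Pred (Blocks b A) 0ℓ} → Decidable P → Dec (∃ P)
  any-blocks? {A = zero}  P? = map′ ([] ,_) (λ { ([] , p) → p }) (P? [])
  any-blocks? {A = suc A} P? = map′ (λ { (x , v , p) → x ∷ v , p }) (λ { (x ∷ v , p) → x , v , p })
    (any-vec? λ x → any-blocks? λ v → P? (x ∷ v))

  record QuasiCyclicCode (V : Blocks (suc b) A → Set) : Set where
    field
      decide : Decidable V
      0∈     : V (replicate _ 0ᵥ)
      ⊞∈     : ∀ {x y} → V x → V y → V (x ⊞⊞ y)
      rot∈   : ∀ {x} → V x → V (Vec.map rot x)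

  rot-0 : rot {b} 0ᵥ ≡ 0ᵥ
  rot-0 {b} = cong₂ _∷_ (last-0 b) (init-0 b)
    where
    last-0 : ∀ b → Vec.last (0ᵥ {suc b}) ≡ false
    last-0 zero    = refl
    last-0 (suc b) = last-0 b
    init-0 : ∀ b → Vec.init (0ᵥ {suc b}) ≡ 0ᵥ
    init-0 zero    = refl
    init-0 (suc b) = cong (false ∷_) (init-0 b)

  DivisorDegrees : (b : ℕ) → ℕ → Set
  DivisorDegrees b c = Σ[ z ∈ Vec Bool c ] monic z ∣ₚ X^ (suc b) ⊕ 1ₚ

  -- A code is an extension of its projection to the first block by the
  -- subcode vanishing there.
  module Extension {V : Blocks (suc b) (suc A) → Set} (code : QuasiCyclicCode V) where
    open QuasiCyclicCode code

    I : Vec Bool (suc b) → Set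
    I x = ∃[ v ] V (x ∷ v)

    V₀ : Blocks (suc b) A → Set
    V₀ v = V (0ᵥ ∷ v)

    I-code : CyclicCode I
    I-code = record
      { decide = λ x → any-blocks? λ v → decide (x ∷ v)
      ; 0∈     = _ , 0∈
      ; ⊞∈     = λ { (_ , p) (_ , q) → _ , ⊞∈ p q }
      ; rot∈   = λ { (_ , p) → _ , rot∈ p } }

    V₀-code : QuasiCyclicCode V₀
    V₀-code = record
      { decide = λ v → decide (0ᵥ ∷ v)
      ; 0∈     = 0∈
      ; ⊞∈     = λ {v} {w} p q → replace-head (v ⊞⊞ w) (⊞-self 0ᵥ) (⊞∈ p q)
      ; rot∈   = λ {v} p → replace-head (Vec.map rot v) rot-0 (rot∈ p) }
      where
      replace-head : ∀ v {x y} → x ≡ y → V (x ∷ v) → V (y ∷ v)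
      replace-head v e = subst (λ x → V (x ∷ v)) e

    module _ {c d} (dimI : Dim I c) (dimV₀ : Dim V₀ d) where
      private
        -- A set-theoretic lift of the first block: the words of V with a given first block form a
        -- coset of the subcode vanishing there.
        section : Vec Bool c → Blocks (suc b) A
        section u = proj₁ (elem∈ dimI u)

        elem′ : Vec Bool c → Vec Bool d → Blocks (suc b) (suc A)
        elem′ u w = elem dimI u ∷ (section u ⊞⊞ elem dimV₀ w)

        elem′∈ : ∀ u w → V (elem′ u w)
        elem′∈ u w = subst (λ x → V (x ∷ _)) (⊞-identityʳ (elem dimI u)) (⊞∈ (proj₂ (elem∈ dimI u)) (elem∈ dimV₀ w))

        elem′-injective : ∀ u w u′ w′ → elem′ u w ≡ elem′ u′ w′ → u ≡ u′ × w ≡ w′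
        elem′-injective u w u′ w′ e with refl ← injective dimI u u′ (cong Vec.head e) =
          refl , injective dimV₀ w w′ (⊞⊞-cancelˡ (section u) _ _ (cong Vec.tail e))

        elem′-covers : ∀ {x v} → V (x ∷ v) → ∃₂ λ u w → elem′ u w ≡ x ∷ v
        elem′-covers {x} {v} p with u , refl ← covers dimI (v , p)
          with w , e ← covers dimV₀ (subst (λ y → V (y ∷ section u ⊞⊞ v)) (⊞-self x) (⊞∈ (proj₂ (elem∈ dimI u)) p))
          = u , w , cong (x ∷_) (trans (cong (section u ⊞⊞_) e) (⊞⊞-cancel (section u) v))

      extension-dim : Dim V (c + d)
      extension-dim = record
        { elem      = λ u → elem′ (take c u) (drop c u)
        ; elem∈     = λ u → elem′∈ (take c u) (drop c u)
        ; injective = λ u u′ e → let e₁ , e₂ = elem′-injective (take c u) (drop c u) (take c u′) (drop c u′) e in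
            trans (sym (take++drop≡id c u)) (trans (cong₂ Vec._++_ e₁ e₂) (take++drop≡id c u′))
        ; covers    = covers′ }
        where
        covers′ : ∀ {x} → V x → ∃[ u ] elem′ (take c u) (drop c u) ≡ x
        covers′ {x ∷ v} p with u , w , e ← elem′-covers p =
          u Vec.++ w , trans (cong₂ elem′ (proj₁ split) (proj₂ split)) e
          where split = ++-injective (take c (u Vec.++ w)) u (take++drop≡id c (u Vec.++ w))

  quasiCyclic-dim : ∀ {A} {V : Blocks (suc b) A → Set} → QuasiCyclicCode V →
                    Σ[ cs ∈ Vec (∃ (DivisorDegrees b)) A ] Dim V (Vec.sum (Vec.map proj₁ cs))
  quasiCyclic-dim {A = zero} code = [] , record
    { elem = λ _ → [] ; elem∈ = λ _ → QuasiCyclicCode.0∈ code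
    ; injective = λ { [] [] _ → refl } ; covers = λ { {[]} _ → [] , refl } }
  quasiCyclic-dim {b = b} {A = suc A} code = combine (cyclic-dim I-code) (quasiCyclic-dim V₀-code)
    where
    open Extension code
    combine : (∃₂ λ c (z : Vec Bool c) → monic z ∣ₚ X^ (suc b) ⊕ 1ₚ × Dim I c) →
              Σ[ cs ∈ Vec (∃ (DivisorDegrees b)) A ] Dim V₀ (Vec.sum (Vec.map proj₁ cs)) →
              Σ[ cs ∈ Vec (∃ (DivisorDegrees b)) (suc A) ] Dim _ (Vec.sum (Vec.map proj₁ cs))
    combine (c , z , z∣ , dimI) (cs , dimV₀) = (c , z , z∣) ∷ cs , extension-dim dimI dimV₀

  count-interleaving : ∀ d {gs cs fs : List (Factor b)} → Interleaving gs cs fs → count d (labels gs) ≤ count d (labels fs)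
  count-interleaving d [] = z≤n
  count-interleaving d {f ∷ gs} {cs} {_ ∷ fs} (consˡ i) with d ≟ label f
  ... | yes refl = ≤-trans (≤-reflexive (count-accept d (labels gs))) (≤-trans (s≤s (count-interleaving d i))
                     (≤-reflexive (sym (count-accept d (labels fs)))))
  ... | no  d≢   = ≤-trans (≤-reflexive (count-reject (labels gs) d≢)) (≤-trans (count-interleaving d i)
                     (≤-reflexive (sym (count-reject (labels fs) d≢))))
  count-interleaving d {gs} {f ∷ cs} {_ ∷ fs} (consʳ i) with d ≟ label f
  ... | yes refl = ≤-trans (count-interleaving d i) (≤-trans (n≤1+n _) (≤-reflexive (sym (count-accept d (labels fs)))))
  ... | no  d≢   = ≤-trans (count-interleaving d i) (≤-reflexive (sym (count-reject (labels fs) d≢)))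

  Σω≡ : (gs : List (Factor (suc b))) → Σω gs ≡ sum (map (λ d → count d (labels gs) * ω d) (divisors (suc b)))
  Σω≡ {b} gs = trans (sym (all-divide gs)) (sum-by-label (suc b) ω (labels gs) (s≤s z≤n))
    where
    all-divide : ∀ gs → sum (map (if-∣ (suc b) ω) (labels gs)) ≡ Σω gs
    all-divide []       = refl
    all-divide (f ∷ gs) = cong₂ _+_ w≡ω (all-divide gs)
      where
      w≡ω : if-∣ (suc b) ω (label f) ≡ ω (label f)
      w≡ω with label f ∣? suc b
      ... | yes _ = refl
      ... | no ∤b = contradiction (label∣b f) ∤b

  module Necessity (b′ : ℕ) (odd : ¬ 2 ∣ suc b′) where
    open Multiplicity b′ odd

    -- The condition of the theorem with A in place of 2ᵃ and the bounds multiplied through by ω(d).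
    Combination : ℕ → ℕ → Set
    Combination A k = Σ[ α ∈ (ℕ → ℕ) ] (∀ d → d ∣ suc b′ → α d * ω d ≤ A * φ d) ×
                                       k ≡ sum (map (λ d → α d * ω d) (divisors (suc b′)))

    -- α_d is the number of irreducible factors of order d of the divisor; these are among the
    -- factors of the whole modulus, which gives the bound.
    divisor-combination : ∀ {c} → DivisorDegrees b′ c → Combination 1 c
    divisor-combination {c} (z , q , e) with m , w , q≈w , _ ← quotient-degree (true ∷ replicate b′ false) z q
      (≈-trans (≈-sym (X^b+1-monic b′)) e) = build (∏-split fs z w (≈-trans ∏fs (≈-trans e
        (≈-trans (⊗-comm q (monic z)) (⊗-congˡ (monic z) q≈w)))))
      where
      build : (∃₂ λ gs cs → Interleaving gs cs fs × monic z ≈ ∏ᶠ gs × monic w ≈ ∏ᶠ cs) → Combination 1 c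
      build (gs , cs , i , z≈ , _) = (λ d → count d (labels gs))
        , (λ d d∣b → ≤-trans (*-monoˡ-≤ (ω d) (count-interleaving d i))
             (≤-reflexive (trans (count*ω≡φ d∣b) (sym (*-identityˡ (φ d))))))
        , trans (monic≈∏⇒degree odd z gs z≈) (Σω≡ gs)

    sum-combination : ∀ {A} (cs : Vec (∃ (DivisorDegrees b′)) A) → Combination A (Vec.sum (Vec.map proj₁ cs))
    sum-combination []             = (λ _ → 0) , (λ _ _ → z≤n) , sym (sum-zero (divisors (suc b′)) λ _ → refl)
    sum-combination {suc A} ((c , z) ∷ cs) = add (divisor-combination z) (sum-combination cs)
      where
      add : Combination 1 c → Combination A (Vec.sum (Vec.map proj₁ cs)) → Combination (suc A) (c + Vec.sum (Vec.map proj₁ cs))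
      add (α , α≤ , c≡) (β , β≤ , s≡) = (λ d → α d + β d)
        , (λ d d∣b → ≤-trans (≤-reflexive (*-distribʳ-+ (ω d) (α d) (β d)))
             (+-mono-≤ (≤-trans (α≤ d d∣b) (≤-reflexive (*-identityˡ (φ d)))) (β≤ d d∣b)))
        , trans (cong₂ _+_ c≡ s≡) (trans (sym (sum-map-+ _ _ (divisors (suc b′))))
            (sum-cong (divisors (suc b′)) λ {d} _ → sym (*-distribʳ-+ (ω d) (α d) (β d))))

    code-combination : ∀ {A k} {V : Blocks (suc b′) A → Set} → QuasiCyclicCode V → Dim V k → Combination A k
    code-combination {A} {k} {V} code dim = build (quasiCyclic-dim code)
      where
      build : Σ[ cs ∈ Vec (∃ (DivisorDegrees b′)) A ] Dim V (Vec.sum (Vec.map proj₁ cs)) → Combination A k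
      build (cs , dim′) = subst (Combination A) (dim-unique dim′ dim) (sum-combination cs)

-- Common neighbours and the automorphisms of PX(n,k).

module LocalStructure where

  open import Data.Bool.Properties using (xor-same)
  open import Data.Fin.Base using (Fin; zero; suc; toℕ; inject₁; lower₁; opposite; fromℕ)
  open import Data.Fin.Properties using (toℕ<n; toℕ-injective; toℕ-inject₁; inject₁-lower₁; opposite-prop; opposite-involutive; nonZeroIndex)
  open import Data.Nat.DivMod using (m<n⇒m%n≡m; n%n≡0)
  open import Data.Nat.Properties
  open import Data.Vec.Base as Vec using (lookup; tabulate; init; tail; _∷ʳ_)
  open import Data.Vec.Properties using (tabulate∘lookup; tabulate-cong; lookup∘tabulate)
  open import Defs
  open CyclicGroup

  lookup-ext : ∀ {A : Set} {m} {x y : Vec A m} → (∀ i → lookup x i ≡ lookup y i) → x ≡ y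
  lookup-ext {x = x} {y} e = trans (sym (tabulate∘lookup x)) (trans (tabulate-cong e) (tabulate∘lookup y))

  lookup-init : ∀ {A : Set} {m} (x : Vec A (suc m)) i → lookup (init x) i ≡ lookup x (inject₁ i)
  lookup-init (a ∷ x@(_ ∷ _)) zero    = refl
  lookup-init (a ∷ x@(_ ∷ _)) (suc i) = lookup-init x i

  lookup-tail : ∀ {A : Set} {m} (x : Vec A (suc m)) i → lookup (tail x) i ≡ lookup x (suc i)
  lookup-tail (_ ∷ _) i = refl

  lookup-∷ʳ : ∀ {A : Set} {m} (x : Vec A m) a i → lookup (x ∷ʳ a) (inject₁ i) ≡ lookup x i
  lookup-∷ʳ (b ∷ x) a zero    = refl
  lookup-∷ʳ (b ∷ x) a (suc i) = lookup-∷ʳ x a i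

  lookup-∷ʳ-last : ∀ {A : Set} {m} (x : Vec A m) a → lookup (x ∷ʳ a) (fromℕ m) ≡ a
  lookup-∷ʳ-last []      a = refl
  lookup-∷ʳ-last (b ∷ x) a = lookup-∷ʳ-last x a

  ∷ʳ-agree : ∀ {A : Set} {m} (x y : Vec A m) a i → (∀ i′ → toℕ i′ ≡ toℕ i → lookup x i′ ≡ lookup y i′) →
             lookup (x ∷ʳ a) i ≡ lookup (y ∷ʳ a) i
  ∷ʳ-agree []      []      a i       e = refl
  ∷ʳ-agree (b ∷ x) (c ∷ y) a zero    e = e zero refl
  ∷ʳ-agree (b ∷ x) (c ∷ y) a (suc i) e = ∷ʳ-agree x y a i λ i′ eq → e (suc i′) (cong suc eq)

  lower : ∀ {m} (i : Fin (suc m)) → toℕ i < m → ∃[ i′ ] inject₁ i′ ≡ i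
  lower i i<m = lower₁ i m≢i , inject₁-lower₁ i m≢i
    where
    m≢i = λ m≡i → <⇒≢ i<m (sym m≡i)

  module Local (n k : ℕ) (n≥5 : 5 ≤ n) where

    -- The words have k + 2 entries, so that k ≥ 2 in the notation of the theorem is built in.
    X : Set
    X = PXVertex n (suc (suc k))

    fib : X → Fin n
    fib = proj₁

    infix 9 _!_
    _!_ : X → Fin (suc (suc k)) → Fin 2
    u ! i = lookup (proj₂ u) i

    private
      variable
        u v w x : X

    vertex-ext : fib u ≡ fib v → (∀ i → u ! i ≡ v ! i) → u ≡ v
    vertex-ext {_ , x} {_ , y} refl e = cong (_ ,_) (lookup-ext e)

    arc-fib : Arc u v → fib v ≡ next (fib u)
    arc-fib (arc i x) = refl

    arc-! : Arc u v → ∀ i → u ! suc i ≡ v ! inject₁ i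
    arc-! (arc i x) j = trans (lookup-init x (suc j)) (sym (lookup-tail x (inject₁ j)))

    arc-intro : fib v ≡ next (fib u) → (∀ i → u ! suc i ≡ v ! inject₁ i) → Arc u v
    arc-intro {_ , y} {i , z@(a ∷ _)} refl e =
      subst (λ z′ → Arc (i , z′) (next i , y)) (lookup-ext λ { zero → lookup-init (a ∷ y) zero
        ; (suc j) → trans (lookup-init (a ∷ y) (suc j)) (sym (e j)) }) (arc i (a ∷ y))

    push : X → Fin 2 → X
    push (i , x) a = next i , tail x ∷ʳ a

    arc-push : ∀ u a → Arc u (push u a)
    arc-push (i , x) a = arc-intro refl λ j → trans (sym (lookup-tail x j)) (sym (lookup-∷ʳ (tail x) a j))

    pull : Fin 2 → X → X
    pull a (i , x) = nx (pred n) i , a ∷ init x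

    next-pred : ∀ (i : Fin n) → next (nx (pred n) i) ≡ i
    next-pred i = trans (cong (λ m → nx m i) (suc-pred n)) (nx-n i)
      where instance _ = nonZeroIndex i

    arc-pull : ∀ a u → Arc (pull a u) u
    arc-pull a (i , x) = arc-intro (sym (next-pred i)) λ j → lookup-init x j

    flipBit : Fin 2 → Fin 2
    flipBit zero       = suc zero
    flipBit (suc zero) = zero

    flipBit-≢ : ∀ a → flipBit a ≢ a
    flipBit-≢ zero       ()
    flipBit-≢ (suc zero) ()

    no-cycle : ∀ m → 0 < m → m < 5 → (p : Fin n) → nx m p ≢ p
    no-cycle m 0<m m<5 p = nx-no-fixpoint m p 0<m (≤-trans m<5 n≥5)

    arc-asym : Arc u v → ¬ Arc v u
    arc-asym {u} a a′ = no-cycle 2 (s≤s z≤n) (s≤s (s≤s (s≤s z≤n))) (fib u)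
      (sym (trans (arc-fib a′) (cong next (arc-fib a))))

    Adj : X → X → Set
    Adj u v = Arc u v ⊎ Arc v u

    -- Two neighbours of u on opposite sides have no other common neighbour …
    opposite-sides : Arc v u → Arc u x → Adj x w → Adj v w → w ≡ u
    -- Here v → w → x: the first entry of w is read off from v and the others from x, which requires
    -- words of at least two entries.
    opposite-sides {v} {u} {x} {w} a a′ (inj₂ b) (inj₁ c) = vertex-ext (trans (arc-fib c) (sym (arc-fib a))) λ
      { zero    → trans (sym (arc-! c zero)) (arc-! a zero)
      ; (suc i) → trans (arc-! b i) (sym (arc-! a′ i)) }
    opposite-sides {v} {u} {x} {w} a a′ (inj₂ b) (inj₂ c) = contradiction
      (trans (cong next (sym (arc-fib a))) (trans (sym (arc-fib a′)) (trans (arc-fib b) (sym (arc-fib c)))))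
      (no-cycle 2 (s≤s z≤n) (s≤s (s≤s (s≤s z≤n))) (fib v))
    opposite-sides {v} {u} {x} {w} a a′ (inj₁ b) (inj₁ c) = contradiction
      (trans (cong next (sym (arc-fib a))) (trans (sym (arc-fib a′)) (next-injective (trans (sym (arc-fib b)) (arc-fib c)))))
      (no-cycle 2 (s≤s z≤n) (s≤s (s≤s (s≤s z≤n))) (fib v))
    -- The closed walk v → u → x → w → v would force 4 = 0 in ℤₙ; this case is the reason for n ≥ 5.
    opposite-sides {v} {u} {x} {w} a a′ (inj₁ b) (inj₂ c) = contradiction
      (sym (trans (arc-fib c) (cong next (trans (arc-fib b) (cong next (trans (arc-fib a′) (cong next (arc-fib a))))))))
      (no-cycle 4 (s≤s z≤n) (s≤s (s≤s (s≤s (s≤s (s≤s z≤n))))) (fib v))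

    -- … whereas two neighbours on the same side do.
    same-side-out : Arc u v → Arc u x → ∃[ w ] w ≢ u × Arc w v × Arc w x
    same-side-out {i , a ∷ y} b c = (i , flipBit a ∷ y) , (λ e → flipBit-≢ a (cong (λ u → u ! zero) e))
      , arc-intro (arc-fib b) (arc-! b) , arc-intro (arc-fib c) (arc-! c)

    same-side-in : Arc v u → Arc x u → ∃[ w ] w ≢ u × Arc v w × Arc x w
    same-side-in {v} {u} b c = push v (flipBit (u ! fromℕ _))
      , (λ e → flipBit-≢ (u ! fromℕ _) (trans (sym (lookup-∷ʳ-last (tail (proj₂ v)) _)) (cong (λ u → u ! fromℕ _) e)))
      , arc-push v _
      , arc-intro (trans (sym (arc-fib b)) (arc-fib c))
          (λ i → trans (arc-! c i) (trans (sym (arc-! b i)) (arc-! (arc-push v (flipBit (u ! fromℕ _))) i)))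

    push-agree : ∀ u u′ a j → (∀ i → suc j ≤ toℕ i → u ! i ≡ u′ ! i) → ∀ i → j ≤ toℕ i → push u a ! i ≡ push u′ a ! i
    push-agree u u′ a j e i j≤i = ∷ʳ-agree (tail (proj₂ u)) (tail (proj₂ u′)) a i λ i′ i′≡i →
      trans (lookup-tail (proj₂ u) i′) (trans (e (suc i′) (s≤s (≤-trans j≤i (≤-reflexive (sym i′≡i))))) (sym (lookup-tail (proj₂ u′) i′)))

    -- Vertices of the same fibre are joined by walking forwards k steps and back.
    fibre-connected : (R : X → X → Set) → (∀ u → R u u) →
                      (∀ {u v u′ v′} → Arc u v → Arc u′ v′ → R v v′ → R u u′) →
                      ∀ u u′ → fib u ≡ fib u′ → R u u′
    fibre-connected R R-refl R-back u u′ eq = go (suc (suc k)) u u′ eq λ i k≤i → contradiction k≤i (<⇒≱ (toℕ<n i))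
      where
      go : ∀ j u u′ → fib u ≡ fib u′ → (∀ i → j ≤ toℕ i → u ! i ≡ u′ ! i) → R u u′
      go zero    u u′ eq e = subst (R u) (vertex-ext eq λ i → e i z≤n) (R-refl u)
      go (suc j) u u′ eq e = R-back (arc-push u zero) (arc-push u′ zero)
        (go j (push u zero) (push u′ zero) (cong next eq) (push-agree u u′ zero j e))

    connected : (P : X → Set) → (∀ {u v} → Arc u v → P u → P v) → (∀ {u v} → Arc u v → P v → P u) →
                ∀ u → P u → ∀ v → P v
    connected P fwd bwd u Pu v with m , e ← reach (fib u) (fib v) =
      fibre-connected (λ u v → P u → P v) (λ _ p → p) (λ a a′ f p → bwd a′ (f (fwd a p))) (walk m) v (trans (fib-walk m) e) (P-walk m)
      where
      walk : ℕ → X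
      walk zero    = u
      walk (suc m) = push (walk m) zero
      fib-walk : ∀ m → fib (walk m) ≡ nx m (fib u)
      fib-walk zero    = refl
      fib-walk (suc m) = cong next (fib-walk m)
      P-walk : ∀ m → P (walk m)
      P-walk zero    = Pu
      P-walk (suc m) = fwd (arc-push (walk m) zero) (P-walk m)

    record Automorphism : Set where
      field
        fun  : X → X
        inv  : X → X
        inv∘fun : ∀ u → inv (fun u) ≡ u
        fun∘inv : ∀ u → fun (inv u) ≡ u
        fun-adj : Adj u v → Adj (fun u) (fun v)
        inv-adj : Adj u v → Adj (inv u) (inv v)

      fun-injective : fun u ≡ fun v → u ≡ v
      fun-injective {u} {v} e = trans (sym (inv∘fun u)) (trans (cong inv e) (inv∘fun v))

    Direct Reversed : (X → X) → Set
    Direct   f = ∀ {u v} → Arc u v → Arc (f u) (f v)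
    Reversed f = ∀ {u v} → Arc u v → Arc (f v) (f u)

    module _ (g : Automorphism) where
      open Automorphism g

      private
        refute : ∀ {u w} → w ≢ u → fun w ≢ fun u
        refute w≢u e = w≢u (fun-injective e)

        inv-≢ : ∀ {u w} → w ≢ fun u → inv w ≢ u
        inv-≢ {u} {w} w≢ e = w≢ (trans (sym (fun∘inv w)) (cong fun e))

        inv-adj′ : ∀ {u w} → Adj (fun u) w → Adj u (inv w)
        inv-adj′ {u} {w} a = subst (λ u → Adj u (inv w)) (inv∘fun u) (inv-adj a)

        -- If only one of the two arcs were reversed, the images of v and x would lie on opposite
        -- sides of `fun u`, yet a second common neighbour of v and x is carried along.
        out : Arc u v → Arc u x → Arc (fun u) (fun v) → Arc (fun u) (fun x)
        out {u} {v} {x} a b d with fun-adj (inj₁ b)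
        ... | inj₁ d′ = d′
        ... | inj₂ d′ with w , w≢u , c , c′ ← same-side-out a b =
          contradiction (opposite-sides d′ d (fun-adj (inj₂ c)) (fun-adj (inj₂ c′))) (refute w≢u)

        -- The same contradiction seen through the inverse: images on the same side have a second
        -- common neighbour, and its preimage is one for v and x, which lie on opposite sides of u.
        backward : Arc v u → Arc u x → Arc (fun u) (fun x) → Arc (fun v) (fun u)
        backward {v} {u} {x} a b d with fun-adj (inj₁ a)
        ... | inj₁ d′ = d′
        ... | inj₂ d′ with w , w≢ , c , c′ ← same-side-out d d′ =
          contradiction (opposite-sides a b (inv-adj′ (inj₂ c)) (inv-adj′ (inj₂ c′))) (inv-≢ w≢)

        forward : Arc v u → Arc u x → Arc (fun v) (fun u) → Arc (fun u) (fun x)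
        forward {v} {u} {x} a b d with fun-adj (inj₁ b)
        ... | inj₁ d′ = d′
        ... | inj₂ d′ with w , w≢ , c , c′ ← same-side-in d d′ =
          contradiction (opposite-sides a b (inv-adj′ (inj₁ c′)) (inv-adj′ (inj₁ c))) (inv-≢ w≢)

      -- Keeping the direction of all outgoing arcs passes from a vertex to its neighbours on both
      -- sides, and the graph is connected.
      arc-direct⇒direct : Arc u v → Arc (fun u) (fun v) → Direct fun
      arc-direct⇒direct {u} a d {x} {y} b = connected (λ u → ∀ {v} → Arc u v → Arc (fun u) (fun v))
        (λ a f b → forward a b (f a))
        (λ {u} {v} a f b → out a b (backward a (arc-push v zero) (f (arc-push v zero))))
        u (λ b → out a b d) x b

    -- The reflection i ↦ −1 − i.
    rev : X → X
    rev (i , x) = opposite i , tabulate (λ j → lookup x (opposite j))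

    rev-! : ∀ u j → rev u ! j ≡ u ! opposite j
    rev-! (i , x) j = lookup∘tabulate (λ j → lookup x (opposite j)) j

    rev-involutive : ∀ u → rev (rev u) ≡ u
    rev-involutive u = vertex-ext (opposite-involutive (fib u)) λ j →
      trans (rev-! (rev u) j) (trans (rev-! u (opposite j)) (cong (u !_) (opposite-involutive j)))

    opposite-next : ∀ (p : Fin n) → opposite p ≡ next (opposite (next p))
    opposite-next p = toℕ-injective (trans (opposite-prop p) (sym (trans (toℕ-next (opposite (next p))) (lemma (m≤n⇒m<n∨m≡n (toℕ<n p))))))
      where
      instance _ = nonZeroIndex p
      open ≡-Reasoning
      lemma : suc (toℕ p) < n ⊎ suc (toℕ p) ≡ n → suc (toℕ (opposite (next p))) % n ≡ n ∸ suc (toℕ p)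
      lemma (inj₁ lt) = begin
        suc (toℕ (opposite (next p))) % n       ≡⟨ cong (λ m → suc m % n) (opposite-prop (next p)) ⟩
        suc (n ∸ suc (toℕ (next p))) % n        ≡⟨ cong (λ m → suc (n ∸ suc m) % n) (trans (toℕ-next p) (m<n⇒m%n≡m lt)) ⟩
        suc (n ∸ suc (suc (toℕ p))) % n         ≡⟨ cong (_% n) (sym (+-∸-assoc 1 lt)) ⟩
        (n ∸ suc (toℕ p)) % n                   ≡⟨ m<n⇒m%n≡m (∸-monoʳ-< (s≤s z≤n) (<⇒≤ lt)) ⟩
        n ∸ suc (toℕ p)                         ∎
      lemma (inj₂ eq) = begin
        suc (toℕ (opposite (next p))) % n       ≡⟨ cong (λ m → suc m % n) (opposite-prop (next p)) ⟩
        suc (n ∸ suc (toℕ (next p))) % n        ≡⟨ cong (λ m → suc (n ∸ suc m) % n) (trans (toℕ-next p) (trans (cong (_% n) eq) (n%n≡0 n))) ⟩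
        suc (n ∸ 1) % n                         ≡⟨ cong (_% n) (m+[n∸m]≡n (≤-trans (s≤s z≤n) (≤-reflexive eq))) ⟩
        n % n                                   ≡⟨ n%n≡0 n ⟩
        0                                       ≡⟨ n∸n≡0 n ⟨
        n ∸ n                                   ≡⟨ cong (n ∸_) eq ⟨
        n ∸ suc (toℕ p)                         ∎

    opposite-inject₁ : ∀ {m} (i : Fin m) → opposite (inject₁ i) ≡ suc (opposite i)
    opposite-inject₁ zero    = refl
    opposite-inject₁ (suc i) = cong inject₁ (opposite-inject₁ i)

    rev-reversed : Reversed rev
    rev-reversed {u} {v} a = arc-intro
      (trans (opposite-next (fib u)) (cong (next ∘ opposite) (sym (arc-fib a))))
      λ i → trans (rev-! v (suc i)) (trans (sym (arc-! a (opposite i)))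
        (trans (cong (u !_) (sym (opposite-inject₁ i))) (sym (rev-! u (inject₁ i)))))

    rev-adj : Adj u v → Adj (rev u) (rev v)
    rev-adj (inj₁ a) = inj₂ (rev-reversed a)
    rev-adj (inj₂ a) = inj₁ (rev-reversed a)

    rev∘ : Automorphism → Automorphism
    rev∘ g = record
      { fun     = rev ∘ fun
      ; inv     = inv ∘ rev
      ; inv∘fun = λ u → trans (cong inv (rev-involutive (fun u))) (inv∘fun u)
      ; fun∘inv = λ u → trans (cong rev (fun∘inv (rev u))) (rev-involutive u)
      ; fun-adj = rev-adj ∘ fun-adj
      ; inv-adj = inv-adj ∘ rev-adj }
      where open Automorphism g

    -- Composition with the reflection reduces the reversing case to the direct one.
    orientation : (g : Automorphism) (u : X) → Direct (Automorphism.fun g) ⊎ Reversed (Automorphism.fun g)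
    orientation g u with Automorphism.fun-adj g (inj₁ (arc-push u zero))
    ... | inj₁ d = inj₁ (arc-direct⇒direct g (arc-push u zero) d)
    ... | inj₂ d = inj₂ λ {u} {v} a → subst₂ Arc (rev-involutive _) (rev-involutive _)
      (rev-reversed (arc-direct⇒direct (rev∘ g) (arc-push _ zero) (rev-reversed d) a))

    hd : X → Bool
    hd u = bool (u ! zero)

    -- A direct automorphism acts coordinatewise: the first coordinate of the
    -- image depends on the fibre and the first coordinate only.
    module _ (g : Automorphism) (direct : Direct (Automorphism.fun g)) where
      open Automorphism g

      -- Here m counts the final entries about which nothing is assumed. Pulling both vertices back
      -- along an arc prepends the same entry to each, so m drops by one there; the image arcs carry
      -- the conclusion forwards again.
      prefix : ∀ m u u′ → fib u ≡ fib u′ → (∀ i → toℕ i + m < suc (suc k) → u ! i ≡ u′ ! i) →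
               ∀ i → toℕ i + m < suc (suc k) → fun u ! i ≡ fun u′ ! i
      prefix zero u u′ eq e i _ = cong (λ u → fun u ! i) (vertex-ext eq λ j → e j (≤-trans (≤-reflexive (cong suc (+-identityʳ _))) (toℕ<n j)))
      prefix (suc m) u u′ eq e i i+m<k
        with i′ , refl ← lower i (≤-trans (s≤s (m≤m+n (toℕ i) m)) (s≤s⁻¹ (≤-trans (≤-reflexive (cong suc (sym (+-suc (toℕ i) m)))) i+m<k)))
        = trans (sym (arc-! (direct (arc-pull zero u)) i′)) (trans
            (prefix m (pull zero u) (pull zero u′) (cong (nx (pred n)) eq) agree (suc i′)
              (≤-trans (≤-reflexive (cong suc (trans (sym (+-suc (toℕ i′) m)) (cong (_+ suc m) (sym (toℕ-inject₁ i′)))))) i+m<k))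
            (arc-! (direct (arc-pull zero u′)) i′))
        where
        agree : ∀ j → toℕ j + m < suc (suc k) → pull zero u ! j ≡ pull zero u′ ! j
        agree zero    _  = refl
        agree (suc j) lt = trans (lookup-init (proj₂ u) j) (trans (e (inject₁ j)
          (≤-trans (≤-reflexive (cong suc (trans (cong (_+ suc m) (toℕ-inject₁ j)) (+-suc (toℕ j) m)))) lt))
          (sym (lookup-init (proj₂ u′) j)))

      head-respects : ∀ {u u′} → fib u ≡ fib u′ → u ! zero ≡ u′ ! zero → fun u ! zero ≡ fun u′ ! zero
      head-respects {u} {u′} eq e = prefix (suc k) u u′ eq agree zero ≤-refl
        where
        agree : ∀ i → toℕ i + suc k < suc (suc k) → u ! i ≡ u′ ! i
        agree zero    _        = e
        agree (suc i) (s≤s lt) = contradiction lt (<⇒≱ (s≤s (m≤n+m (suc k) (toℕ i))))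

      -- The auxiliary `u₁` has the head of u′ and the tail of u. It shares an out-neighbour with u,
      -- so their images can differ in the first entry only; if they agree there too, injectivity
      -- gives u = u₁.
      head-reflects : ∀ {u u′} → fib u ≡ fib u′ → fun u ! zero ≡ fun u′ ! zero → u ! zero ≡ u′ ! zero
      head-reflects {u@(i , a ∷ x)} {u′} eq e = cong (λ u → u ! zero) (fun-injective {u} {u₁} (vertex-ext
        (next-injective (trans (sym (arc-fib arc-u)) (arc-fib arc-u₁)))
        λ { zero → trans e (sym (head-respects {u₁} {u′} eq refl)) ; (suc j) → trans (arc-! arc-u j) (sym (arc-! arc-u₁ j)) }))
        where
        u₁ = i , u′ ! zero ∷ x
        arc-u = direct (arc-push u zero)
        arc-u₁ : Arc (fun u₁) (fun (push u zero))
        arc-u₁ = direct (arc-push u₁ zero)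

      -- On each fibre the first entry undergoes a permutation of 𝔽₂, and both permutations of 𝔽₂
      -- are translations.
      head-xor : ∀ {u u′} → fib u ≡ fib u′ → hd (fun u) xor hd (fun u′) ≡ hd u xor hd u′
      head-xor {u} {u′} eq = cases (u ! zero) (u′ ! zero) (fun u ! zero) (fun u′ ! zero) (head-respects eq) (head-reflects eq)
        where
        cases : ∀ a a′ b b′ → (a ≡ a′ → b ≡ b′) → (b ≡ b′ → a ≡ a′) → bool b xor bool b′ ≡ bool a xor bool a′
        cases zero       zero       b b′ f _ = trans (cong (λ c → bool b xor bool c) (sym (f refl))) (xor-same (bool b))
        cases (suc zero) (suc zero) b b′ f _ = trans (cong (λ c → bool b xor bool c) (sym (f refl))) (xor-same (bool b))
        cases zero       (suc zero) zero       zero       _ f = contradiction (f refl) λ ()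
        cases zero       (suc zero) (suc zero) (suc zero) _ f = contradiction (f refl) λ ()
        cases zero       (suc zero) zero       (suc zero) _ f = refl
        cases zero       (suc zero) (suc zero) zero       _ f = refl
        cases (suc zero) zero       zero       zero       _ f = contradiction (f refl) λ ()
        cases (suc zero) zero       (suc zero) (suc zero) _ f = contradiction (f refl) λ ()
        cases (suc zero) zero       zero       (suc zero) _ f = refl
        cases (suc zero) zero       (suc zero) zero       _ f = refl

-- From a regular group of automorphisms to a shift-invariant code.

module RegularGroup where

  open import Algebra.Bundles using (Group)
  open import Data.Bool.Properties using (xor-same; xor-comm; xor-assoc; xor-identityʳ; not-involutive)
  open import Data.Empty using (⊥-elim)
  open import Data.Fin.Base using (Fin; zero; suc; toℕ; inject₁)
  open import Data.Fin.Properties using (toℕ-inject₁)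
  open import Data.Fin.Induction using (<-weakInduction)
  open import Data.Nat.Divisibility using (_∣_; divides; ∣m∣n⇒∣m+n; _∣0)
  open import Data.Nat.Properties
  open import Data.Vec.Base as Vec using (tabulate; replicate; map)
  open import Data.Vec.Properties using (lookup∘tabulate; tabulate-cong; map-∘; map-cong; map-id)
  open import Function.Bundles using (Inverse; Equivalence)
  open import Defs hiding (φ)
  open PolynomialRing using (xor-interchange; xor-cancelˡ)
  open Factorisation using (any-vec?)
  open CyclicGroup
  open LocalStructure

  module Group-level (n k : ℕ) (n≥5 : 5 ≤ n) where
    open Local n k n≥5

    -- The Cayley group transported to the vertices, so that its laws become propositional
    -- equalities and elements are vertices.
    record RegularAction : Set where
      infixl 7 _∙_
      infix 8 _⁻
      field
        _∙_  : X → X → X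
        e    : X
        _⁻   : X → X
        assoc     : ∀ u v w → (u ∙ v) ∙ w ≡ u ∙ (v ∙ w)
        identityˡ : ∀ u → e ∙ u ≡ u
        identityʳ : ∀ u → u ∙ e ≡ u
        inverseˡ  : ∀ u → u ⁻ ∙ u ≡ e
        inverseʳ  : ∀ u → u ∙ u ⁻ ≡ e
        translate : ∀ {u v} w → Adj u v → Adj (u ∙ w) (v ∙ w)

    Cayley⇒regular : (n≥3 : 3 ≤ n) → IsCayleyGraph (PX n (suc (suc k)) n≥3) → RegularAction
    Cayley⇒regular n≥3 (G , C , iso) = record
      { _∙_ = λ u v → from (to u ∙ to v) ; e = from ε ; _⁻ = λ u → from (to u ⁻¹)
      ; assoc = λ u v w → from-cong (G.trans (∙-congʳ (to-from _)) (G.trans (G.assoc _ _ _) (∙-congˡ (G.sym (to-from _)))))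
      ; identityˡ = λ u → trans (from-cong (G.trans (∙-congʳ (to-from ε)) (G.identityˡ _))) (from-to u)
      ; identityʳ = λ u → trans (from-cong (G.trans (∙-congˡ (to-from ε)) (G.identityʳ _))) (from-to u)
      ; inverseˡ = λ u → from-cong (G.trans (∙-congʳ (to-from _)) (G.inverseˡ _))
      ; inverseʳ = λ u → from-cong (G.trans (∙-congˡ (to-from _)) (G.inverseʳ _))
      ; translate = λ {u} {v} w a → Equivalence.from (preserves _ _)
          (resp (G.sym (G.trans (G.∙-cong (to-from _) (G.⁻¹-cong (to-from _))) (cancel (to v) (to u) (to w))))
            (Equivalence.to (preserves u v) a)) }
      where
      open _≅_ iso
      open Inverse bijection using (from-cong) renaming (strictlyInverseˡ to to-from; strictlyInverseʳ to from-to)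
      module G = Group G
      open G using (_∙_; ε; _⁻¹; ∙-congʳ; ∙-congˡ)
      open ConnectionSet C
      open import Algebra.Properties.Group G using (⁻¹-anti-homo-∙)
      cancel : ∀ v u w → (v ∙ w) ∙ (u ∙ w) ⁻¹ G.≈ v ∙ u ⁻¹
      cancel v u w = G.trans (∙-congˡ (⁻¹-anti-homo-∙ u w)) (G.trans (G.assoc v w _)
        (∙-congˡ (G.trans (G.sym (G.assoc w (w ⁻¹) (u ⁻¹))) (G.trans (∙-congʳ (G.inverseʳ w)) (G.identityˡ _)))))

    -- A labelling y of ℤₙ passes through the vertices on y p = (p, (y p, …, y (p + k − 1))).
    Ω : Set
    Ω = Fin n → Bool

    infixl 6 _⊻_
    _⊻_ : Ω → Ω → Ω
    (x ⊻ y) p = x p xor y p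

    0Ω : Ω
    0Ω _ = false

    on : Ω → Fin n → X
    on y p = p , tabulate (λ i → bit (y (nx (toℕ i) p)))

    on-cong : ∀ {y z} → y ≗ z → ∀ p → on y p ≡ on z p
    on-cong e p = cong (p ,_) (tabulate-cong λ i → cong bit (e (nx (toℕ i) p)))

    on-! : ∀ y p i → on y p ! i ≡ bit (y (nx (toℕ i) p))
    on-! y p i = lookup∘tabulate (λ i → bit (y (nx (toℕ i) p))) i

    hd-on : ∀ y p → hd (on y p) ≡ y p
    hd-on y p = bool-bit (y p)

    on-arc : ∀ y p → Arc (on y p) (on y (next p))
    on-arc y p = arc-intro refl λ i → trans (on-! y p (suc i)) (trans
      (cong (bit ∘ y) (trans (cong (λ m → next (nx m p)) (sym (toℕ-inject₁ i))) (sym (iter-swap next (toℕ (inject₁ i)) p))))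
      (sym (on-! y (next p) (inject₁ i))))

    -- Each entry of a vertex is the first entry of a vertex further along the walk. Thus labellings
    -- are the closed walks meeting every fibre once, a notion that automorphisms respect.
    closed-walk : (V : Fin n → X) → (∀ p → fib (V p) ≡ p) → (∀ p → Arc (V p) (V (next p))) → ∀ p → V p ≡ on (hd ∘ V) p
    closed-walk V fibV arcV p = vertex-ext (fibV p) λ i → trans (entry i p) (sym (on-! (hd ∘ V) p i))
      where
      entry : ∀ i p → V p ! i ≡ bit (hd (V (nx (toℕ i) p)))
      entry = <-weakInduction _ (λ p → sym (bit-bool _)) λ i ih p →
        trans (arc-! (arcV p) i) (trans (ih (next p)) (cong (bit ∘ hd ∘ V) (trans (cong (λ m → nx m (next p)) (toℕ-inject₁ i)) (iter-swap next (toℕ i) p))))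

    -- A linear code on ℤₙ invariant under the shift by s; `param` records that it has 2^(k+2)
    -- words, which determines its dimension.
    record Code (s : ℕ) : Set₁ where
      field
        V            : Ω → Set
        V-resp       : ∀ {x y} → x ≗ y → V x → V y
        V-0          : V 0Ω
        V-⊻          : ∀ {x y} → V x → V y → V (x ⊻ y)
        V-shift      : ∀ {x y} → V x → (∀ p → y (nx s p) ≡ x p) → V y
        param        : Vec Bool (suc (suc k)) → Ω
        param∈       : ∀ u → V (param u)
        param-inj    : ∀ u u′ → param u ≗ param u′ → u ≡ u′
        param-covers : ∀ {x} → V x → ∃[ u ] param u ≗ x

    module Classification (action : RegularAction) where
      open RegularAction action

      cancel-⁻ʳ : ∀ u w → (u ∙ w) ∙ w ⁻ ≡ u
      cancel-⁻ʳ u w = trans (assoc u w _) (trans (cong (u ∙_) (inverseʳ w)) (identityʳ u))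

      cancel-ʳ⁻ : ∀ u w → (u ∙ w ⁻) ∙ w ≡ u
      cancel-ʳ⁻ u w = trans (assoc u _ w) (trans (cong (u ∙_) (inverseˡ w)) (identityʳ u))

      cancelˡ : ∀ u {w w′} → u ∙ w ≡ u ∙ w′ → w ≡ w′
      cancelˡ u {w} {w′} eq = trans (sym (lemma w)) (trans (cong (u ⁻ ∙_) eq) (lemma w′))
        where
        lemma : ∀ w → u ⁻ ∙ (u ∙ w) ≡ w
        lemma w = trans (sym (assoc _ u w)) (trans (cong (_∙ w) (inverseˡ u)) (identityˡ w))

      R : X → Automorphism
      R w = record
        { fun = _∙ w ; inv = _∙ w ⁻
        ; inv∘fun = λ u → cancel-⁻ʳ u w ; fun∘inv = λ u → cancel-ʳ⁻ u w
        ; fun-adj = translate w ; inv-adj = translate (w ⁻) }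

      D Rv : X → Set
      D w  = Direct (_∙ w)
      Rv w = Reversed (_∙ w)

      orient : ∀ w → D w ⊎ Rv w
      orient w = orientation (R w) e

      ¬both : ∀ {w} → D w → ¬ Rv w
      ¬both d r = arc-asym (d (arc-push e zero)) (r (arc-push e zero))

      Arc-resp : ∀ {u u′ v v′ : X} → u ≡ u′ → v ≡ v′ → Arc u v → Arc u′ v′
      Arc-resp refl refl a = a

      D-e : D e
      D-e {u} {v} a = Arc-resp (sym (identityʳ u)) (sym (identityʳ v)) a

      D-D : ∀ {w w′} → D w → D w′ → D (w ∙ w′)
      D-D {w} {w′} d d′ {u} {v} a = Arc-resp (assoc u w w′) (assoc v w w′) (d′ (d a))

      R-R : ∀ {w w′} → Rv w → Rv w′ → D (w ∙ w′)
      R-R {w} {w′} d d′ {u} {v} a = Arc-resp (assoc u w w′) (assoc v w w′) (d′ (d a))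

      R-D : ∀ {w w′} → Rv w → D w′ → Rv (w ∙ w′)
      R-D {w} {w′} d d′ {u} {v} a = Arc-resp (assoc v w w′) (assoc u w w′) (d′ (d a))

      D-R : ∀ {w w′} → D w → Rv w′ → Rv (w ∙ w′)
      D-R {w} {w′} d d′ {u} {v} a = Arc-resp (assoc v w w′) (assoc u w w′) (d′ (d a))

      D-⁻ : ∀ {w} → D w → D (w ⁻)
      D-⁻ {w} d with orient (w ⁻)
      ... | inj₁ d′ = d′
      ... | inj₂ r  = contradiction (λ {u} {v} → subst Rv (inverseʳ w) (D-R d r) {u} {v}) (¬both D-e)

      R-⁻ : ∀ {w} → Rv w → Rv (w ⁻)
      R-⁻ {w} r with orient (w ⁻)
      ... | inj₂ r′ = r′
      ... | inj₁ d  = contradiction (λ {u} {v} → subst Rv (inverseʳ w) (R-D r d) {u} {v}) (¬both D-e)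

      -- The permutation of the fibres induced by `w`, sampled at the zero word; `fib-∙` shows that
      -- any other vertex of the fibre gives the same value.
      φ : X → Fin n → Fin n
      φ w p = fib ((p , replicate _ zero) ∙ w)

      fib-∙ : ∀ u w → fib (u ∙ w) ≡ φ w (fib u)
      fib-∙ u w = fibre-connected (λ u u′ → fib (u ∙ w) ≡ fib (u′ ∙ w)) (λ _ → refl) (back (orient w)) u (fib u , replicate _ zero) refl
        where
        back : D w ⊎ Rv w → ∀ {u v u′ v′} → Arc u v → Arc u′ v′ → fib (v ∙ w) ≡ fib (v′ ∙ w) → fib (u ∙ w) ≡ fib (u′ ∙ w)
        back (inj₁ d) a a′ eq = next-injective (trans (sym (arc-fib (d a))) (trans eq (arc-fib (d a′))))
        back (inj₂ r) a a′ eq = trans (arc-fib (r a)) (trans (cong next eq) (sym (arc-fib (r a′))))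

      φ-∙ : ∀ w w′ p → φ (w ∙ w′) p ≡ φ w′ (φ w p)
      φ-∙ w w′ p = trans (cong fib (sym (assoc _ w w′))) (fib-∙ _ w′)

      φ-e : ∀ p → φ e p ≡ p
      φ-e p = cong fib (identityʳ _)

      φ-⁻ʳ : ∀ w p → φ w (φ (w ⁻) p) ≡ p
      φ-⁻ʳ w p = trans (sym (φ-∙ (w ⁻) w p)) (trans (cong (λ u → φ u p) (inverseˡ w)) (φ-e p))

      φ-⁻ˡ : ∀ w p → φ (w ⁻) (φ w p) ≡ p
      φ-⁻ˡ w p = trans (sym (φ-∙ w (w ⁻) p)) (trans (cong (λ u → φ u p) (inverseʳ w)) (φ-e p))

      fib-φ : ∀ w → fib w ≡ φ w (fib e)
      fib-φ w = trans (cong fib (sym (identityˡ w))) (fib-∙ e w)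

      φ-D : ∀ {w} → D w → ∀ p → φ w (next p) ≡ next (φ w p)
      φ-D {w} d p = trans (sym (fib-∙ (push (p , replicate _ zero) zero) w)) (arc-fib (d (arc-push (p , replicate _ zero) zero)))

      φ-R : ∀ {w} → Rv w → ∀ p → φ w p ≡ next (φ w (next p))
      φ-R {w} r p = trans (arc-fib (r (arc-push (p , replicate _ zero) zero))) (cong next (fib-∙ (push (p , replicate _ zero) zero) w))

      φ-D-nx : ∀ {w} → D w → ∀ m p → φ w (nx m p) ≡ nx m (φ w p)
      φ-D-nx d zero    p = refl
      φ-D-nx d (suc m) p = trans (φ-D d (nx m p)) (cong next (φ-D-nx d m p))

      φ-R-nx : ∀ {w} → Rv w → ∀ m p → φ w p ≡ nx m (φ w (nx m p))
      φ-R-nx r zero    p = refl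
      φ-R-nx {w} r (suc m) p = trans (φ-R-nx r m p) (trans (cong (nx m) (φ-R r (nx m p))) (iter-swap next m _))

      shift : ∀ {w} s → D w → fib w ≡ nx s (fib e) → ∀ p → φ w p ≡ nx s p
      shift {w} s d eq p with m , refl ← reach (fib e) p =
        trans (φ-D-nx d m (fib e)) (trans (cong (nx m) (trans (sym (fib-φ w)) eq)) (iter-comm next m s (fib e)))

      infixl 7 _◃_
      -- The image of the closed walk of y under w, read as a labelling again; the index is pulled
      -- back by φ, so reversing elements are covered too.
      _◃_ : Ω → X → Ω
      (y ◃ w) p = hd (on y (φ (w ⁻) p) ∙ w)

      on-◃ : ∀ y w p → on y p ∙ w ≡ on (y ◃ w) (φ w p)
      on-◃ y w p = trans (cong (λ q → on y q ∙ w) (sym (φ-⁻ˡ w p)))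
        (closed-walk (λ q → on y (φ (w ⁻) q) ∙ w) (λ q → trans (fib-∙ _ w) (φ-⁻ʳ w q)) (walk (orient w)) (φ w p))
        where
        walk : D w ⊎ Rv w → ∀ q → Arc (on y (φ (w ⁻) q) ∙ w) (on y (φ (w ⁻) (next q)) ∙ w)
        walk (inj₁ d) q = d (subst (λ r → Arc (on y (φ (w ⁻) q)) (on y r))
          (trans (sym (φ-⁻ˡ w _)) (cong (φ (w ⁻)) (trans (φ-D d _) (cong next (φ-⁻ʳ w q))))) (on-arc y (φ (w ⁻) q)))
        walk (inj₂ r) q = r (subst (λ s → Arc (on y (φ (w ⁻) (next q))) (on y s))
          (trans (sym (φ-⁻ˡ w _)) (cong (φ (w ⁻)) (next-injective (trans (sym (φ-R r _)) (φ-⁻ʳ w (next q))))))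
          (on-arc y (φ (w ⁻) (next q))))

      ◃-unique : ∀ y w z → (∀ p → on y p ∙ w ≡ on z (φ w p)) → z ≗ y ◃ w
      ◃-unique y w z eq q = trans (sym (hd-on z q)) (cong hd (trans (cong (on z) (sym (φ-⁻ʳ w q))) (sym (eq (φ (w ⁻) q)))))

      ◃-∙ : ∀ y w w′ → y ◃ w ◃ w′ ≗ y ◃ (w ∙ w′)
      ◃-∙ y w w′ = ◃-unique y (w ∙ w′) _ λ p → trans (sym (assoc _ w w′)) (trans (cong (_∙ w′) (on-◃ y w p))
        (trans (on-◃ (y ◃ w) w′ (φ w p)) (cong (on (y ◃ w ◃ w′)) (sym (φ-∙ w w′ p)))))

      ◃-cong : ∀ {y z} w → y ≗ z → y ◃ w ≗ z ◃ w
      ◃-cong w eq p = cong (λ u → hd (u ∙ w)) (on-cong eq (φ (w ⁻) p))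

      ◃-e : ∀ y → y ≗ y ◃ e
      ◃-e y = ◃-unique y e y λ p → trans (identityʳ _) (cong (on y) (sym (φ-e p)))

      ◃-φ : ∀ y w p → (y ◃ w) (φ w p) ≡ hd (on y p ∙ w)
      ◃-φ y w p = cong (λ q → hd (on y q ∙ w)) (φ-⁻ˡ w p)

      -- Direct elements act on labellings as affine maps whose linear part is a shift.
      ◃-affine : ∀ {w} → D w → ∀ x y p → (x ◃ w) (φ w p) xor (y ◃ w) (φ w p) ≡ x p xor y p
      ◃-affine {w} d x y p = trans (cong₂ _xor_ (◃-φ x w p) (◃-φ y w p))
        (trans (head-xor (R w) d {on x p} {on y p} refl) (cong₂ _xor_ (hd-on x p) (hd-on y p)))

      -- The normal subgroup of translations.
      record K (w : X) : Set where
        constructor mkK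
        field
          direct : D w
          fixes  : ∀ p → φ w p ≡ p

      K-intro : ∀ {w} → D w → fib w ≡ fib e → K w
      K-intro d eq = mkK (λ {u} {v} → d {u} {v}) (shift 0 d eq)

      fib-K : ∀ {w} → K w → fib w ≡ fib e
      fib-K {w} (mkK _ f) = trans (fib-φ w) (f (fib e))

      K-e : K e
      K-e = mkK D-e φ-e

      K-∙ : ∀ {w w′} → K w → K w′ → K (w ∙ w′)
      K-∙ {w} {w′} (mkK d f) (mkK d′ f′) = mkK (D-D d d′) λ p → trans (φ-∙ w w′ p) (trans (f′ (φ w p)) (f p))

      K-⁻ : ∀ {w} → K w → K (w ⁻)
      K-⁻ {w} (mkK d f) = mkK (D-⁻ d) λ p → trans (cong (φ (w ⁻)) (sym (f p))) (φ-⁻ˡ w p)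

      K-conj : ∀ {κ} w → K κ → K (w ⁻ ∙ κ ∙ w)
      K-conj {κ} w (mkK d f) = mkK (direct (orient w)) λ p → trans (φ-∙ (w ⁻ ∙ κ) w p)
        (trans (cong (φ w) (trans (φ-∙ (w ⁻) κ p) (f _))) (φ-⁻ʳ w p))
        where
        direct : D w ⊎ Rv w → D (w ⁻ ∙ κ ∙ w)
        direct (inj₁ dw) = D-D (D-D (D-⁻ dw) d) dw
        direct (inj₂ rw) = R-R (R-D (R-⁻ rw) d) rw

      ∙-conj : ∀ κ w → w ∙ (w ⁻ ∙ κ ∙ w) ≡ κ ∙ w
      ∙-conj κ w = begin
        w ∙ (w ⁻ ∙ κ ∙ w)      ≡⟨ assoc w (w ⁻ ∙ κ) w ⟨
        w ∙ (w ⁻ ∙ κ) ∙ w      ≡⟨ cong (_∙ w) (assoc w (w ⁻) κ) ⟨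
        w ∙ w ⁻ ∙ κ ∙ w        ≡⟨ cong (λ u → u ∙ κ ∙ w) (inverseʳ w) ⟩
        e ∙ κ ∙ w              ≡⟨ cong (_∙ w) (identityˡ κ) ⟩
        κ ∙ w                  ∎
        where open ≡-Reasoning

      translation : ∀ {w} → K w → ∀ y p → (y ◃ w) p ≡ y p xor (0Ω ◃ w) p
      translation {w} (mkK d f) y p = begin
        (y ◃ w) p                                               ≡⟨ xor-cancelʳ ((y ◃ w) p) ((0Ω ◃ w) p) ⟨
        ((y ◃ w) p xor (0Ω ◃ w) p) xor (0Ω ◃ w) p               ≡⟨ cong (_xor (0Ω ◃ w) p) (subst (λ q → (y ◃ w) q xor (0Ω ◃ w) q ≡ y p xor false) (f p) (◃-affine d y 0Ω p)) ⟩
        (y p xor false) xor (0Ω ◃ w) p                          ≡⟨ cong (_xor (0Ω ◃ w) p) (xor-identityʳ (y p)) ⟩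
        y p xor (0Ω ◃ w) p                                      ∎
        where
        open ≡-Reasoning
        xor-cancelʳ : ∀ a b → (a xor b) xor b ≡ a
        xor-cancelʳ a b = trans (xor-assoc a b b) (trans (cong (a xor_) (xor-same b)) (xor-identityʳ a))

      infix 4 _∼_
      -- Congruence modulo C, phrased through orbits of K: as K is normal, it is visibly compatible
      -- with reversing elements as well.
      record _∼_ (x y : Ω) : Set where
        constructor related
        field
          element  : X
          element∈ : K element
          moves    : x ◃ element ≗ y

      ∼-reflexive : ∀ {x y} → x ≗ y → x ∼ y
      ∼-reflexive {x} eq = related e K-e λ p → trans (sym (◃-e x p)) (eq p)

      ∼-sym : ∀ {x y} → x ∼ y → y ∼ x
      ∼-sym {x} (related κ kκ eq) = related (κ ⁻) (K-⁻ kκ) λ p → trans (sym (◃-cong (κ ⁻) eq p))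
        (trans (◃-∙ x κ (κ ⁻) p) (trans (cong (λ w → (x ◃ w) p) (inverseʳ κ)) (sym (◃-e x p))))

      ∼-trans : ∀ {x y z} → x ∼ y → y ∼ z → x ∼ z
      ∼-trans {x} (related κ kκ eq) (related κ′ kκ′ eq′) = related (κ ∙ κ′) (K-∙ kκ kκ′) λ p →
        trans (sym (◃-∙ x κ κ′ p)) (trans (◃-cong κ′ eq p) (eq′ p))

      ∼-◃ : ∀ {x y} w → x ∼ y → x ◃ w ∼ y ◃ w
      ∼-◃ {x} w (related κ kκ eq) = related (w ⁻ ∙ κ ∙ w) (K-conj w kκ) λ p → trans (◃-∙ x w _ p)
        (trans (cong (λ u → (x ◃ u) p) (∙-conj κ w)) (trans (sym (◃-∙ x κ w p)) (◃-cong w eq p)))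

      -- The vectors by which the elements of K translate labellings.
      C : Ω → Set
      C c = 0Ω ∼ c

      ∼⇒C : ∀ {x y} → x ∼ y → C (x ⊻ y)
      ∼⇒C {x} {y} (related κ kκ eq) = related κ kκ λ p → begin
        (0Ω ◃ κ) p                     ≡⟨ xor-cancelˡ (x p) _ ⟨
        x p xor (x p xor (0Ω ◃ κ) p)   ≡⟨ cong (x p xor_) (translation kκ x p) ⟨
        x p xor (x ◃ κ) p              ≡⟨ cong (x p xor_) (eq p) ⟩
        x p xor y p                    ∎
        where open ≡-Reasoning

      C⇒∼ : ∀ {c} x → C c → x ∼ x ⊻ c
      C⇒∼ x (related κ kκ eq) = related κ kκ λ p → trans (translation kκ x p) (cong (x p xor_) (eq p))

      C-resp : ∀ {x y} → x ≗ y → C x → C y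
      C-resp eq c = ∼-trans c (∼-reflexive eq)

      C-⊻ : ∀ {x y} → C x → C y → C (x ⊻ y)
      C-⊻ {x} c c′ = ∼-trans c (C⇒∼ x c′)

      surjective : ∀ w {P : Fin n → Set} → (∀ p → P (φ w p)) → ∀ q → P q
      surjective w {P} h q = subst P (φ-⁻ʳ w q) (h (φ (w ⁻) q))

      shift-difference : ∀ {γ x y} → D γ → ∀ z → (∀ p → y (φ γ p) ≡ x p) → (x ⊻ z) ◃ γ ⊻ (z ◃ γ) ≗ y
      shift-difference {γ} {x} {y} d z eq = surjective γ λ p → begin
        ((x ⊻ z) ◃ γ) (φ γ p) xor (z ◃ γ) (φ γ p)   ≡⟨ ◃-affine d (x ⊻ z) z p ⟩
        (x p xor z p) xor z p                       ≡⟨ trans (xor-assoc (x p) (z p) (z p)) (trans (cong (x p xor_) (xor-same (z p))) (xor-identityʳ (x p))) ⟩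
        x p                                         ≡⟨ eq p ⟨
        y (φ γ p)                                   ∎
        where open ≡-Reasoning

      -- From 0 ∼ x follows 0·γ ∼ x·γ, and the difference of these two images is x shifted, because
      -- γ is affine.
      C-shift : ∀ {γ x y} → D γ → C x → (∀ p → y (φ γ p) ≡ x p) → C y
      C-shift {γ} {x} {y} d c eq = C-resp (λ p → trans (xor-comm ((0Ω ◃ γ) p) _) (shift-difference d 0Ω eq p))
        (∼⇒C (∼-◃ γ (∼-trans c (∼-reflexive λ p → sym (xor-identityʳ (x p))))))

      C-0 : C 0Ω
      C-0 = ∼-reflexive λ _ → refl

      pow : X → ℕ → X
      pow γ zero    = e
      pow γ (suc m) = pow γ m ∙ γ

      D-pow : ∀ {γ} → D γ → ∀ m → D (pow γ m)
      D-pow d zero    = D-e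
      D-pow d (suc m) = D-D (D-pow d m) d

      φ-pow : ∀ {γ s} → (∀ p → φ γ p ≡ nx s p) → ∀ m p → φ (pow γ m) p ≡ nx (m * s) p
      φ-pow sh zero    p = φ-e p
      φ-pow {γ} {s} sh (suc m) p = trans (φ-∙ (pow γ m) γ p) (trans (sh (φ (pow γ m) p))
        (trans (cong (nx s) (φ-pow sh m p)) (sym (iter-+ next s (m * s) p))))

      square : ∀ {w} → D w → (∀ p → φ w p ≡ next p) → ∃[ γ ] D γ × (∀ p → φ γ p ≡ nx 2 p)
      square {w} d sh = w ∙ w , D-D d d , λ p → trans (φ-∙ w w p) (trans (sh (φ w p)) (cong next (sh p)))

      -- Fibres 1 and 2 steps away from that of e give a direct element of shift 2.
      shift-2 : ∃[ γ ] D γ × (∀ p → φ γ p ≡ nx 2 p)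
      shift-2 with orient (next (fib e) , replicate _ zero) | orient (nx 2 (fib e) , replicate _ zero)
      ... | inj₁ d | _       = square d (shift 1 d refl)
      ... | inj₂ _ | inj₁ d  = _ , d , shift 2 d refl
      -- Since w₂ reverses, w₁w₂ sends the fibre of e to the one just before the fibre of w₂, which
      -- is a shift by 1.
      ... | inj₂ r | inj₂ r′ = square (R-R r r′) (shift 1 (R-R r r′) (trans (fib-φ (w₁ ∙ w₂)) (trans (φ-∙ w₁ w₂ (fib e))
          (trans (cong (φ w₂) (sym (fib-φ w₁))) (next-injective (trans (sym (φ-R r′ (fib e))) (sym (fib-φ w₂))))))))
        where
        w₁ = next (fib e) , replicate _ zero
        w₂ = nx 2 (fib e) , replicate _ zero

      -- The elements in the fibre of e. They are the elements whose action fixes that fibre, and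
      -- those among them that are direct form K.
      base : Vec Bool (suc (suc k)) → X
      base u = fib e , map bit u

      base-injective : ∀ u u′ → base u ≡ base u′ → u ≡ u′
      base-injective u u′ eq = trans (sym (lemma u)) (trans (cong (map bool ∘ proj₂) eq) (lemma u′))
        where
        lemma : ∀ u → map bool (map bit u) ≡ u
        lemma u = trans (sym (map-∘ bool bit u)) (trans (map-cong bool-bit u) (map-id u))

      base-covers : ∀ w → fib w ≡ fib e → ∃[ u ] base u ≡ w
      base-covers (i , x) refl = map bool x , cong (i ,_) (trans (sym (map-∘ bit bool x)) (trans (map-cong bit-bool x) (map-id x)))

      -- By regularity an element is determined by where it sends the one vertex `on y (fib e)`.
      ◃-injective : ∀ {w w′} y → φ w (fib e) ≡ φ w′ (fib e) → y ◃ w ≗ y ◃ w′ → w ≡ w′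
      ◃-injective {w} {w′} y eq eq′ = cancelˡ (on y (fib e)) (trans (on-◃ y w (fib e))
        (trans (trans (on-cong eq′ _) (cong (on (y ◃ w′)) eq)) (sym (on-◃ y w′ (fib e)))))

      K-injective : ∀ {w w′} y → K w → K w′ → y ◃ w ≗ y ◃ w′ → w ≡ w′
      K-injective y (mkK _ f) (mkK _ f′) eq = ◃-injective y (trans (f (fib e)) (sym (f′ (fib e)))) eq

      all-direct⇒Code : ∀ {γ s} → D γ → (∀ p → φ γ p ≡ nx s p) → (∀ u → D (base u)) → Code s
      all-direct⇒Code {γ} {s} d sh allD = record
        { V = C ; V-resp = C-resp ; V-0 = C-0 ; V-⊻ = C-⊻
        ; V-shift = λ {x} {y} c eq → C-shift d c λ p → trans (cong y (sh p)) (eq p)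
        ; param = λ u → 0Ω ◃ base u
        ; param∈ = λ u → related (base u) (K-intro (allD u) refl) (λ _ → refl)
        ; param-inj = λ u u′ eq → base-injective u u′ (K-injective 0Ω (K-intro (allD u) refl) (K-intro (allD u′) refl) eq)
        ; param-covers = λ { (related κ kκ eq) → let u , e₁ = base-covers κ (fib-K kκ) in
            u , λ p → trans (cong (λ w → (0Ω ◃ w) p) e₁) (eq p) } }

      -- The average of the orbit of 0 under ⟨γ⟩, whose length is odd modulo C, is fixed by γ modulo C.
      module _ {γ} (d : D γ) where
        private
          z : ℕ → Ω
          z m = 0Ω ◃ pow γ m

          Σz : ℕ → Ω
          Σz zero    = 0Ω
          Σz (suc m) = Σz m ⊻ z m

          even : ℕ → Bool
          even zero    = true
          even (suc m) = not (even m)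

          affine : ∀ x y → (x ⊻ y) ◃ γ ≗ (x ◃ γ ⊻ y ◃ γ) ⊻ 0Ω ◃ γ
          affine x y = surjective γ λ p → shuffle (((x ⊻ y) ◃ γ) (φ γ p)) ((x ◃ γ) (φ γ p)) ((y ◃ γ) (φ γ p)) ((0Ω ◃ γ) (φ γ p))
            (trans (◃-affine d (x ⊻ y) x p) (trans (cong (_xor x p) (xor-comm (x p) (y p))) (trans (xor-assoc (y p) (x p) (x p))
              (trans (cong (y p xor_) (xor-same (x p))) (sym (◃-affine d y 0Ω p))))))
            where
            shuffle : ∀ s a b c → s xor a ≡ b xor c → s ≡ (a xor b) xor c
            shuffle s a b c eq = trans (sym (xor-cancelˡ a s)) (trans (cong (a xor_) (trans (xor-comm a s) eq)) (sym (xor-assoc a b c)))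

          -- γ takes each summand z j to z (j + 1), and z 0 is zero; being affine rather than
          -- linear, it adds a copy of 0·γ when the number of summands is even. For odd m the sum
          -- therefore changes only by z m, and for m = b this is a vector of C.
          step : ∀ m → Σz m ◃ γ ≗ λ p → (Σz m p xor z m p) xor (even m ∧ (0Ω ◃ γ) p)
          step zero    p = cong (_xor (0Ω ◃ γ) p) (◃-e 0Ω p)
          step (suc m) p = trans (affine (Σz m) (z m) p) (trans
            (cong₂ (λ a b → (a xor b) xor (0Ω ◃ γ) p) (step m p) (◃-∙ 0Ω (pow γ m) γ p))
            (shuffle (Σz m p xor z m p) (even m) ((0Ω ◃ γ) p) (z (suc m) p)))
            where
            shuffle : ∀ a ε b c → ((a xor (ε ∧ b)) xor c) xor b ≡ (a xor c) xor (not ε ∧ b)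
            shuffle a true  b c = trans (cong (_xor b) (trans (xor-assoc a b c) (trans (cong (a xor_) (xor-comm b c)) (sym (xor-assoc a c b)))))
              (trans (xor-assoc (a xor c) b b) (cong ((a xor c) xor_) (xor-same b)))
            shuffle a false b c = cong (λ a → (a xor c) xor b) (xor-identityʳ a)

          odd⇒¬even : ∀ m → ¬ 2 ∣ m → even m ≡ false
          odd⇒¬even zero          odd = contradiction (2 ∣0) odd
          odd⇒¬even (suc zero)    odd = refl
          odd⇒¬even (suc (suc m)) odd = trans (not-involutive (even m)) (odd⇒¬even m λ 2∣m → odd (∣m∣n⇒∣m+n (divides 1 refl) 2∣m))

        fixed-labelling : ∀ b → ¬ 2 ∣ b → (∀ p → φ (pow γ b) p ≡ p) → ∃[ v ] v ◃ γ ∼ v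
        fixed-labelling b odd fixes = Σz b , ∼-sym (∼-trans (C⇒∼ (Σz b) (related (pow γ b) (mkK (D-pow d b) fixes) λ _ → refl))
          (∼-reflexive λ p → sym (trans (step b p) (trans (cong (λ ε → (Σz b p xor z b p) xor (ε ∧ (0Ω ◃ γ) p)) (odd⇒¬even b odd))
            (xor-identityʳ _)))))

      -- A reversed element w in the fibre of e halves the translation subgroup; the
      -- missing dimension is supplied by v + v·w, where v is fixed by γ modulo C.
      module WithReflection {γ s w} (d : D γ) (sh : ∀ p → φ γ p ≡ nx s p) (r : Rv w) (fib-w : fib w ≡ fib e)
                            {v} (fixed : v ◃ γ ∼ v) where
        private
          q : Ω
          q = v ⊻ v ◃ w

          φ-w : φ w (fib e) ≡ fib e
          φ-w = trans (sym (fib-φ w)) fib-w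

          -- Otherwise some κ in K moves v to v·w. Both κ and w fix the fibre of e, so regularity
          -- gives w = κ, although κ is direct and w is not.
          q∉C : ¬ C q
          q∉C c = refute (∼-trans (C⇒∼ v c) (∼-reflexive λ p → xor-cancelˡ (v p) ((v ◃ w) p)))
            where
            refute : ¬ v ∼ v ◃ w
            refute (related κ (mkK dκ f) eq) = ¬both (subst D (◃-injective v (trans (f (fib e)) (sym φ-w)) eq) dκ) r

          -- Conjugation by the reversing w inverts the shift of γ, so this product has shift 0:
          -- modulo K, the elements γ and w satisfy a dihedral relation.
          κ₁ : X
          κ₁ = w ⁻ ∙ γ ∙ w ∙ γ

          κ₁∈K : K κ₁
          κ₁∈K = mkK (D-D (R-R (R-D (R-⁻ r) d) r) d) λ p → begin
            φ κ₁ p                              ≡⟨ trans (φ-∙ _ γ p) (cong (φ γ) (trans (φ-∙ _ w p) (cong (φ w) (φ-∙ _ γ p)))) ⟩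
            φ γ (φ w (φ γ (φ (w ⁻) p)))         ≡⟨ trans (sh _) (cong (nx s ∘ φ w) (sh _)) ⟩
            nx s (φ w (nx s (φ (w ⁻) p)))       ≡⟨ φ-R-nx r s _ ⟨
            φ w (φ (w ⁻) p)                     ≡⟨ φ-⁻ʳ w p ⟩
            p                                   ∎
            where open ≡-Reasoning

          wγ≡γ⁻wκ : γ ⁻ ∙ w ∙ κ₁ ≡ w ∙ γ
          wγ≡γ⁻wκ = begin
            γ ⁻ ∙ w ∙ (w ⁻ ∙ γ ∙ w ∙ γ)       ≡⟨ assoc _ _ γ ⟨
            γ ⁻ ∙ w ∙ (w ⁻ ∙ γ ∙ w) ∙ γ       ≡⟨ cong (_∙ γ) (assoc _ w _) ⟩
            γ ⁻ ∙ (w ∙ (w ⁻ ∙ γ ∙ w)) ∙ γ     ≡⟨ cong (λ u → γ ⁻ ∙ u ∙ γ) (∙-conj γ w) ⟩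
            γ ⁻ ∙ (γ ∙ w) ∙ γ                 ≡⟨ cong (_∙ γ) (assoc _ γ w) ⟨
            γ ⁻ ∙ γ ∙ w ∙ γ                   ≡⟨ cong (λ u → u ∙ w ∙ γ) (inverseˡ γ) ⟩
            e ∙ w ∙ γ                         ≡⟨ cong (_∙ γ) (identityˡ w) ⟩
            w ∙ γ                             ∎
            where open ≡-Reasoning

          -- wγ = γ⁻¹wκ₁, where γ⁻¹ fixes v modulo C and κ₁ acts trivially modulo C.
          fixed′ : v ◃ w ◃ γ ∼ v ◃ w
          fixed′ = ∼-sym (∼-trans (∼-◃ w (∼-trans (∼-reflexive v≗) (∼-◃ (γ ⁻) fixed)))
            (related κ₁ κ₁∈K λ p → trans (◃-cong κ₁ (◃-∙ v (γ ⁻) w) p)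
              (trans (◃-∙ v (γ ⁻ ∙ w) κ₁ p) (trans (cong (λ u → (v ◃ u) p) wγ≡γ⁻wκ) (sym (◃-∙ v w γ p))))))
            where
            v≗ : v ≗ v ◃ γ ◃ γ ⁻
            v≗ p = trans (◃-e v p) (trans (cong (λ u → (v ◃ u) p) (sym (inverseʳ γ))) (sym (◃-∙ v γ (γ ⁻) p)))

          sq : Ω
          sq p = q (φ (γ ⁻) p)

          -- Applying the affine γ to both v and v·w shifts their difference q, while each of them
          -- changes by a vector of C only.
          sq⊻q∈C : C (sq ⊻ q)
          sq⊻q∈C = C-resp (λ p → trans (xor-interchange ((v ◃ γ) p) (v p) ((v ◃ w ◃ γ) p) ((v ◃ w) p)) (cong (_xor q p) (sq≗ p)))
            (C-⊻ (∼⇒C fixed) (∼⇒C fixed′))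
            where
            sq≗ : v ◃ γ ⊻ v ◃ w ◃ γ ≗ sq
            sq≗ = surjective γ λ p → trans (◃-affine d v (v ◃ w) p) (cong q (sym (φ-⁻ˡ γ p)))

          V : Ω → Set
          V x = C x ⊎ C (x ⊻ q)

          xor-right : ∀ a b c → (a xor c) xor b ≡ (a xor b) xor c
          xor-right a b c = trans (xor-assoc a c b) (trans (cong (a xor_) (xor-comm c b)) (sym (xor-assoc a b c)))

          xor-twice : ∀ a b → (a xor b) xor b ≡ a
          xor-twice a b = trans (xor-assoc a b b) (trans (cong (a xor_) (xor-same b)) (xor-identityʳ a))

          V-⊻ : ∀ {x y} → V x → V y → V (x ⊻ y)
          V-⊻         (inj₁ c) (inj₁ c′) = inj₁ (C-⊻ c c′)
          V-⊻ {x} {y} (inj₁ c) (inj₂ c′) = inj₂ (C-resp (λ p → sym (xor-assoc (x p) (y p) (q p))) (C-⊻ c c′))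
          V-⊻ {x} {y} (inj₂ c) (inj₁ c′) = inj₂ (C-resp (λ p → xor-right (x p) (y p) (q p)) (C-⊻ c c′))
          V-⊻ {x} {y} (inj₂ c) (inj₂ c′) = inj₁ (C-resp (λ p → trans (xor-interchange (x p) (q p) (y p) (q p))
            (trans (cong ((x p xor y p) xor_) (xor-same (q p))) (xor-identityʳ _))) (C-⊻ c c′))

          V-shift : ∀ {x y} → V x → (∀ p → y (nx s p) ≡ x p) → V y
          V-shift {x} {y} (inj₁ c) eq = inj₁ (C-shift d c λ p → trans (cong y (sh p)) (eq p))
          V-shift {x} {y} (inj₂ c) eq = inj₂ (C-resp (λ p → cancel-middle (y p) (sq p) (q p)) (C-⊻ (C-shift {y = y ⊻ sq} d c
              λ p → cong₂ _xor_ (trans (cong y (sh p)) (eq p)) (cong q (φ-⁻ˡ γ p))) sq⊻q∈C))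
            where
            cancel-middle : ∀ a b c → (a xor b) xor (b xor c) ≡ a xor c
            cancel-middle a b c = trans (sym (xor-assoc (a xor b) b c)) (cong (_xor c) (xor-twice a b))

          K-w : ∀ {u} → Rv (base u) → K (base u ∙ w)
          K-w {u} ru = K-intro (R-R ru r) (trans (fib-∙ (base u) w) φ-w)

          -- Direct elements give their own translation vectors. Reversed ones are first brought
          -- into K by w, and adding q places their vectors in the other coset, so that together
          -- they fill C and C + q.
          param : ∀ u → D (base u) ⊎ Rv (base u) → Ω
          param u (inj₁ _) = 0Ω ◃ base u
          param u (inj₂ _) = 0Ω ◃ (base u ∙ w) ⊻ q

          C-K : ∀ {κ} → K κ → C (0Ω ◃ κ)
          C-K kκ = related _ kκ λ _ → refl

          param∈ : ∀ u o → V (param u o)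
          param∈ u (inj₁ du) = inj₁ (C-K (K-intro du refl))
          param∈ u (inj₂ ru) = inj₂ (C-resp (λ p → sym (xor-twice _ (q p))) (C-K (K-w {u} ru)))

          param-inj : ∀ u u′ o o′ → param u o ≗ param u′ o′ → u ≡ u′
          param-inj u u′ (inj₁ du) (inj₁ du′) eq = base-injective u u′ (K-injective 0Ω (K-intro du refl) (K-intro du′ refl) eq)
          param-inj u u′ (inj₁ du) (inj₂ ru′) eq = contradiction
            (C-resp (λ p → trans (cong ((0Ω ◃ (base u′ ∙ w)) p xor_) (eq p)) (xor-cancelˡ ((0Ω ◃ (base u′ ∙ w)) p) (q p)))
              (C-⊻ (C-K (K-w {u′} ru′)) (C-K (K-intro du refl)))) q∉C
          param-inj u u′ (inj₂ ru) (inj₁ du′) eq = contradiction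
            (C-resp (λ p → trans (cong ((0Ω ◃ (base u ∙ w)) p xor_) (sym (eq p))) (xor-cancelˡ ((0Ω ◃ (base u ∙ w)) p) (q p)))
              (C-⊻ (C-K (K-w {u} ru)) (C-K (K-intro du′ refl)))) q∉C
          param-inj u u′ (inj₂ ru) (inj₂ ru′) eq = base-injective u u′ (Automorphism.fun-injective (R w)
            (K-injective 0Ω (K-w {u} ru) (K-w {u′} ru′) λ p → trans (sym (xor-twice _ (q p))) (trans (cong (_xor q p) (eq p)) (xor-twice _ (q p)))))

          param-direct : ∀ {u} → D (base u) → ∀ o → param u o ≗ 0Ω ◃ base u
          param-direct du (inj₁ _)  p = refl
          param-direct {u} du (inj₂ ru) p = ⊥-elim (¬both {base u} du ru)

          param-reversed : ∀ {u} → Rv (base u) → ∀ o → param u o ≗ 0Ω ◃ (base u ∙ w) ⊻ q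
          param-reversed ru (inj₂ _)  p = refl
          param-reversed {u} ru (inj₁ du) p = ⊥-elim (¬both {base u} du ru)

          param-covers : ∀ {x} → V x → ∃[ u ] param u (orient (base u)) ≗ x
          param-covers {x} (inj₁ (related κ kκ eq)) = build (base-covers κ (fib-K kκ))
            where
            build : (∃[ u ] base u ≡ κ) → ∃[ u ] param u (orient (base u)) ≗ x
            build (u , e₁) = u , λ p → trans (param-direct (subst D (sym e₁) (K.direct kκ)) (orient (base u)) p)
              (trans (cong (λ w → (0Ω ◃ w) p) e₁) (eq p))
          -- κw⁻¹ reverses arcs, lies in the fibre of e, and is brought back to κ by w.
          param-covers {x} (inj₂ (related κ kκ eq)) = build (base-covers (κ ∙ w ⁻) (trans (fib-∙ κ (w ⁻))
              (trans (cong (φ (w ⁻)) (trans (fib-K kκ) (sym φ-w))) (φ-⁻ˡ w (fib e)))))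
            where
            build : (∃[ u ] base u ≡ κ ∙ w ⁻) → ∃[ u ] param u (orient (base u)) ≗ x
            build (u , e₁) = u , λ p → trans (param-reversed (subst Rv (sym e₁) (D-R (K.direct kκ) (R-⁻ r))) (orient (base u)) p)
              (trans (cong (_xor q p) (trans (cong (λ u → (0Ω ◃ u) p) (trans (cong (_∙ w) e₁) (cancel-ʳ⁻ κ w))) (eq p))) (xor-twice (x p) (q p)))

        reflection⇒Code : Code s
        reflection⇒Code = record
          { V            = V
          ; V-resp       = λ { eq (inj₁ c) → inj₁ (C-resp eq c) ; eq (inj₂ c) → inj₂ (C-resp (λ p → cong (_xor q p) (eq p)) c) }
          ; V-0          = inj₁ C-0
          ; V-⊻          = V-⊻
          ; V-shift      = V-shift
          ; param        = λ u → param u (orient (base u))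
          ; param∈       = λ u → param∈ u (orient (base u))
          ; param-inj    = λ u u′ → param-inj u u′ (orient (base u)) (orient (base u′))
          ; param-covers = param-covers }

      regular⇒Code : ∀ A b → ¬ 2 ∣ b → A * b ≡ n → Code A
      regular⇒Code A b odd A*b≡n = build shift-2 (half b odd)
        where
        half : ∀ b → ¬ 2 ∣ b → ∃[ h ] suc b ≡ h * 2
        half zero          odd = contradiction (2 ∣0) odd
        half (suc zero)    odd = 1 , refl
        half (suc (suc b)) odd = let h , eq = half b λ 2∣b → odd (∣m∣n⇒∣m+n (divides 1 refl) 2∣b) in suc h , cong (2 +_) eq
        cases : ∀ {γ} → D γ → (∀ p → φ γ p ≡ nx A p) → (∃[ v ] v ◃ γ ∼ v) → Dec (∃[ u ] Rv (base u)) → Code A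
        cases d sh (_ , fixed) (yes (u , r)) = WithReflection.reflection⇒Code d sh r refl fixed
        cases d sh _           (no  ¬r)      = all-direct⇒Code d sh λ u → direct u (orient (base u))
          where
          direct : ∀ u → D (base u) ⊎ Rv (base u) → D (base u)
          direct u (inj₁ du) = du
          direct u (inj₂ ru) = contradiction (u , λ {x} {y} → ru {x} {y}) ¬r
        reversed? : ∀ u → D (base u) ⊎ Rv (base u) → Dec (Rv (base u))
        reversed? u (inj₁ du) = no λ ru → ¬both {base u} du λ {x} {y} → ru {x} {y}
        reversed? u (inj₂ ru) = yes λ {x} {y} → ru {x} {y}
        build : (∃[ γ ] D γ × (∀ p → φ γ p ≡ nx 2 p)) → (∃[ h ] suc b ≡ h * 2) → Code A
        build (γ₂ , d₂ , sh₂) (h , 1+b≡2h) = cases d sh (fixed-labelling d b odd fixes) (any-vec? λ u → reversed? u (orient (base u)))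
          where
          open ≡-Reasoning
          -- γ₂ has shift 2 and 2h = b + 1, so this power has shift A(b + 1) = A + n, which is A in
          -- ℤₙ.
          γ = pow γ₂ (A * h)
          d : D γ
          d = D-pow d₂ (A * h)
          steps : A * h * 2 ≡ A + n
          steps = begin
            A * h * 2      ≡⟨ *-assoc A h 2 ⟩
            A * (h * 2)    ≡⟨ cong (A *_) 1+b≡2h ⟨
            A * suc b      ≡⟨ *-suc A b ⟩
            A + A * b      ≡⟨ cong (A +_) A*b≡n ⟩
            A + n          ∎
          sh : ∀ p → φ γ p ≡ nx A p
          sh p = begin
            φ γ p              ≡⟨ φ-pow sh₂ (A * h) p ⟩
            nx (A * h * 2) p   ≡⟨ cong (λ m → nx m p) steps ⟩
            nx (A + n) p       ≡⟨ iter-+ next A n p ⟩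
            nx A (nx n p)      ≡⟨ cong (nx A) (nx-n p) ⟩
            nx A p             ∎
          fixes : ∀ p → φ (pow γ b) p ≡ p
          fixes p = trans (φ-pow sh b p) (trans (cong (λ m → nx m p) (trans (*-comm b A) A*b≡n)) (nx-n p))

-- Labellings as words of a quasi-cyclic code, and the small cases.

module Columns where

  import Data.Bool.Properties as Bool
  open import Data.Fin.Base using (Fin; zero; suc; toℕ; inject₁; fromℕ; cast; combine; remQuot)
  open import Data.Fin.Properties using (toℕ<n; toℕ-injective; toℕ-inject₁; toℕ-fromℕ; toℕ-cast; toℕ-combine; cast-involutive; remQuot-combine; combine-remQuot; nonZeroIndex)
  open import Data.Nat.DivMod using (m<n⇒m%n≡m; n%n≡0; [m+n]%n≡m%n)
  open import Data.Nat.Divisibility using (_∣_; divides; ∣-refl; _∣0; 1∣_)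
  open import Data.Nat.Properties
  open import Data.Vec.Base as Vec using (lookup; tabulate; replicate; map; last)
  open import Data.Vec.Properties using (lookup∘tabulate; tabulate-cong; lookup-map; lookup-zipWith; lookup-replicate; ≡-dec)
  open import Relation.Nullary.Decidable using (map′)
  open import Defs
  open Factorisation using (any-vec?)
  open Totient
  open CyclicGroup
  open ShiftRegister using (_⊞_)
  open DivisorSelection
  open CyclicCode-dimension
  open QuasiCyclicCode-dimension
  open LocalStructure using (lookup-init; lookup-ext; lower)
  open RegularGroup

  -- ℤₙ with n = A b as b consecutive rows of length A: column j is an orbit of i ↦ i + A.
  module _ (A b′ : ℕ) where
    private
      b = suc b′
      n = A * b

      position : Fin b → Fin A → Fin n
      position l j = cast (*-comm b A) (combine l j)

      toℕ-position : ∀ l j → toℕ (position l j) ≡ A * toℕ l + toℕ j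
      toℕ-position l j = trans (toℕ-cast (*-comm b A) (combine l j)) (toℕ-combine l j)

      coordinates : Fin n → Fin b × Fin A
      coordinates p = remQuot A (cast (*-comm A b) p)

      coordinates-position : ∀ l j → coordinates (position l j) ≡ (l , j)
      coordinates-position l j = trans (cong (remQuot A) (cast-involutive (*-comm A b) (*-comm b A) (combine l j))) (remQuot-combine l j)

      position-coordinates : ∀ p → position (proj₁ (coordinates p)) (proj₂ (coordinates p)) ≡ p
      position-coordinates p = trans (cong (cast (*-comm b A)) (combine-remQuot {b} A _)) (cast-involutive (*-comm b A) (*-comm A b) p)

      position-elim : {P : Fin n → Set} → (∀ l j → P (position l j)) → ∀ p → P p
      position-elim {P} h p = subst P (position-coordinates p) (h (proj₁ (coordinates p)) (proj₂ (coordinates p)))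

      boundary : (l : Fin b) → toℕ l < b′ ⊎ toℕ l ≡ b′
      boundary l = m≤n⇒m<n∨m≡n (s≤s⁻¹ (toℕ<n l))

      nx-position : ∀ l j → nx A (position l j) ≡ position (next l) j
      nx-position l j = toℕ-injective (trans (toℕ-nx A (position l j)) (trans (cong (_% n) eq₁) (trans (wrap (boundary l)) (sym (toℕ-position (next l) j)))))
        where
        instance _ = nonZeroIndex (position l j)
        open ≡-Reasoning
        eq₁ : A + toℕ (position l j) ≡ A * suc (toℕ l) + toℕ j
        eq₁ = trans (cong (_+_ A) (toℕ-position l j)) (trans (sym (+-assoc A (A * toℕ l) (toℕ j))) (cong (_+ toℕ j) (sym (*-suc A (toℕ l)))))
        wrap : toℕ l < b′ ⊎ toℕ l ≡ b′ → (A * suc (toℕ l) + toℕ j) % n ≡ A * toℕ (next l) + toℕ j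
        wrap (inj₁ l<b′) = begin
          (A * suc (toℕ l) + toℕ j) % n     ≡⟨ cong (λ m → (A * m + toℕ j) % n) next-l ⟨
          (A * toℕ (next l) + toℕ j) % n    ≡⟨ cong (_% n) (toℕ-position (next l) j) ⟨
          toℕ (position (next l) j) % n     ≡⟨ m<n⇒m%n≡m (toℕ<n (position (next l) j)) ⟩
          toℕ (position (next l) j)         ≡⟨ toℕ-position (next l) j ⟩
          A * toℕ (next l) + toℕ j          ∎
          where
          next-l : toℕ (next l) ≡ suc (toℕ l)
          next-l = trans (toℕ-next l) (m<n⇒m%n≡m (s≤s l<b′))
        wrap (inj₂ l≡b′) = begin
          (A * suc (toℕ l) + toℕ j) % n     ≡⟨ cong (λ m → (A * suc m + toℕ j) % n) l≡b′ ⟩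
          (n + toℕ j) % n                   ≡⟨ cong (_% n) (+-comm n (toℕ j)) ⟩
          (toℕ j + n) % n                   ≡⟨ [m+n]%n≡m%n (toℕ j) n ⟩
          toℕ j % n                         ≡⟨ m<n⇒m%n≡m (≤-trans (toℕ<n j) (m≤m*n A b)) ⟩
          toℕ j                             ≡⟨ cong (_+ toℕ j) (trans (cong (A *_) next-l) (*-zeroʳ A)) ⟨
          A * toℕ (next l) + toℕ j          ∎
          where
          next-l : toℕ (next l) ≡ 0
          next-l = trans (toℕ-next l) (trans (cong (λ m → suc m % b) l≡b′) (n%n≡0 b))

      lookup-last : ∀ {m} (x : Vec Bool (suc m)) → last x ≡ lookup x (fromℕ m)
      lookup-last (a ∷ [])        = refl
      lookup-last (a ∷ x@(_ ∷ _)) = lookup-last x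

      lookup-rot : ∀ (x : Vec Bool b) l → lookup (rot x) (next l) ≡ lookup x l
      lookup-rot x l with boundary l
      ... | inj₁ l<b′ = cases (lower l l<b′)
        where
        cases : (∃[ l′ ] inject₁ l′ ≡ l) → lookup (rot x) (next l) ≡ lookup x l
        cases (l′ , eq) = trans (cong (lookup (rot x)) (toℕ-injective {j = suc l′} (trans (toℕ-next l)
            (trans (m<n⇒m%n≡m (s≤s l<b′)) (cong suc (trans (cong toℕ (sym eq)) (toℕ-inject₁ l′)))))))
          (trans (lookup-init x l′) (cong (lookup x) eq))
      ... | inj₂ l≡b′ = trans (cong (lookup (rot x)) (toℕ-injective {j = zero} (trans (toℕ-next l)
            (trans (cong (λ m → suc m % b) l≡b′) (n%n≡0 b)))))
          (trans (lookup-last x) (cong (lookup x) (toℕ-injective (trans (toℕ-fromℕ b′) (sym l≡b′)))))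

      labelling : Blocks b A → Fin n → Bool
      labelling M p = lookup (lookup M (proj₂ (coordinates p))) (proj₁ (coordinates p))

      blocks : (Fin n → Bool) → Blocks b A
      blocks y = tabulate λ j → tabulate λ l → y (position l j)

      labelling-position : ∀ M l j → labelling M (position l j) ≡ lookup (lookup M j) l
      labelling-position M l j = cong (λ c → lookup (lookup M (proj₂ c)) (proj₁ c)) (coordinates-position l j)

      lookup-blocks : ∀ y l j → lookup (lookup (blocks y) j) l ≡ y (position l j)
      lookup-blocks y l j = trans (cong (λ v → lookup v l) (lookup∘tabulate (λ j → tabulate λ l → y (position l j)) j))
        (lookup∘tabulate (λ l → y (position l j)) l)

      labelling-blocks : ∀ y → labelling (blocks y) ≗ y
      labelling-blocks y = position-elim λ l j → trans (labelling-position (blocks y) l j) (lookup-blocks y l j)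

      blocks-cong : ∀ {y z} → y ≗ z → blocks y ≡ blocks z
      blocks-cong eq = tabulate-cong λ j → tabulate-cong λ l → eq (position l j)

      blocks-labelling : ∀ M → blocks (labelling M) ≡ M
      blocks-labelling M = lookup-ext λ j → lookup-ext λ l → trans (lookup-blocks (labelling M) l j) (labelling-position M l j)

    module _ {k} (n≥5 : 5 ≤ n) (code : Group-level.Code n k n≥5 A) where
      open Group-level n k n≥5 using (Ω; 0Ω; _⊻_)
      open Group-level.Code code

      private
        V′ : Blocks b A → Set
        V′ M = V (labelling M)

      Code-dim : Dim V′ (suc (suc k))
      Code-dim = record
        { elem      = blocks ∘ param
        ; elem∈     = λ u → V-resp (λ p → sym (labelling-blocks (param u) p)) (param∈ u)
        ; injective = λ u u′ eq → param-inj u u′ λ p → trans (sym (labelling-blocks (param u) p))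
            (trans (cong (λ M → labelling M p) eq) (labelling-blocks (param u′) p))
        ; covers    = λ {M} M∈ → let u , eq = param-covers M∈ in u , trans (blocks-cong eq) (blocks-labelling M) }

      Code-quasiCyclic : QuasiCyclicCode V′
      Code-quasiCyclic = record
        -- Membership is decided by running through all values of the parametrisation.
        { decide = λ M → map′ (λ { (u , eq) → subst V′ eq (Dim.elem∈ Code-dim u) }) (Dim.covers Code-dim)
            (any-vec? λ u → ≡-dec (≡-dec Bool._≟_) (blocks (param u)) M)
        ; 0∈     = V-resp (position-elim λ l j → sym (trans (labelling-position (replicate A (replicate b false)) l j)
            (trans (cong (λ v → lookup v l) (lookup-replicate j (replicate b false))) (lookup-replicate l false)))) V-0
        ; ⊞∈     = λ {M} {N} M∈ N∈ → V-resp (position-elim λ l j → sym (trans (labelling-position (M ⊞⊞ N) l j)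
            (trans (cong (λ v → lookup v l) (lookup-zipWith _⊞_ j M N)) (trans (lookup-zipWith _xor_ l (lookup M j) (lookup N j))
            (sym (cong₂ _xor_ (labelling-position M l j) (labelling-position N l j))))))) (V-⊻ M∈ N∈)
        ; rot∈   = λ {M} M∈ → V-shift M∈ (position-elim λ l j → trans (cong (labelling (map rot M)) (nx-position l j))
            (trans (labelling-position (map rot M) (next l) j) (trans (cong (λ v → lookup v (next l)) (lookup-map j rot M))
            (trans (lookup-rot (lookup M j) l) (sym (labelling-position M l j)))))) }

  module Main (A b′ : ℕ) (odd : ¬ 2 ∣ suc b′) where
    open Necessity b′ odd using (Combination; code-combination)

    single : ∀ c {d} → d ∣ suc b′ → c * ω d ≤ A * φ d → Combination A (c * ω d)
    single c {d} d∣b bound = at-point d (λ _ → c) , bounds , sym (trans (sum-cong (divisors (suc b′)) (λ {x} _ → at-ω x))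
        (sum-at-point (divisors-unique (suc b′)) (∈-divisors⁺ (s≤s z≤n) d∣b)))
      where
      bounds : ∀ x → x ∣ suc b′ → at-point d (λ _ → c) x * ω x ≤ A * φ x
      bounds x _ with x ≟ d
      ... | yes refl = ≤-trans (≤-reflexive (cong (_* ω x) (at-point-≡ x (λ _ → c)))) bound
      ... | no  x≢d  = ≤-trans (≤-reflexive (cong (_* ω x) (at-point-≢ (λ _ → c) x≢d))) z≤n
      at-ω : ∀ x → at-point d (λ _ → c) x * ω x ≡ at-point d (λ x → c * ω x) x
      at-ω x with x ≟ d
      ... | yes refl = trans (cong (_* ω x) (at-point-≡ x (λ _ → c))) (sym (at-point-≡ x (λ x → c * ω x)))
      ... | no  x≢d  = trans (cong (_* ω x) (at-point-≢ (λ _ → c) x≢d)) (sym (at-point-≢ (λ x → c * ω x) x≢d))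

    -- The divisor 1 alone suffices, since ω(1) = φ(1) = 1.
    small : ∀ k → k ≤ A → Combination A k
    small k k≤A = subst (Combination A) (*-identityʳ k) (single k (1∣ suc b′) (*-monoˡ-≤ 1 k≤A))

    large : ∀ {k} (n≥5 : 5 ≤ A * suc b′) (n≥3 : 3 ≤ A * suc b′) → IsCayleyGraph (PX (A * suc b′) (suc (suc k)) n≥3) →
            Combination A (suc (suc k))
    large {k} n≥5 n≥3 cayley = code-combination (Code-quasiCyclic A b′ n≥5 code) (Code-dim A b′ n≥5 code)
      where
      open Group-level (A * suc b′) k n≥5
      code = Classification.regular⇒Code (Cayley⇒regular n≥3 cayley) A (suc b′) odd refl

  -- Apart from the trivial cases k = 1 and b = 1, only n = 3 is below the bound n ≥ 5.
  Cayley⇒Combination : ∀ A b′ (1≤A : 1 ≤ A) (odd : ¬ 2 ∣ suc b′) k (n≥3 : 3 ≤ A * suc b′) → 1 ≤ k → k ≤ A * suc b′ ∸ 1 →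
                       IsCayleyGraph (PX (A * suc b′) k n≥3) → Necessity.Combination b′ odd A k
  Cayley⇒Combination A b′ 1≤A odd (suc zero) n≥3 _ _ _ = Main.small A b′ odd 1 1≤A
  Cayley⇒Combination A zero 1≤A odd k@(suc (suc _)) n≥3 _ k≤ _ =
    Main.small A 0 odd k (≤-trans k≤ (≤-trans (m∸n≤m (A * 1) 1) (≤-reflexive (*-identityʳ A))))
  Cayley⇒Combination A (suc zero) 1≤A odd k n≥3 _ _ _ = contradiction ∣-refl odd
  -- n = 3 and k = 2: as ω(3) = φ(3) = 2, the coefficient 1 at d = 3 is admissible.
  Cayley⇒Combination (suc zero) (suc (suc zero)) 1≤A odd (suc (suc zero)) n≥3 _ _ _ =
    Main.single 1 2 odd 1 ∣-refl ≤-refl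
  Cayley⇒Combination (suc zero) (suc (suc zero)) 1≤A odd (suc (suc (suc k))) n≥3 _ (s≤s (s≤s ())) _
  Cayley⇒Combination (suc zero) (suc (suc (suc zero))) 1≤A odd k n≥3 _ _ _ = contradiction (divides 2 refl) odd
  Cayley⇒Combination (suc zero) b′@(suc (suc (suc (suc c)))) 1≤A odd (suc (suc k)) n≥3 _ _ cayley =
    Main.large 1 b′ odd (s≤s (s≤s (s≤s (s≤s (s≤s z≤n))))) n≥3 cayley
  -- A ≥ 2 and b ≥ 3 give n ≥ 6.
  Cayley⇒Combination A@(suc (suc A′)) b′@(suc (suc c)) 1≤A odd (suc (suc k)) n≥3 _ _ cayley =
    Main.large A b′ odd (≤-trans (s≤s (s≤s (s≤s (s≤s (s≤s z≤n))))) (*-mono-≤ {2} {A} {3} {suc b′} (s≤s (s≤s z≤n)) (s≤s (s≤s (s≤s z≤n))))) n≥3 cayley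

-- Rational bounds, and the theorem.

open import Data.Integer.Base as ℤ using (+_)
import Data.Integer.Properties as ℤ
open import Data.List.Base using (map)
open import Data.Nat.Divisibility using (_∣_; _∣0)
open import Data.Nat.ListAction using (sum)
open import Data.Nat.Properties using (≤-trans; ≤-reflexive; *-identityʳ; m^n>0)
open import Data.Rational.Unnormalised.Base using (_/_; *≤*) renaming (_≤_ to _≤ᵘ_)
open import Data.Rational.Unnormalised.Properties using (drop-*≤*)
open import Function.Bundles using (_⇔_; mk⇔)
open import Defs
open ShiftRegister using (divisor⇒Cayley)
open DivisorSelection using (module Multiplicity)
open Columns using (Cayley⇒Combination)

-- Cross-multiplication; the denominator is a successor because ω(d) is one by definition.
≤ᵘ⇒*≤ : ∀ x y w → + x / 1 ≤ᵘ + y / suc w → x * suc w ≤ y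
≤ᵘ⇒*≤ x y w le = ≤-trans (ℤ.drop‿+≤+ (subst₂ ℤ._≤_ (sym (ℤ.pos-* x (suc w))) (sym (ℤ.pos-* y 1)) (drop-*≤* le)))
  (≤-reflexive (*-identityʳ y))

*≤⇒≤ᵘ : ∀ x y w → x * suc w ≤ y → + x / 1 ≤ᵘ + y / suc w
*≤⇒≤ᵘ x y w le = *≤* (subst₂ ℤ._≤_ (ℤ.pos-* x (suc w)) (ℤ.pos-* y 1)
  (ℤ.+≤+ (≤-trans le (≤-reflexive (sym (*-identityʳ y))))))

corollary2 : ∀ (a b k : ℕ) → ¬ 2 ∣ b → let n = 2 ^ a * b in
    (n≥3 : 3 ≤ n) → 1 ≤ k → k ≤ n ∸ 1 →
    IsCayleyGraph (PX n k n≥3) ⇔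
    (Σ[ α ∈ (ℕ → ℕ) ] (∀ d → d ∣ b → + α d / 1 ≤ᵘ + (2 ^ a * φ d) / ω d)
    × k ≡ sum (map (λ d → α d * ω d) (divisors b)))
corollary2 a zero     k       odd n≥3 1≤k k≤n-1 = contradiction (2 ∣0) odd
corollary2 a (suc b′) (suc k) odd n≥3 1≤k k≤n-1 = mk⇔ necessity sufficiency
  where
  necessity : IsCayleyGraph (PX (2 ^ a * suc b′) (suc k) n≥3) →
              Σ[ α ∈ (ℕ → ℕ) ] (∀ d → d ∣ suc b′ → + α d / 1 ≤ᵘ + (2 ^ a * φ d) / ω d)
              × suc k ≡ sum (map (λ d → α d * ω d) (divisors (suc b′)))
  necessity cayley =
    let α , bound , k≡ = Cayley⇒Combination (2 ^ a) b′ (m^n>0 2 a) odd (suc k) n≥3 1≤k k≤n-1 cayley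
    in  α , (λ d d∣b → *≤⇒≤ᵘ (α d) (2 ^ a * φ d) (pred (ω d)) (bound d d∣b)) , k≡
  sufficiency : (Σ[ α ∈ (ℕ → ℕ) ] (∀ d → d ∣ suc b′ → + α d / 1 ≤ᵘ + (2 ^ a * φ d) / ω d)
                × suc k ≡ sum (map (λ d → α d * ω d) (divisors (suc b′)))) →
                IsCayleyGraph (PX (2 ^ a * suc b′) (suc k) n≥3)
  sufficiency (α , bound , k≡) =
    let h , h∣ = Multiplicity.divisor-of-degree b′ odd a α (λ d d∣b → ≤ᵘ⇒*≤ (α d) (2 ^ a * φ d) (pred (ω d)) (bound d d∣b)) k≡
    in  divisor⇒Cayley n≥3 h h∣
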